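{- Let $p\ge5$ be a prime, $k>1$, $A=\mathbb{Z}_p^k$, and let $T$ be a caterpillar with spine path $s_1s_2s_3$ and $|V(T)|=p^k$, where $X,Y,Z$ are the sets of leaves attached to $s_1,s_2,s_3$ respectively. Let $\alpha,\beta,\gamma\in\{0,1,\dots,p-1\}$ be the residues of $|X|,|Y|,|Z|$ modulo $p$. Then $T$ is $A$-rainbow if and only if none of the following holds: 1. $\beta=p-2$ and either ($\alpha=0$, $\gamma=p-1$) or ($\alpha=p-1$, $\gamma=0$); 2. $|Y|=0$ and either ($\alpha=p-1$, $\gamma=p-2$) or ($\alpha=p-2$, $\gamma=p-1$); 3. $|Y|=1$ and either ($\alpha=p-1$, $\gamma=p-3$) or ($\alpha=p-3$, $\gamma=p-1$).
   Context: For an Abelian group $A$ and a tree $T$ with $|V(T)|=|A|$, a labeling $f\colon V(T)\to A$ induces the edge labeling $uv\mapsto f(u)+f(v)$. $f$ is an $A$-rainbow labeling if $f$ is a bijection and all edges receive distinct labels; $T$ is $A$-rainbow if it admits such a labeling. A caterpillar with three spine vertices is the path $s_1s_2s_3$ with some number of leaves attached to each $s_i$. -}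

module Defs where

open import Data.Nat using (ℕ; zero; suc; _+_; _∸_; _≡ᵇ_)
open import Data.Nat.DivMod using (_mod_; _%_)
open import Data.Fin using (Fin; toℕ) renaming (zero to fzero; suc to fsuc)
open import Data.Vec using (Vec; zipWith)
open import Data.Sum using (_⊎_; inj₁; inj₂)
open import Data.Product using (_×_; Σ)
open import Function.Definitions using (Bijective; Injective)
open import Relation.Binary.PropositionalEquality using (_≡_)

addMod : ∀ {p} → Fin p → Fin p → Fin p
addMod {suc n} a b = (toℕ a + toℕ b) mod (suc n)

Zpk : ℕ → ℕ → Set
Zpk p k = Vec (Fin p) k

_⊕_ : ∀ {p k} → Zpk p k → Zpk p k → Zpk p k
_⊕_ = zipWith addMod

-- residue of n modulo p (p = 0 never occurs in use; returns n then)
res : ℕ → ℕ → ℕ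
res zero n = n
res (suc m) n = n % suc m

-- Caterpillar with spine s₁ s₂ s₃ and x, y, z leaves at s₁, s₂, s₃.
-- Vertices: spine (Fin 3: s₁,s₂,s₃) ⊎ X ⊎ Y ⊎ Z.
Vertex : ℕ → ℕ → ℕ → Set
Vertex x y z = Fin 3 ⊎ (Fin x ⊎ (Fin y ⊎ Fin z))

s₁ s₂ s₃ : ∀ {x y z} → Vertex x y z
s₁ = inj₁ fzero
s₂ = inj₁ (fsuc fzero)
s₃ = inj₁ (fsuc (fsuc fzero))

-- Edges: spine edges (Fin 2: s₁s₂, s₂s₃) ⊎ one pendant edge per leaf.
Edge : ℕ → ℕ → ℕ → Set
Edge x y z = Fin 2 ⊎ (Fin x ⊎ (Fin y ⊎ Fin z))

ends : ∀ {x y z} → Edge x y z → Vertex x y z × Vertex x y z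
ends (inj₁ fzero) = s₁ Data.Product., s₂
ends (inj₁ (fsuc fzero)) = s₂ Data.Product., s₃
ends (inj₂ (inj₁ i)) = s₁ Data.Product., inj₂ (inj₁ i)
ends (inj₂ (inj₂ (inj₁ j))) = s₂ Data.Product., inj₂ (inj₂ (inj₁ j))
ends (inj₂ (inj₂ (inj₂ l))) = s₃ Data.Product., inj₂ (inj₂ (inj₂ l))

edgeLabel : ∀ {p k x y z} → (Vertex x y z → Zpk p k) → Edge x y z → Zpk p k
edgeLabel f e = f (Data.Product.proj₁ (ends e)) ⊕ f (Data.Product.proj₂ (ends e))

IsRainbowLabeling : ∀ p k x y z → (Vertex x y z → Zpk p k) → Set
IsRainbowLabeling p k x y z f =
  Bijective _≡_ _≡_ f × Injective _≡_ _≡_ (edgeLabel {p} {k} {x} {y} {z} f)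

Rainbow : ∀ p k x y z → Set
Rainbow p k x y z = Σ (Vertex x y z → Zpk p k) (IsRainbowLabeling p k x y z)

{-# OPTIONS --safe #-}
module Submission where

open import Defs

-- Record each edge by its end away from s₂ (or its leaf) v and by the vertex at its other end; a
-- rainbow labeling then shifts the p^k - 1 elements v different from a₂ injectively by a₁, a₂ or
-- a₃, where aᵢ is the label of sᵢ.
--
-- Necessity. Exactly one element m is not an edge label. Summing over the whole group in two ways
-- gives x a₁ + (y + 1) a₂ + z a₃ + m = 0. In the first exceptional case this makes m the label of
-- a spine edge. In the second, a₁ + a₃ can be no edge label, so it equals m, which forces two
-- spine labels to agree. In the third the leaf of s₂ must carry the label a₁ + a₃ - a₂; then the
-- elements of the line through a₁ and a₃ are forced one after the other to be leaves of s₁ or s₃,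
-- until the positions of m and of that leaf lead to a contradiction.
--
-- Sufficiency. Split the group into cosets of the line generated by the first coordinate and put
-- the spine on that line. A coset without spine can carry A, B, C leaves of the three kinds
-- whenever A + B + C = p and A a₁ + B a₂ + C a₃ = 0, by exchanging two intervals; in particular it
-- can be given to one kind entirely. Hence, unless y is 0 or 1, only the residues α, β, γ of the
-- numbers of leaves matter. If α + β + γ = p - 3 the usual caterpillar labeling of one line
-- suffices. If none of α + 1, β + 1, γ + 1 is p and they sum to 2p, there is an n such that n and
-- n + 1 times these numbers have residues with sums 2p and p, and this splits the leaves between
-- a caterpillar and one further line. The remaining residues are settled by explicit arrangements
-- on at most three lines; only for x = 0, y ≡ -1, z ≡ -2, up to reversal, is a₁ taken outside the
-- line of a₂ and a₃.

-- With the spine on the line, the condition A a₁ + B a₂ + C a₃ = 0 is forced on a coset without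
-- spine: its p elements and their p labels each fill a whole coset, and a coset of a line sums to
-- zero because p is odd. This is also why a₁ leaves the line for x = 0, y ≡ -1, z ≡ -2. Otherwise
-- every coset without spine would have B + C = p and B a₂ + C a₃ = 0, hence C (a₃ - a₂) = 0, and
-- would be of one kind only; the spine coset, with only p - 3 leaves, would need at least p - 1 of
-- them at s₂. The balancing by n and n + 1 breaks down when a residue is p - 1, since its successor
-- is then a multiple of p and never wraps around. All exceptional cases lie there: for α = p - 1
-- and β + γ = p - 2 they are exactly γ = 0, |Y| = 0 and |Y| = 1.

module Caterpillars where

  open import Data.Bool using (Bool; true; false; if_then_else_)
  open import Data.Nat as ℕ using (ℕ; zero; suc; z≤n; s≤s; _≡ᵇ_)
  import Data.Nat.Properties as ℕ
  import Data.Nat.DivMod as ℕ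
  open import Data.Nat.Divisibility using (divides) renaming (_∣_ to _∣ℕ_)
  import Data.Nat.Divisibility as Div
  open import Data.Nat.Coprimality using (prime⇒coprime; coprime-Bézout)
  open import Data.Nat.GCD using (module Bézout)
  open import Data.Nat.Primality using (Prime; euclidsLemma; prime⇒irreducible; prime⇒nonTrivial)
  import Data.Nat.Tactic.RingSolver as ℕSolver
  open import Data.Integer as ℤ using (ℤ; +_; -[1+_]; _+_; _*_; -_; _-_; 0ℤ; 1ℤ; ∣_∣)
  import Data.Integer.Properties as ℤ
  open import Data.Integer.DivMod using (_%ℕ_; _/ℕ_; n%ℕd<d; a≡a%ℕn+[a/ℕn]*n)
  open import Data.Integer.Tactic.RingSolver using (solve-∀)
  open import Data.Fin as Fin using (Fin; toℕ; fromℕ<)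
  import Data.Fin.Properties as Fin
  open import Data.Vec as Vec using (Vec; []; _∷_; lookup; tabulate; replicate)
  import Data.Vec.Properties as Vec
  open import Data.List as List
    using (List; []; _∷_; _++_; length; map; concat; allFin; cartesianProductWith)
  import Data.List.Properties as List
  open import Data.List.Membership.Propositional using (_∈_)
  open import Data.List.Membership.Propositional.Properties
    using (∈-∃++; ∈-++⁻; ∈-++⁺ˡ; ∈-++⁺ʳ; ∈-allFin; ∈-map⁺; ∈-map⁻; ∈-lookup; ∈-cartesianProductWith⁺)
  open import Data.List.Relation.Unary.Any using (here; there)
  open import Data.List.Relation.Unary.All as All using (All; []; _∷_)
  import Data.List.Relation.Unary.All.Properties as All
  open import Data.List.Relation.Unary.AllPairs as AllPairs using (AllPairs; []; _∷_)
  import Data.List.Relation.Unary.AllPairs.Properties as AllPairs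
  open import Data.List.Relation.Unary.Unique.Propositional using (Unique)
  import Data.List.Relation.Unary.Unique.Propositional.Properties as Unique
  open import Data.List.Relation.Binary.Permutation.Propositional
    using (_↭_; refl; prep; swap; trans; ↭-refl; ↭-sym; ↭-trans; ↭⇒↭ₛ)
  import Data.List.Relation.Binary.Permutation.Propositional.Properties as Perm
  import Data.List.Relation.Binary.Permutation.Setoid.Properties as SetoidPerm
  open import Data.Maybe using (Maybe; just; nothing)
  open import Data.Product using (Σ; ∃; _×_; _,_; proj₁; proj₂)
  open import Data.Sum using (_⊎_; inj₁; inj₂)
  open import Data.Sum.Properties using (inj₁-injective; inj₂-injective)
  open import Data.Empty using (⊥; ⊥-elim)
  open import Data.Unit using (⊤; tt)
  open import Function using (_∘_; id; case_of_)
  open import Relation.Nullary using (¬_; yes; no)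
  open import Relation.Binary.PropositionalEquality hiding ([_]; trans)
  import Relation.Binary.PropositionalEquality as ≡

  -- Arithmetic modulo `p` and the group of residue vectors.

  module Residues (p-1 : ℕ) where

    p : ℕ
    p = suc p-1

    infix 4 _≈_ _≉_

    record _≈_ (x y : ℤ) : Set where
      constructor by
      field
        quot : ℤ
        eq   : x ≡ y + quot * + p

    _≉_ : ℤ → ℤ → Set
    x ≉ y = ¬ x ≈ y

    ≈-refl : ∀ {x} → x ≈ x
    ≈-refl {x} = by 0ℤ (sym (≡.trans (cong (_+_ x) (ℤ.*-zeroˡ (+ p))) (ℤ.+-identityʳ x)))

    ≡⇒≈ : ∀ {x y} → x ≡ y → x ≈ y
    ≡⇒≈ refl = ≈-refl

    private
      sym-id : ∀ y k q → y ≡ y + k * q + (- k) * q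
      sym-id = solve-∀
      trans-id : ∀ z k l q → z + l * q + k * q ≡ z + (l + k) * q
      trans-id = solve-∀
      plus-id : ∀ y w k l q → y + k * q + (w + l * q) ≡ y + w + (k + l) * q
      plus-id = solve-∀
      times-id : ∀ y w k l q →
        (y + k * q) * (w + l * q) ≡ y * w + (y * l + k * w + k * l * q) * q
      times-id = solve-∀
      neg-id : ∀ y k q → - (y + k * q) ≡ - y + (- k) * q
      neg-id = solve-∀
      diff-id : ∀ x y → x ≡ y + (x - y)
      diff-id = solve-∀

    ≈-sym : ∀ {x y} → x ≈ y → y ≈ x
    ≈-sym {y = y} (by k refl) = by (- k) (sym-id y k (+ p))

    ≈-trans : ∀ {x y z} → x ≈ y → y ≈ z → x ≈ z
    ≈-trans {z = z} (by k refl) (by l refl) = by (l + k) (trans-id z k l (+ p))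

    +-cong : ∀ {x y z w} → x ≈ y → z ≈ w → x + z ≈ y + w
    +-cong {y = y} {w = w} (by k refl) (by l refl) = by (k + l) (plus-id y w k l (+ p))

    *-cong : ∀ {x y z w} → x ≈ y → z ≈ w → x * z ≈ y * w
    *-cong {y = y} {w = w} (by k refl) (by l refl) = by (y * l + k * w + k * l * + p) (times-id y w k l (+ p))

    neg-cong : ∀ {x y} → x ≈ y → - x ≈ - y
    neg-cong {y = y} (by k refl) = by (- k) (neg-id y k (+ p))

    -- To derive a linear consequence of congruences, add them up to one with the same difference.
    shift : ∀ {x y z w} → z ≈ w → x - y ≡ z - w → x ≈ y
    shift {x} {y} {z} {w} (by k refl) e =
      by k (≡.trans (diff-id x y) (cong (_+_ y) (≡.trans e (cancel-id w k (+ p)))))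
      where
      cancel-id : ∀ w k q → w + k * q - w ≡ k * q
      cancel-id = solve-∀

    +-cancelˡ : ∀ x {y z} → x + y ≈ x + z → y ≈ z
    +-cancelˡ x {y} {z} h = shift h (id₁ x y z)
      where
      id₁ : ∀ x y z → y - z ≡ x + y - (x + z)
      id₁ = solve-∀

    p≈0 : + p ≈ 0ℤ
    p≈0 = by 1ℤ (sym (≡.trans (ℤ.+-identityˡ _) (ℤ.*-identityˡ (+ p))))

    kp≈0 : ∀ k → + (k ℕ.* p) ≈ 0ℤ
    kp≈0 k = by (+ k) (≡.trans (ℤ.pos-* k p) (sym (ℤ.+-identityˡ _)))

    %≈ : ∀ m → + (m ℕ.% p) ≈ + m
    %≈ m = ≈-sym (by (+ (m ℕ./ p))
      (≡.trans (cong +_ (ℕ.m≡m%n+[m/n]*n m p))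
        (cong (λ t → + (m ℕ.% p) + t) (ℤ.pos-* (m ℕ./ p) p))))

    ∣diff : ∀ {m n} → m ℕ.≤ n → + n ≈ + m → p ∣ℕ n ℕ.∸ m
    ∣diff {m} {n} m≤n (by k e) = divides ∣ k ∣ (≡.trans (cong ∣_∣ d) (ℤ.abs-* k (+ p)))
      where
      id₁ : ∀ m t → m + t - m ≡ t
      id₁ = solve-∀
      d : + (n ℕ.∸ m) ≡ k * + p
      d = ≡.trans (sym (ℤ.⊖-≥ m≤n)) (≡.trans (sym (ℤ.m-n≡m⊖n n m))
            (≡.trans (cong (_- + m) e) (id₁ (+ m) (k * + p))))

    small-≈ : ∀ {m n} → m ℕ.≤ n → n ℕ.∸ m ℕ.< p → + m ≈ + n → m ≡ n
    small-≈ {m} {n} m≤n d<p h with n ℕ.∸ m in eq | ∣diff m≤n (≈-sym h)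
    ... | zero  | _ = ℕ.≤-antisym m≤n (ℕ.m∸n≡0⇒m≤n eq)
    ... | suc d | p∣ = ⊥-elim (ℕ.<⇒≱ d<p (Div.∣⇒≤ p∣))

    -- Positions and labels are later written as natural numbers in an interval of length `p` that
    -- need not start at 0; this is what makes that notation faithful.
    window : ∀ {w m n} → w ℕ.≤ m → m ℕ.< w ℕ.+ p → w ℕ.≤ n → n ℕ.< w ℕ.+ p →
             + m ≈ + n → m ≡ n
    window {w} {m} {n} wm mp wn np h with ℕ.≤-total m n
    ... | inj₁ m≤n = small-≈ m≤n (gap m wm np) h
      where
      gap : ∀ {n} m → w ℕ.≤ m → n ℕ.< w ℕ.+ p → n ℕ.∸ m ℕ.< p
      gap {n} m wm np = ℕ.≤-<-trans (ℕ.∸-monoʳ-≤ n wm)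
        (ℕ.m<n+o⇒m∸n<o n w np)
    ... | inj₂ n≤m = sym (small-≈ n≤m (gap n wn mp) (≈-sym h))
      where
      gap : ∀ {n} m → w ℕ.≤ m → n ℕ.< w ℕ.+ p → n ℕ.∸ m ℕ.< p
      gap {n} m wm np = ℕ.≤-<-trans (ℕ.∸-monoʳ-≤ n wm)
        (ℕ.m<n+o⇒m∸n<o n w np)

    below-p : ∀ {m n} → m ℕ.< p → n ℕ.< p → + m ≈ + n → m ≡ n
    below-p m<p n<p = window z≤n m<p z≤n n<p

    opaque
      val : Fin p → ℤ
      val i = + toℕ i

      val-toℕ : ∀ i → val i ≡ + toℕ i
      val-toℕ i = refl

    residue : ℤ → Fin p
    residue i = fromℕ< (n%ℕd<d i p)

    val-residue : ∀ i → val (residue i) ≈ i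
    val-residue i = ≈-trans
      (≡⇒≈ (≡.trans (val-toℕ (residue i)) (cong +_ (Fin.toℕ-fromℕ< (n%ℕd<d i p)))))
      (≈-sym (by (i /ℕ p) (a≡a%ℕn+[a/ℕn]*n i p)))

    val-injective : ∀ {i j} → val i ≈ val j → i ≡ j
    val-injective {i} {j} h = Fin.toℕ-injective (below-p (Fin.toℕ<n i) (Fin.toℕ<n j)
      (subst₂ _≈_ (val-toℕ i) (val-toℕ j) h))

    val-addMod : ∀ i j → val (addMod i j) ≈ val i + val j
    val-addMod i j = ≈-trans
      (≡⇒≈ (≡.trans (val-toℕ (addMod i j)) (cong +_ (Fin.toℕ-fromℕ< (ℕ.m%n<n (toℕ i ℕ.+ toℕ j) p)))))
      (≈-trans (%≈ (toℕ i ℕ.+ toℕ j))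
        (≡⇒≈ (cong₂ _+_ (sym (val-toℕ i)) (sym (val-toℕ j)))))

    residue-cong : ∀ {x y} → x ≈ y → residue x ≡ residue y
    residue-cong {x} {y} h =
      val-injective (≈-trans (val-residue x) (≈-trans h (≈-sym (val-residue y))))

    residue-injective : ∀ {x y} → residue x ≡ residue y → x ≈ y
    residue-injective {x} {y} e =
      ≈-trans (≈-sym (val-residue x)) (≈-trans (≡⇒≈ (cong val e)) (val-residue y))

    addMod-residue : ∀ x y → addMod (residue x) (residue y) ≡ residue (x + y)
    addMod-residue x y = val-injective
      (≈-trans (val-addMod (residue x) (residue y))
        (≈-trans (+-cong (val-residue x) (val-residue y)) (≈-sym (val-residue (x + y)))))

    coord : ∀ {k} → Zpk p k → Fin k → ℤ
    coord u j = val (lookup u j)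

    coord-⊕ : ∀ {k} (u v : Zpk p k) j → coord (u ⊕ v) j ≈ coord u j + coord v j
    coord-⊕ u v j = ≈-trans (≡⇒≈ (cong val (Vec.lookup-zipWith addMod j u v)))
      (val-addMod (lookup u j) (lookup v j))

    coord-injective : ∀ {k} {u v : Zpk p k} → (∀ j → coord u j ≈ coord v j) → u ≡ v
    coord-injective {u = u} {v} h =
      ≡.trans (sym (Vec.tabulate∘lookup u))
        (≡.trans (Vec.tabulate-cong (λ j → val-injective (h j))) (Vec.tabulate∘lookup v))

    fromCoords : ∀ {k} → (Fin k → ℤ) → Zpk p k
    fromCoords g = tabulate (residue ∘ g)

    coord-fromCoords : ∀ {k} (g : Fin k → ℤ) j → coord (fromCoords g) j ≈ g j
    coord-fromCoords g j =
      ≈-trans (≡⇒≈ (cong val (Vec.lookup∘tabulate (residue ∘ g) j))) (val-residue (g j))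

    ⊕-comm : ∀ {k} (u v : Zpk p k) → u ⊕ v ≡ v ⊕ u
    ⊕-comm u v = coord-injective λ j →
      ≈-trans (coord-⊕ u v j) (≈-trans (≡⇒≈ (ℤ.+-comm (coord u j) (coord v j))) (≈-sym (coord-⊕ v u j)))

    ⊕-cancelˡ : ∀ {k} (u : Zpk p k) {v w} → u ⊕ v ≡ u ⊕ w → v ≡ w
    ⊕-cancelˡ u {v} {w} e = coord-injective λ j → +-cancelˡ (coord u j)
      (≈-trans (≈-sym (coord-⊕ u v j)) (≈-trans (≡⇒≈ (cong (λ t → coord t j) e)) (coord-⊕ u w j)))

    zeros : ∀ {k} → Zpk p k
    zeros = replicate _ Fin.zero

    zeros⊕ : ∀ {k} (u : Zpk p k) → zeros ⊕ u ≡ u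
    zeros⊕ u = coord-injective λ j → ≈-trans (coord-⊕ zeros u j)
      (≡⇒≈ (≡.trans (cong (λ t → val t + coord u j) (Vec.lookup-replicate j Fin.zero))
        (≡.trans (cong (_+ coord u j) (val-toℕ Fin.zero)) (ℤ.+-identityˡ (coord u j)))))

    module PrimeModulus (pr : Prime p) where

      ∣⇒≈0 : ∀ z → p ∣ℕ ∣ z ∣ → z ≈ 0ℤ
      ∣⇒≈0 (+ n) (divides q e) = ≈-trans (≡⇒≈ (cong +_ e)) (kp≈0 q)
      ∣⇒≈0 -[1+ n ] (divides q e) =
        ≈-trans (≡⇒≈ (cong (λ t → - + t) e)) (neg-cong (kp≈0 q))

      ≈0⇒∣ : ∀ {z} → z ≈ 0ℤ → p ∣ℕ ∣ z ∣
      ≈0⇒∣ (by k refl) = divides ∣ k ∣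
        (≡.trans (cong ∣_∣ (ℤ.+-identityˡ (k * + p))) (ℤ.abs-* k (+ p)))

      integral : ∀ x y → x * y ≈ 0ℤ → x ≈ 0ℤ ⊎ y ≈ 0ℤ
      integral x y h
        with euclidsLemma ∣ x ∣ ∣ y ∣ pr (subst (p ∣ℕ_) (ℤ.abs-* x y) (≈0⇒∣ h))
      ... | inj₁ d = inj₁ (∣⇒≈0 x d)
      ... | inj₂ d = inj₂ (∣⇒≈0 y d)

      *-cancelˡ : ∀ {x y z} → x ≉ 0ℤ → x * y ≈ x * z → y ≈ z
      *-cancelˡ {x} {y} {z} x≉0 h with integral x (y - z) (shift h (id₁ x y z))
        where
        id₁ : ∀ x y z → x * (y - z) - + 0 ≡ x * y - x * z
        id₁ = solve-∀
      ... | inj₁ x≈0 = ⊥-elim (x≉0 x≈0)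
      ... | inj₂ d   = shift d (id₂ y z)
        where
        id₂ : ∀ y z → y - z ≡ y - z - + 0
        id₂ = solve-∀

      small≉0 : ∀ {n} → 0 ℕ.< n → n ℕ.< p → + n ≉ 0ℤ
      small≉0 0<n n<p h = ℕ.<⇒≢ 0<n (sym (below-p n<p (s≤s z≤n) h))

      inverse : ∀ {z} → z ≉ 0ℤ → ∃ λ y → y * z ≈ 1ℤ
      inverse {z} z≉0 =
        go (z %ℕ p) (n%ℕd<d z p) (by (z /ℕ p) (a≡a%ℕn+[a/ℕn]*n z p))
        where
        id₁ : ∀ y n → - y * n ≡ 1ℤ - (1ℤ + y * n)
        id₁ = solve-∀
        id₂ : ∀ x q → 1ℤ - x * q ≡ 1ℤ + (- x) * q
        id₂ = solve-∀
        go : ∀ n → n ℕ.< p → z ≈ + n → ∃ λ y → y * z ≈ 1ℤ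
        go zero    _   z≈0 = ⊥-elim (z≉0 z≈0)
        go (suc n) n<p z≈n with coprime-Bézout (prime⇒coprime pr n<p)
        ... | Bézout.Identity.+- x y e = - + y , ≈-trans (*-cong (≈-refl {x = - + y}) z≈n)
                (by (- + x) (≡.trans (id₁ (+ y) (+ suc n)) (≡.trans (cong (_-_ 1ℤ) e′) (id₂ (+ x) (+ p)))))
          where
          e′ : 1ℤ + + y * + suc n ≡ + x * + p
          e′ = ≡.trans (cong (_+_ 1ℤ) (sym (ℤ.pos-* y (suc n)))) (≡.trans (cong +_ e) (ℤ.pos-* x p))
        ... | Bézout.Identity.-+ x y e = + y , ≈-trans (*-cong (≈-refl {x = + y}) z≈n)
                (by (+ x) (≡.trans (sym (ℤ.pos-* y (suc n)))
                  (≡.trans (sym (cong +_ e)) (cong (_+_ 1ℤ) (ℤ.pos-* x p)))))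

  -- Duplicate-free lists, counting and sums over lists.

  unique-extend : ∀ {A : Set} {ys xs : List A} → Unique ys → (∀ {v} → v ∈ ys → v ∈ xs) →
                  ∃ λ rest → xs ↭ ys ++ rest
  unique-extend {ys = []} {xs} _ _ = xs , ↭-refl
  unique-extend {ys = y ∷ ys} (y∉ ∷ u) sub with ∈-∃++ (sub (here refl))
  ... | as , bs , refl with unique-extend {xs = as ++ bs} u sub′
    where
    sub′ : ∀ {v} → v ∈ ys → v ∈ as ++ bs
    sub′ v∈ with ∈-++⁻ as (sub (there v∈))
    ... | inj₁ v∈as           = ∈-++⁺ˡ v∈as
    ... | inj₂ (there v∈bs)   = ∈-++⁺ʳ as v∈bs
    ... | inj₂ (here refl)    = ⊥-elim (All.lookup y∉ v∈ refl)
  ... | rest , π = rest , ↭-trans (Perm.shift y as bs) (prep y π)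

  Unique-resp-↭ : ∀ {A : Set} {xs ys : List A} → xs ↭ ys → Unique xs → Unique ys
  Unique-resp-↭ π = SetoidPerm.Unique-resp-↭ (setoid _) (↭⇒↭ₛ π)

  unique-full : ∀ {A : Set} {ys xs : List A} → Unique ys → (∀ v → v ∈ xs) →
                length ys ≡ length xs → xs ↭ ys
  unique-full {ys = ys} {xs} u full e with unique-extend u (λ {v} _ → full v)
  ... | rest , π = subst (xs ↭_) (≡.trans (cong (ys ++_) (empty rest no-rest)) (List.++-identityʳ ys)) π
    where
    no-rest : length rest ≡ 0
    no-rest = ℕ.+-cancelˡ-≡ (length ys) _ _
      (≡.trans (sym (List.length-++ ys)) (≡.trans (sym (Perm.↭-length π))
        (≡.trans (sym e) (sym (ℕ.+-identityʳ _)))))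
    empty : ∀ {A : Set} (zs : List A) → length zs ≡ 0 → zs ≡ []
    empty [] _ = refl

  -- A tree has one edge fewer than vertices, so distinct edge labels leave out exactly one group
  -- element; this lemma produces it.
  unique-almost-full : ∀ {A : Set} {ys xs : List A} → Unique ys → (∀ v → v ∈ xs) →
                       length xs ≡ suc (length ys) → ∃ λ m → xs ↭ m ∷ ys
  unique-almost-full {ys = ys} {xs} u full e with unique-extend u (λ {v} _ → full v)
  ... | rest , π = single rest π one
    where
    one : length rest ≡ 1
    one = ℕ.+-cancelˡ-≡ (length ys) _ _
      (≡.trans (sym (List.length-++ ys)) (≡.trans (sym (Perm.↭-length π))
        (≡.trans e (ℕ.+-comm 1 (length ys)))))
    single : ∀ rest → xs ↭ ys ++ rest → length rest ≡ 1 → ∃ λ m → xs ↭ m ∷ ys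
    single (m ∷ []) π _ = m , ↭-trans π (↭-sym (Perm.∷↭∷ʳ m ys))

  length-cartesianProductWith : ∀ {A B C : Set} (f : A → B → C) xs ys →
    length (cartesianProductWith f xs ys) ≡ length xs ℕ.* length ys
  length-cartesianProductWith f []       ys = refl
  length-cartesianProductWith f (x ∷ xs) ys = ≡.trans (List.length-++ (map (f x) ys))
    (cong₂ ℕ._+_ (List.length-map (f x) ys) (length-cartesianProductWith f xs ys))

  module _ {A B : Set} where

    sumList : List A → List B → List (A ⊎ B)
    sumList xs ys = map inj₁ xs ++ map inj₂ ys

    ∈-sumList : ∀ {xs ys} → (∀ a → a ∈ xs) → (∀ b → b ∈ ys) → ∀ v → v ∈ sumList xs ys
    ∈-sumList {xs} ∈xs ∈ys (inj₁ a) = ∈-++⁺ˡ (∈-map⁺ inj₁ (∈xs a))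
    ∈-sumList {xs} ∈xs ∈ys (inj₂ b) = ∈-++⁺ʳ (map inj₁ xs) (∈-map⁺ inj₂ (∈ys b))

    sumList-unique : ∀ {xs ys} → Unique xs → Unique ys → Unique (sumList xs ys)
    sumList-unique {xs} {ys} u w =
      Unique.++⁺ (Unique.map⁺ inj₁-injective u) (Unique.map⁺ inj₂-injective w) disjoint
      where
      disjoint : ∀ {v} → ¬ (v ∈ map inj₁ xs × v ∈ map inj₂ ys)
      disjoint (v∈ , v∈′) with ∈-map⁻ inj₁ v∈ | ∈-map⁻ inj₂ v∈′
      ... | _ , _ , refl | _ , _ , ()

    length-sumList : ∀ xs ys → length (sumList xs ys) ≡ length xs ℕ.+ length ys
    length-sumList xs ys = ≡.trans (List.length-++ (map inj₁ xs))
      (cong₂ ℕ._+_ (List.length-map inj₁ xs) (List.length-map inj₂ ys))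

  leafList : ∀ n x y z → List (Fin n ⊎ (Fin x ⊎ (Fin y ⊎ Fin z)))
  leafList n x y z = sumList (allFin n) (sumList (allFin x) (sumList (allFin y) (allFin z)))

  ∈-leafList : ∀ n x y z v → v ∈ leafList n x y z
  ∈-leafList n x y z =
    ∈-sumList ∈-allFin (∈-sumList ∈-allFin (∈-sumList ∈-allFin ∈-allFin))

  leafList-unique : ∀ n x y z → Unique (leafList n x y z)
  leafList-unique n x y z = sumList-unique (Unique.allFin⁺ n)
    (sumList-unique (Unique.allFin⁺ x) (sumList-unique (Unique.allFin⁺ y) (Unique.allFin⁺ z)))

  length-leafList : ∀ n x y z → length (leafList n x y z) ≡ n ℕ.+ (x ℕ.+ (y ℕ.+ z))
  length-leafList n x y z =
    ≡.trans (length-sumList (allFin n) _) (cong₂ ℕ._+_ (len n)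
    (≡.trans (length-sumList (allFin x) _) (cong₂ ℕ._+_ (len x)
    (≡.trans (length-sumList (allFin y) _) (cong₂ ℕ._+_ (len y) (len z))))))
    where
    len : ∀ m → length (allFin m) ≡ m
    len m = List.length-tabulate id

  sumOf : ∀ {A : Set} → (A → ℤ) → List A → ℤ
  sumOf g []       = 0ℤ
  sumOf g (x ∷ xs) = g x + sumOf g xs

  sumOf-↭ : ∀ {A : Set} (g : A → ℤ) {xs ys} → xs ↭ ys → sumOf g xs ≡ sumOf g ys
  sumOf-↭ g refl         = refl
  sumOf-↭ g (prep x π)   = cong (λ t → g x + t) (sumOf-↭ g π)
  sumOf-↭ g {_ ∷ _ ∷ xs} {_ ∷ _ ∷ ys} (swap x y π) = ≡.trans (id₁ (g x) (g y) (sumOf g xs))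
    (cong (λ t → g y + (g x + t)) (sumOf-↭ g π))
    where
    id₁ : ∀ a b c → a + (b + c) ≡ b + (a + c)
    id₁ = solve-∀
  sumOf-↭ g (trans π σ)  = ≡.trans (sumOf-↭ g π) (sumOf-↭ g σ)

  sumOf-map : ∀ {A B : Set} (g : B → ℤ) (h : A → B) xs → sumOf g (map h xs) ≡ sumOf (g ∘ h) xs
  sumOf-map g h []       = refl
  sumOf-map g h (x ∷ xs) = cong (λ t → g (h x) + t) (sumOf-map g h xs)

  sumOf-++ : ∀ {A : Set} (g : A → ℤ) xs ys → sumOf g (xs ++ ys) ≡ sumOf g xs + sumOf g ys
  sumOf-++ g []       ys = sym (ℤ.+-identityˡ _)
  sumOf-++ g (x ∷ xs) ys = ≡.trans (cong (λ t → g x + t) (sumOf-++ g xs ys))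
    (sym (ℤ.+-assoc (g x) _ _))

  sumOf-sumList : ∀ {A B : Set} (g : A ⊎ B → ℤ) xs ys →
    sumOf g (sumList xs ys) ≡ sumOf (g ∘ inj₁) xs + sumOf (g ∘ inj₂) ys
  sumOf-sumList g xs ys = ≡.trans (sumOf-++ g (map inj₁ xs) _)
    (cong₂ _+_ (sumOf-map g inj₁ xs) (sumOf-map g inj₂ ys))

  module Vectors (p-1 : ℕ) where
    open Residues p-1

    vectors : ∀ k → List (Zpk p k)
    vectors zero    = [] ∷ []
    vectors (suc k) = cartesianProductWith _∷_ (allFin p) (vectors k)

    ∈-vectors : ∀ {k} (v : Zpk p k) → v ∈ vectors k
    ∈-vectors []       = here refl
    ∈-vectors (i ∷ v) = ∈-cartesianProductWith⁺ _∷_ (∈-allFin i) (∈-vectors v)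

    vectors-unique : ∀ k → Unique (vectors k)
    vectors-unique zero    = [] ∷ []
    vectors-unique (suc k) =
      Unique.cartesianProductWith⁺ _∷_ (λ { refl → refl , refl }) (Unique.allFin⁺ p) (vectors-unique k)

    length-vectors : ∀ k → length (vectors k) ≡ p ℕ.^ k
    length-vectors zero    = refl
    length-vectors (suc k) = ≡.trans (length-cartesianProductWith _∷_ (allFin p) (vectors k))
      (cong₂ ℕ._*_ (List.length-tabulate {n = p} id) (length-vectors k))

    vectors-head : ∀ k → ∃ λ rest → vectors k ≡ zeros ∷ rest
    vectors-head zero    = [] , refl
    vectors-head (suc k) with vectors k | vectors-head k
    ... | _ | _ , refl = _ , refl

    sumOf-≈ : ∀ {A : Set} {g h : A → ℤ} → (∀ a → g a ≈ h a) → ∀ xs → sumOf g xs ≈ sumOf h xs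
    sumOf-≈ e []       = ≈-refl
    sumOf-≈ e (x ∷ xs) = +-cong (e x) (sumOf-≈ e xs)

    sumOf-shift : ∀ {A : Set} c (g : A → ℤ) xs →
      sumOf (λ a → c + g a) xs ≡ + length xs * c + sumOf g xs
    sumOf-shift c g []       = sym (≡.trans (ℤ.+-identityʳ (0ℤ * c)) (ℤ.*-zeroˡ c))
    sumOf-shift c g (x ∷ xs) = ≡.trans (cong (λ t → c + g x + t) (sumOf-shift c g xs))
      (≡.trans (id₁ c (g x) (+ length xs) (sumOf g xs))
        (cong (λ t → t * c + (g x + sumOf g xs)) (sym (ℤ.pos-+ 1 (length xs)))))
      where
      id₁ : ∀ c g n s → c + g + (n * c + s) ≡ (1ℤ + n) * c + (g + s)
      id₁ = solve-∀

  -- Necessity: the missing label and the sum relation.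

  module Labeled (p-1 : ℕ) (pr : Prime (suc p-1))
    {k x y z : ℕ} (size : x ℕ.+ y ℕ.+ z ℕ.+ 3 ≡ suc p-1 ℕ.^ k)
    (f : Vertex x y z → Zpk (suc p-1) k) (rainbow : IsRainbowLabeling (suc p-1) k x y z f) where

    open Residues p-1
    open Vectors p-1
    open PrimeModulus pr

    label : Edge x y z → Zpk p k
    label = edgeLabel {p} {k} {x} {y} {z} f

    f-injective : ∀ {v w} → f v ≡ f w → v ≡ w
    f-injective = proj₁ (proj₁ rainbow)

    f-surjective : ∀ u → ∃ λ v → f v ≡ u
    f-surjective u with proj₂ (proj₁ rainbow) u
    ... | v , h = v , h refl

    label-injective : ∀ {d e} → label d ≡ label e → d ≡ e
    label-injective = proj₂ rainbow

    a₁ a₂ a₃ : Zpk p k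
    a₁ = f s₁
    a₂ = f s₂
    a₃ = f s₃

    leafX : Fin x → Zpk p k
    leafX i = f (inj₂ (inj₁ i))

    leafY : Fin y → Zpk p k
    leafY i = f (inj₂ (inj₂ (inj₁ i)))

    leafZ : Fin z → Zpk p k
    leafZ i = f (inj₂ (inj₂ (inj₂ i)))

    private
      labels : List (Zpk p k)
      labels = map label (leafList 2 x y z)

      values : List (Zpk p k)
      values = map f (leafList 3 x y z)

      vectors↭values : vectors k ↭ values
      vectors↭values = unique-full (Unique.map⁺ f-injective (leafList-unique 3 x y z)) ∈-vectors
        (≡.trans (List.length-map f (leafList 3 x y z)) (≡.trans (length-leafList 3 x y z)
          (≡.trans (arrange x y z) (≡.trans size (sym (length-vectors k))))))
        where
        arrange : ∀ x y z → 3 ℕ.+ (x ℕ.+ (y ℕ.+ z)) ≡ x ℕ.+ y ℕ.+ z ℕ.+ 3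
        arrange = ℕSolver.solve-∀

      labels-unique : Unique labels
      labels-unique = Unique.map⁺ {f = label} (λ {d} {e} → label-injective {d} {e}) (leafList-unique 2 x y z)

      length-labels : length labels ≡ 2 ℕ.+ (x ℕ.+ (y ℕ.+ z))
      length-labels = ≡.trans (List.length-map label (leafList 2 x y z)) (length-leafList 2 x y z)

      arrange : ∀ x y z → x ℕ.+ y ℕ.+ z ℕ.+ 3 ≡ suc (2 ℕ.+ (x ℕ.+ (y ℕ.+ z)))
      arrange = ℕSolver.solve-∀

      abstract
       missing : ∃ λ m → vectors k ↭ m ∷ labels
       missing = unique-almost-full labels-unique ∈-vectors
        (≡.trans (length-vectors k) (≡.trans (sym size) (≡.trans (arrange x y z)
          (cong suc (sym length-labels)))))

    m : Zpk p k
    m = proj₁ missing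

    label≢m : ∀ e → label e ≢ m
    label≢m e eq = apart (Unique-resp-↭ (proj₂ missing) (vectors-unique k))
      (∈-map⁺ label (∈-leafList 2 x y z e)) eq
      where
      apart : ∀ {A : Set} {u m : A} {us} → Unique (m ∷ us) → u ∈ us → u ≢ m
      apart (m∉ ∷ _) u∈ eq = All.lookup m∉ u∈ (sym eq)

    m-or-label : ∀ u → u ≡ m ⊎ ∃ λ e → label e ≡ u
    m-or-label u = split {g = label} {xs = leafList 2 x y z} (Perm.∈-resp-↭ (proj₂ missing) (∈-vectors u))
      where
      split : ∀ {A B : Set} {g : A → B} {u m : B} {xs} → u ∈ m ∷ map g xs → u ≡ m ⊎ ∃ λ e → g e ≡ u
      split (here eq) = inj₁ eq
      split {g = g} (there u∈) with ∈-map⁻ g u∈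
      ... | e , _ , eq = inj₂ (e , sym eq)

    -- Compare the sum of all vertex labels with the sum of all edge labels; both lists exhaust
    -- the group, the latter up to m.
    sum-relation : ∀ j → + x * coord a₁ j + (1ℤ + + y) * coord a₂ j + + z * coord a₃ j + coord m j ≈ 0ℤ
    sum-relation j = conclude (+ x) (+ y) (+ z) (≈-trans (≈-sym edges) (≡⇒≈ same))
      where
      c : Zpk p k → ℤ
      c v = coord v j
      SX = sumOf (c ∘ leafX) (allFin x)
      SY = sumOf (c ∘ leafY) (allFin y)
      SZ = sumOf (c ∘ leafZ) (allFin z)
      unfold : ∀ n (h : Fin n ⊎ (Fin x ⊎ (Fin y ⊎ Fin z)) → ℤ) → sumOf h (leafList n x y z) ≡
        sumOf (h ∘ inj₁) (allFin n) + (sumOf (h ∘ inj₂ ∘ inj₁) (allFin x) +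
          (sumOf (h ∘ inj₂ ∘ inj₂ ∘ inj₁) (allFin y) + sumOf (h ∘ inj₂ ∘ inj₂ ∘ inj₂) (allFin z)))
      unfold n h =
        ≡.trans (sumOf-sumList h (allFin n) _) (cong (λ t → sumOf (h ∘ inj₁) (allFin n) + t)
          (≡.trans (sumOf-sumList (h ∘ inj₂) (allFin x) _)
            (cong (λ t → sumOf (h ∘ inj₂ ∘ inj₁) (allFin x) + t)
              (sumOf-sumList (h ∘ inj₂ ∘ inj₂) (allFin y) (allFin z)))))
      -- `V` sums the vertex labels and `E` the edge labels. The leaf sums occur in both and cancel;
      -- what remains is one spine label per pendant edge, and `a₂` once more because it lies on
      -- both spine edges.
      V = c a₁ + (c a₂ + (c a₃ + 0ℤ)) + (SX + (SY + SZ))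
      E = c a₁ + c a₂ + (c a₂ + c a₃ + 0ℤ) +
          (+ x * c a₁ + SX + ((+ y * c a₂ + SY) + (+ z * c a₃ + SZ)))
      same : c m + sumOf c labels ≡ V
      same = ≡.trans (sym (sumOf-↭ c (proj₂ missing))) (≡.trans (sumOf-↭ c vectors↭values)
        (≡.trans (sumOf-map c f (leafList 3 x y z)) (unfold 3 (c ∘ f))))
      leaves : ∀ {n} a (g : Fin n → Zpk p k) →
        sumOf (λ i → c (a ⊕ g i)) (allFin n) ≈ + n * c a + sumOf (c ∘ g) (allFin n)
      leaves {n} a g = ≈-trans (sumOf-≈ (λ i → coord-⊕ a (g i) j) (allFin n))
        (≡⇒≈ (≡.trans (sumOf-shift (c a) (c ∘ g) (allFin n))
          (cong (λ t → + t * c a + sumOf (c ∘ g) (allFin n)) (List.length-tabulate {n = n} id))))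
      edges : c m + sumOf c labels ≈ c m + E
      edges = +-cong (≈-refl {c m}) (≈-trans
        (≡⇒≈ (≡.trans (sumOf-map c label (leafList 2 x y z)) (unfold 2 (c ∘ label))))
        (+-cong (+-cong (coord-⊕ a₁ a₂ j) (+-cong (coord-⊕ a₂ a₃ j) (≈-refl {0ℤ})))
          (+-cong (leaves a₁ leafX) (+-cong (leaves a₂ leafY) (leaves a₃ leafZ)))))
      conclude : ∀ {a b d m X Y Z} x y z →
        m + (a + b + (b + d + 0ℤ) + (x * a + X + ((y * b + Y) + (z * d + Z)))) ≈
          a + (b + (d + 0ℤ)) + (X + (Y + Z)) →
        x * a + (1ℤ + y) * b + z * d + m ≈ 0ℤ
      conclude {a} {b} {d} {m} {X} {Y} {Z} x y z h = shift h (id₁ a b d m x y z X Y Z)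
        where
        id₁ : ∀ a b d m x y z X Y Z → x * a + (1ℤ + y) * b + z * d + m - 0ℤ ≡
            (m + (a + b + (b + d + 0ℤ) + (x * a + X + ((y * b + Y) + (z * d + Z))))) -
            (a + (b + (d + 0ℤ)) + (X + (Y + Z)))
        id₁ = solve-∀

  -- Necessity: excluding the exceptional cases.

  module Obstruction (p-1 : ℕ) (pr : Prime (suc p-1)) (5≤p : 5 ℕ.≤ suc p-1)
    {k x y z : ℕ} (size : x ℕ.+ y ℕ.+ z ℕ.+ 3 ≡ suc p-1 ℕ.^ k)
    (f : Vertex x y z → Zpk (suc p-1) k) (rainbow : IsRainbowLabeling (suc p-1) k x y z f) where

    open Residues p-1
    open PrimeModulus pr
    open Labeled p-1 pr size f rainbow

    +2≉0 : + 2 ≉ 0ℤ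
    +2≉0 = small≉0 (s≤s z≤n) (ℕ.≤-trans (s≤s (s≤s (s≤s z≤n))) 5≤p)

    data VertexCase (u : Zpk p k) : Set where
      is-a₁   : u ≡ a₁ → VertexCase u
      is-a₂   : u ≡ a₂ → VertexCase u
      is-a₃   : u ≡ a₃ → VertexCase u
      in-X    : (i : Fin x) → u ≡ leafX i → VertexCase u
      in-Y    : (i : Fin y) → u ≡ leafY i → VertexCase u
      in-Z    : (i : Fin z) → u ≡ leafZ i → VertexCase u

    data LabelCase (u : Zpk p k) : Set where
      is-m    : u ≡ m → LabelCase u
      is-12   : u ≡ a₁ ⊕ a₂ → LabelCase u
      is-23   : u ≡ a₂ ⊕ a₃ → LabelCase u
      from-X  : (i : Fin x) → u ≡ a₁ ⊕ leafX i → LabelCase u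
      from-Y  : (i : Fin y) → u ≡ a₂ ⊕ leafY i → LabelCase u
      from-Z  : (i : Fin z) → u ≡ a₃ ⊕ leafZ i → LabelCase u

    vertex-case : ∀ u → VertexCase u
    vertex-case u = go (f-surjective u)
      where
      go : (∃ λ v → f v ≡ u) → VertexCase u
      go (inj₁ Fin.zero , e)                         = is-a₁ (sym e)
      go (inj₁ (Fin.suc Fin.zero) , e)               = is-a₂ (sym e)
      go (inj₁ (Fin.suc (Fin.suc Fin.zero)) , e)     = is-a₃ (sym e)
      go (inj₂ (inj₁ i) , e)                         = in-X i (sym e)
      go (inj₂ (inj₂ (inj₁ i)) , e)                  = in-Y i (sym e)
      go (inj₂ (inj₂ (inj₂ i)) , e)                  = in-Z i (sym e)

    label-case : ∀ u → LabelCase u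
    label-case u = go (m-or-label u)
      where
      go : (u ≡ m ⊎ ∃ λ e → label e ≡ u) → LabelCase u
      go (inj₁ e)                                    = is-m e
      go (inj₂ (inj₁ Fin.zero , e))                  = is-12 (sym e)
      go (inj₂ (inj₁ (Fin.suc Fin.zero) , e))        = is-23 (sym e)
      go (inj₂ (inj₂ (inj₁ i) , e))                  = from-X i (sym e)
      go (inj₂ (inj₂ (inj₂ (inj₁ i)) , e))           = from-Y i (sym e)
      go (inj₂ (inj₂ (inj₂ (inj₂ i)) , e))           = from-Z i (sym e)

    e₁₂ e₂₃ : Edge x y z
    e₁₂ = inj₁ Fin.zero
    e₂₃ = inj₁ (Fin.suc Fin.zero)

    eX : Fin x → Edge x y z
    eX i = inj₂ (inj₁ i)

    eZ : Fin z → Edge x y z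
    eZ i = inj₂ (inj₂ (inj₂ i))

    a₁≢a₂ : a₁ ≢ a₂
    a₁≢a₂ e = case f-injective {s₁} {s₂} e of λ ()

    a₂≢a₃ : a₂ ≢ a₃
    a₂≢a₃ e = case f-injective {s₂} {s₃} e of λ ()

    a₁≢a₃ : a₁ ≢ a₃
    a₁≢a₃ e = case f-injective {s₁} {s₃} e of λ ()

    X≢spine : ∀ i j → leafX i ≢ f (inj₁ j)
    X≢spine i j e = case f-injective {inj₂ (inj₁ i)} {inj₁ j} e of λ ()

    Z≢spine : ∀ i j → leafZ i ≢ f (inj₁ j)
    Z≢spine i j e = case f-injective {inj₂ (inj₂ (inj₂ i))} {inj₁ j} e of λ ()

    X≢Y : ∀ i j → leafX i ≢ leafY j
    X≢Y i j e = case f-injective {inj₂ (inj₁ i)} {inj₂ (inj₂ (inj₁ j))} e of λ ()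

    distinct : ∀ {u v} d e → label d ≡ u → label e ≡ v → d ≢ e → u ≢ v
    distinct d e p q d≢e u≡v = d≢e (label-injective {d} {e} (≡.trans p (≡.trans u≡v (sym q))))

    coords : ∀ {u v : Zpk p k} → u ≡ v → ∀ j → coord u j ≈ coord v j
    coords e j = ≡⇒≈ (cong (λ t → coord t j) e)

    relation : ∀ {r s t} → + x ≈ r → 1ℤ + + y ≈ s → + z ≈ t → ∀ j →
               r * coord a₁ j + s * coord a₂ j + t * coord a₃ j + coord m j ≈ 0ℤ
    relation {r} {s} {t} ex ey ez j = ≈-trans
      (+-cong (+-cong (+-cong (*-cong (≈-sym ex) (≈-refl {coord a₁ j}))
          (*-cong (≈-sym ey) (≈-refl {coord a₂ j})))
        (*-cong (≈-sym ez) (≈-refl {coord a₃ j}))) (≈-refl {coord m j}))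
      (sum-relation j)

    not-case₁ : + x ≈ 0ℤ → 1ℤ + + y ≈ - 1ℤ → + z ≈ - 1ℤ → ⊥
    not-case₁ ex ey ez = label≢m e₂₃ (coord-injective λ j →
      ≈-trans (coord-⊕ a₂ a₃ j) (≈-sym (shift (relation ex ey ez j)
        (id₁ (coord a₁ j) (coord a₂ j) (coord a₃ j) (coord m j)))))
      where
      id₁ : ∀ a b c m → m - (b + c) ≡ 0ℤ * a + - 1ℤ * b + - 1ℤ * c + m - 0ℤ
      id₁ = solve-∀

    -- On any other edge with this label, cancelling the common summand would make two spine
    -- vertices, or a leaf and a spine vertex, share a label.
    cross-label : a₁ ⊕ a₃ ≡ m ⊎ ∃ λ i → a₂ ⊕ leafY i ≡ a₁ ⊕ a₃
    cross-label = go (label-case (a₁ ⊕ a₃))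
      where
      go : LabelCase (a₁ ⊕ a₃) → a₁ ⊕ a₃ ≡ m ⊎ ∃ λ i → a₂ ⊕ leafY i ≡ a₁ ⊕ a₃
      go (is-m e)     = inj₁ e
      go (is-12 e)    = ⊥-elim (a₂≢a₃ (sym (⊕-cancelˡ a₁ e)))
      go (is-23 e)    = ⊥-elim (a₁≢a₂ (⊕-cancelˡ a₃
        (≡.trans (⊕-comm a₃ a₁) (≡.trans e (⊕-comm a₂ a₃)))))
      go (from-X i e) = ⊥-elim (X≢spine i _ (sym (⊕-cancelˡ a₁ e)))
      go (from-Y i e) = inj₂ (i , sym e)
      go (from-Z i e) = ⊥-elim (Z≢spine i _ (sym (⊕-cancelˡ a₃ (≡.trans (⊕-comm a₃ a₁) e))))

    not-case₂ : y ≡ 0 → + x ≈ - 1ℤ → + z ≈ - + 2 → ⊥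
    not-case₂ refl ex ez = go cross-label
      where
      id₁ : ∀ a b c m → b - c ≡ (- 1ℤ * a + 1ℤ * b + - + 2 * c + m + (a + c)) - (0ℤ + m)
      id₁ = solve-∀
      go : (a₁ ⊕ a₃ ≡ m ⊎ ∃ λ i → a₂ ⊕ leafY i ≡ a₁ ⊕ a₃) → ⊥
      -- Substituting m = a₁ + a₃ into - a₁ + a₂ - 2 a₃ + m = 0 leaves a₂ = a₃.
      go (inj₁ e) = a₂≢a₃ (coord-injective λ j → shift
        (+-cong (relation ex ≈-refl ez j) (≈-trans (≈-sym (coord-⊕ a₁ a₃ j)) (coords e j)))
        (id₁ (coord a₁ j) (coord a₂ j) (coord a₃ j) (coord m j)))

    module OneMiddleLeaf (y≡1 : y ≡ 1) (ex : + x ≈ - 1ℤ) (ez : + z ≈ - + 3) where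

      ey : 1ℤ + + y ≈ + 2
      ey = ≡⇒≈ (cong (λ t → 1ℤ + + t) y≡1)

      y₀ : Fin y
      y₀ = subst Fin (sym y≡1) Fin.zero

      only-y₀ : ∀ i → leafY i ≡ leafY y₀
      only-y₀ i = cong leafY (unique y≡1 i)
        where
        unique : ∀ {n} (e : n ≡ 1) (i : Fin n) → i ≡ subst Fin (sym e) Fin.zero
        unique refl Fin.zero = refl

      -- Were a₁ + a₃ the missing label, then - a₁ + 2 a₂ - 3 a₃ + m = 0 would turn into 2 a₂ = 2
      -- a₃.
      cross : a₂ ⊕ leafY y₀ ≡ a₁ ⊕ a₃
      cross = go cross-label
        where
        id₁ : ∀ a b c m → + 2 * b - + 2 * c ≡ (- 1ℤ * a + + 2 * b + - + 3 * c + m + (a + c)) - (0ℤ + m)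
        id₁ = solve-∀
        go : (a₁ ⊕ a₃ ≡ m ⊎ ∃ λ i → a₂ ⊕ leafY i ≡ a₁ ⊕ a₃) → a₂ ⊕ leafY y₀ ≡ a₁ ⊕ a₃
        go (inj₁ e) = ⊥-elim (a₂≢a₃ (coord-injective λ j → *-cancelˡ +2≉0 (shift
          (+-cong (relation ex ey ez j) (≈-trans (≈-sym (coord-⊕ a₁ a₃ j)) (coords e j)))
          (id₁ (coord a₁ j) (coord a₂ j) (coord a₃ j) (coord m j)))))
        go (inj₂ (i , e)) = ≡.trans (cong (a₂ ⊕_) (sym (only-y₀ i))) e

      δ : Fin k → ℤ
      δ j = coord a₃ j - coord a₁ j

      -- The leaves of s₁ and s₃ on the line through a₁ and a₃ are determined by walking along it.
      e : ℕ → Zpk p k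
      e n = fromCoords λ j → coord a₁ j + + n * δ j

      coord-e : ∀ n j → coord (e n) j ≈ coord a₁ j + + n * δ j
      coord-e n = coord-fromCoords λ j → coord a₁ j + + n * δ j

      e-cong : ∀ {i n} → + i ≈ + n → e i ≡ e n
      e-cong {i} {n} h = coord-injective λ j → ≈-trans (coord-e i j)
        (≈-trans (+-cong (≈-refl {coord a₁ j}) (*-cong h (≈-refl {δ j}))) (≈-sym (coord-e n j)))

      -- `δ` is nonzero, but no particular coordinate of it is known to be. So the argument runs
      -- backwards: if the scalars differed modulo `p`, every coordinate of `δ` would vanish and
      -- `a₁` would equal `a₃`.
      δ-faithful : ∀ {s t} → (∀ j → s * δ j ≈ t * δ j) → s ≈ t
      δ-faithful {s} {t} h with residue s Fin.≟ residue t
      ... | yes eq = residue-injective eq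
      ... | no s≢t = ⊥-elim (a₁≢a₃ (coord-injective λ j → ≈-sym (δ-zero j)))
        where
        id₁ : ∀ s t d → (s - t) * d - 0ℤ ≡ s * d - t * d
        id₁ = solve-∀
        id₂ : ∀ s t → s - t ≡ s - t - 0ℤ
        id₂ = solve-∀
        δ-zero : ∀ j → coord a₃ j ≈ coord a₁ j
        δ-zero j = go (integral (s - t) (δ j) (shift (h j) (id₁ s t (δ j))))
          where
          go : s - t ≈ 0ℤ ⊎ δ j ≈ 0ℤ → coord a₃ j ≈ coord a₁ j
          go (inj₁ s-t≈0) = ⊥-elim (s≢t (residue-cong {s} {t} (shift s-t≈0 (id₂ s t))))
          go (inj₂ d≈0)   = shift d≈0 (id₂ (coord a₃ j) (coord a₁ j))

      e-injective : ∀ {i n} → e i ≡ e n → + i ≈ + n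
      e-injective {i} {n} eq = δ-faithful λ j → +-cancelˡ (coord a₁ j)
        (≈-trans (≈-sym (coord-e i j)) (≈-trans (coords eq j) (coord-e n j)))

      e0 : e 0 ≡ a₁
      e0 = coord-injective λ j → ≈-trans (coord-e 0 j) (≡⇒≈ (id₁ (coord a₁ j) (δ j)))
        where
        id₁ : ∀ a d → a + 0ℤ * d ≡ a
        id₁ = solve-∀

      e1 : e 1 ≡ a₃
      e1 = coord-injective λ j → ≈-trans (coord-e 1 j) (≡⇒≈ (id₁ (coord a₁ j) (coord a₃ j)))
        where
        id₁ : ∀ a c → a + 1ℤ * (c - a) ≡ c
        id₁ = solve-∀

      ep : e p ≡ a₁
      ep = ≡.trans (e-cong p≈0) e0

      -- Since `δ` is a₃ - a₁, trading `a₁` for `a₃` makes up for one step along the line. A leaf of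
      -- s₃ at `e n` and a leaf of s₁ at `e (suc n)` would therefore collide, and this collision
      -- drives all the forcing below.
      e-step : ∀ n → a₁ ⊕ e (suc n) ≡ a₃ ⊕ e n
      e-step n = coord-injective λ j → ≈-trans (coord-⊕ a₁ (e (suc n)) j)
        (≈-trans (+-cong (≈-refl {coord a₁ j}) (coord-e (suc n) j))
          (≈-trans (≡⇒≈ (id₁ (coord a₁ j) (coord a₃ j) (+ n)))
            (≈-sym (≈-trans (coord-⊕ a₃ (e n) j) (+-cong (≈-refl {coord a₃ j}) (coord-e n j))))))
        where
        id₁ : ∀ a c n → a + (a + (1ℤ + n) * (c - a)) ≡ c + (a + n * (c - a))
        id₁ = solve-∀

      FX FZ : ℕ → Set
      FX n = ∃ λ i → e n ≡ leafX i
      FZ n = ∃ λ i → e n ≡ leafZ i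

      FX-spine : ∀ {n} j → FX n → e n ≢ f (inj₁ j)
      FX-spine j (i , eq) h = X≢spine i j (≡.trans (sym eq) h)

      FX-y₀ : ∀ {n} → FX n → e n ≢ leafY y₀
      FX-y₀ (i , eq) h = X≢Y i y₀ (≡.trans (sym eq) h)

      FX⇒¬FZ : ∀ {n} → FX n → ¬ FZ n
      FX⇒¬FZ (i , eq) (l , eq′) =
        case f-injective {inj₂ (inj₁ i)} {inj₂ (inj₂ (inj₂ l))} (≡.trans (sym eq) eq′) of λ ()

      FX-label : ∀ {n} → FX n → ∃ λ i → label (eX i) ≡ a₁ ⊕ e n
      FX-label (i , eq) = i , cong (a₁ ⊕_) (sym eq)

      FZ-label : ∀ {n} → FZ n → ∃ λ i → label (eZ i) ≡ a₁ ⊕ e (suc n)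
      FZ-label {n} (i , eq) = i , ≡.trans (cong (a₃ ⊕_) (sym eq)) (sym (e-step n))

      FX≢m : ∀ {n} → FX n → a₁ ⊕ e n ≢ m
      FX≢m {n} h eq with FX-label {n} h
      ... | i , l = label≢m (eX i) (≡.trans l eq)

      FZ-next : ∀ {n} → FZ n → ¬ FX (suc n)
      FZ-next {n} h h′ = clash (FZ-label {n} h) (FX-label {suc n} h′)
        where
        clash : ∀ {u} → (∃ λ i → label (eZ i) ≡ u) → (∃ λ i → label (eX i) ≡ u) → ⊥
        clash (i , l) (i′ , l′) = distinct (eZ i) (eX i′) l l′ (λ ()) refl

      -- The only two ways in which the run of leaves of s₁ can end: the label a₁ + e n is the
      -- missing one, or it belongs to the edge s₁s₂.
      Stop : ℕ → Set
      Stop n = a₁ ⊕ e n ≡ m ⊎ e n ≡ a₂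

      -- Ask which edge carries the label a₁ + e (n + 2) = a₃ + e (n + 1). The edge s₂s₃ or a leaf
      -- of s₃ would require `e (suc n)` to be `a₂` or such a leaf, but it is `a₃` or already a leaf
      -- of s₁; and the leaf of s₂ has the label a₁ + e 1.
      step : ∀ n → suc (suc n) ℕ.≤ p → (∀ i → 2 ℕ.≤ i → i ℕ.≤ suc n → FX i) → Stop (suc (suc n)) ⊎ FX (suc (suc n))
      step n n≤p below = go (label-case (a₁ ⊕ e (suc (suc n))))
        where
        not-FZ : ∀ n → (∀ i → 2 ℕ.≤ i → i ℕ.≤ suc n → FX i) → ¬ FZ (suc n)
        not-FZ zero    below (i , eq) = Z≢spine i _ (≡.trans (sym eq) e1)
        not-FZ (suc n) below = FX⇒¬FZ {suc (suc n)} (below _ (s≤s (s≤s z≤n)) ℕ.≤-refl)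
        not-a₂ : ∀ n → (∀ i → 2 ℕ.≤ i → i ℕ.≤ suc n → FX i) → e (suc n) ≢ a₂
        not-a₂ zero    below eq = a₂≢a₃ (≡.trans (sym eq) e1)
        not-a₂ (suc n) below = FX-spine {suc (suc n)} _ (below _ (s≤s (s≤s z≤n)) ℕ.≤-refl)
        go : LabelCase (a₁ ⊕ e (suc (suc n))) → Stop (suc (suc n)) ⊎ FX (suc (suc n))
        go (is-m h)     = inj₁ (inj₁ h)
        go (is-12 h)    = inj₁ (inj₂ (⊕-cancelˡ a₁ h))
        go (is-23 h)    = ⊥-elim (not-a₂ n below (⊕-cancelˡ a₃
          (≡.trans (sym (e-step (suc n))) (≡.trans h (⊕-comm a₂ a₃)))))
        go (from-X i h) = inj₂ (i , ⊕-cancelˡ a₁ h)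
        go (from-Y i h) = ⊥-elim (not-e1 (⊕-cancelˡ a₁
          (≡.trans h (≡.trans (cong (a₂ ⊕_) (only-y₀ i)) (≡.trans cross (cong (a₁ ⊕_) (sym e1)))))))
          where
          not-e1 : e (suc (suc n)) ≢ e 1
          -- The window starts at 1 because the index may be as large as `p`.
          not-e1 eq = case window {1} (s≤s z≤n) (s≤s n≤p) (s≤s z≤n) (s≤s (s≤s z≤n)) (e-injective {suc (suc n)} {1} eq) of λ ()
        go (from-Z i h) = ⊥-elim (not-FZ n below (i , ⊕-cancelˡ a₃ (≡.trans (sym (e-step (suc n))) h)))

      FirstStop : Set
      FirstStop = ∃ λ s → 2 ℕ.≤ s × s ℕ.≤ p × Stop s × (∀ i → 2 ℕ.≤ i → i ℕ.< s → FX i)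

      walk : ∀ d n → d ℕ.+ suc (suc n) ≡ p → (∀ i → 2 ℕ.≤ i → i ℕ.≤ suc n → FX i) → FirstStop
      walk d n eq below = go d eq (step n n≤p below)
        where
        n≤p : suc (suc n) ℕ.≤ p
        n≤p = subst (suc (suc n) ℕ.≤_) eq (ℕ.m≤n+m _ d)
        go : ∀ d → d ℕ.+ suc (suc n) ≡ p → Stop (suc (suc n)) ⊎ FX (suc (suc n)) → FirstStop
        go _       eq (inj₁ stop) =
          suc (suc n) , s≤s (s≤s z≤n) , n≤p , stop , λ i 2≤i i<s → below i 2≤i (ℕ.s≤s⁻¹ i<s)
        -- The walk cannot get past `p`, because `e p` is `a₁`, which is not a leaf.
        go zero    eq (inj₂ fx) =
          ⊥-elim (FX-spine {suc (suc n)} Fin.zero fx (≡.trans (cong e eq) ep))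
        go (suc d) eq (inj₂ fx) = walk d (suc n) (≡.trans (ℕ.+-suc d _) eq) below′
          where
          below′ : ∀ i → 2 ℕ.≤ i → i ℕ.≤ suc (suc n) → FX i
          below′ i 2≤i i≤ with ℕ.m≤n⇒m<n∨m≡n i≤
          ... | inj₁ i< = below i 2≤i (ℕ.s≤s⁻¹ i<)
          ... | inj₂ refl = fx

      first-stop : FirstStop
      first-stop = walk (p ℕ.∸ 2) 0 (ℕ.m∸n+n≡m (ℕ.≤-trans (s≤s (s≤s z≤n)) 5≤p))
        λ i 2≤i i≤1 → ⊥-elim (ℕ.<⇒≱ 2≤i i≤1)

      e-below-p : ∀ {i n} → i ℕ.< p → n ℕ.< p → e i ≡ e n → i ≡ n
      e-below-p {i} {n} i<p n<p eq = below-p i<p n<p (e-injective {i} {n} eq)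

      module Indexed (j l : ℕ) (2≤j : 2 ℕ.≤ j) (j<p : j ℕ.< p) (l+j : l ℕ.+ j ≡ suc p)
                     (a₂≡ : a₂ ≡ e j) where

        l<p : l ℕ.< p
        l<p = ℕ.+-cancelʳ-≤ 1 (suc l) p (ℕ.≤-trans
          (subst (ℕ._≤ l ℕ.+ j) (ar l) (ℕ.+-monoʳ-≤ l 2≤j))
          (ℕ.≤-reflexive (≡.trans l+j (ℕ.+-comm 1 p))))
          where
          ar : ∀ l → l ℕ.+ 2 ≡ suc l ℕ.+ 1
          ar = ℕSolver.solve-∀

        2≤l : 2 ℕ.≤ l
        2≤l = ℕ.+-cancelʳ-≤ j 2 l (subst (2 ℕ.+ j ℕ.≤_) (sym l+j) (s≤s j<p))

        -- By `cross`, the indices of `a₂` and of this leaf add up to those of `a₁` and `a₃`, which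
        -- is 0 + 1 modulo `p`. As both representatives lie between 2 and `p` - 1, their sum is `p`
        -- + 1.
        y₀≡ : leafY y₀ ≡ e l
        y₀≡ = coord-injective λ i → ≈-trans (shift
            (+-cong (+-cong (≈-trans (≈-sym (coord-⊕ a₂ (leafY y₀) i))
              (≈-trans (coords cross i) (coord-⊕ a₁ a₃ i)))
              (≈-sym (≈-trans (coords a₂≡ i) (coord-e j i))))
              (*-cong idx (≈-refl {δ i})))
            (id₁ (coord a₁ i) (coord a₂ i) (coord a₃ i) (coord (leafY y₀) i) (+ l) (+ j)))
          (≈-sym (coord-e l i))
          where
          idx : 1ℤ ≈ + (l ℕ.+ j)
          idx = ≈-trans (shift (≈-sym p≈0) (id₂ (+ p))) (≡⇒≈ (cong +_ (sym l+j)))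
            where
            id₂ : ∀ q → 1ℤ - (1ℤ + q) ≡ 0ℤ - q
            id₂ = solve-∀
          id₁ : ∀ a b c y l j → y - (a + l * (c - a)) ≡
            (b + y + (a + j * (c - a)) + 1ℤ * (c - a)) - (a + c + b + (l + j) * (c - a))
          id₁ = solve-∀

        a₂≈ : ∀ i → coord a₂ i ≈ coord a₁ i + + j * δ i
        a₂≈ i = ≈-trans (coords a₂≡ i) (coord-e j i)

        label-e≈ : ∀ n i → coord (a₁ ⊕ e n) i ≈ coord a₁ i + (coord a₁ i + + n * δ i)
        label-e≈ n i = ≈-trans (coord-⊕ a₁ (e n) i) (+-cong (≈-refl {coord a₁ i}) (coord-e n i))

        -- With a₂ = a₁ + j δ the sum relation becomes m = 2 a₁ + (3 - 2 j) δ, whereas a₁ + e n = 2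
        -- a₁ + n δ.
        m-at : ∀ n → + (n ℕ.+ (j ℕ.+ j)) ≈ + 3 → a₁ ⊕ e n ≡ m
        m-at n h = coord-injective λ i → ≈-trans (label-e≈ n i) (shift
          (+-cong (+-cong (*-cong h (≈-refl {δ i})) (≈-sym (relation ex ey ez i)))
            (*-cong (≈-refl {+ 2}) (a₂≈ i)))
          (id₁ (coord a₁ i) (coord a₂ i) (coord a₃ i) (coord m i) (+ n) (+ j)))
          where
          id₁ : ∀ a b c m n j → a + (a + n * (c - a)) - m ≡
            ((n + (j + j)) * (c - a) + 0ℤ + + 2 * b) -
            (+ 3 * (c - a) + (- 1ℤ * a + + 2 * b + - + 3 * c + m) + + 2 * (a + j * (c - a)))
          id₁ = solve-∀

        m-index : ∀ n → a₁ ⊕ e n ≡ m → + (n ℕ.+ (j ℕ.+ j)) ≈ + 3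
        m-index n h = δ-faithful λ i → shift
          (+-cong (+-cong (≈-trans (≈-sym (label-e≈ n i)) (coords h i)) (relation ex ey ez i))
            (*-cong (≈-refl { + 2}) (≈-sym (a₂≈ i))))
          (id₁ (coord a₁ i) (coord a₂ i) (coord a₃ i) (coord m i) (+ n) (+ j))
          where
          id₁ : ∀ a b c m n j → (n + (j + j)) * (c - a) - + 3 * (c - a) ≡
            (a + (a + n * (c - a)) + (- 1ℤ * a + + 2 * b + - + 3 * c + m) + + 2 * (a + j * (c - a))) -
            (m + 0ℤ + + 2 * b)
          id₁ = solve-∀

        not-FX⇒FZ : ∀ i → 2 ℕ.≤ i → i ℕ.< p → i ≢ j → i ≢ l → ¬ FX i → FZ i
        not-FX⇒FZ i 2≤i i<p i≢j i≢l ¬fx = go (vertex-case (e i))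
          where
          0<p : 0 ℕ.< p
          0<p = s≤s z≤n
          1<p : 1 ℕ.< p
          1<p = ℕ.<-trans 2≤i i<p
          go : VertexCase (e i) → FZ i
          go (is-a₁ h) = ⊥-elim (ℕ.<⇒≢ (ℕ.<-trans (s≤s z≤n) 2≤i)
            (sym (e-below-p i<p 0<p (≡.trans h (sym e0)))))
          go (is-a₂ h) = ⊥-elim (i≢j (e-below-p i<p j<p (≡.trans h a₂≡)))
          go (is-a₃ h) = ⊥-elim (ℕ.<⇒≢ 2≤i (sym (e-below-p i<p 1<p (≡.trans h (sym e1)))))
          go (in-X n h) = ⊥-elim (¬fx (n , h))
          go (in-Y n h) = ⊥-elim (i≢l (e-below-p i<p l<p (≡.trans h (≡.trans (only-y₀ n) y₀≡))))
          go (in-Z n h) = n , h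

        -- By `FZ-next`, a leaf of s₃ keeps the next element of the line from being a leaf of s₁.
        -- Away from the indices `j` and `l` this makes the next element a leaf of s₃ again, so a
        -- single failure of `FX` propagates.
        chain : ∀ n d → 2 ℕ.≤ n → ¬ FX n → d ℕ.+ n ℕ.< p →
                (∀ i → n ℕ.≤ i → i ℕ.≤ d ℕ.+ n → i ≢ j × i ≢ l) → FZ (d ℕ.+ n)
        chain n zero 2≤n ¬fx <p free =
          not-FX⇒FZ n 2≤n <p (proj₁ (free n ℕ.≤-refl ℕ.≤-refl)) (proj₂ (free n ℕ.≤-refl ℕ.≤-refl)) ¬fx
        chain n (suc d) 2≤n ¬fx <p free =
          not-FX⇒FZ (suc d ℕ.+ n) (ℕ.≤-trans 2≤n (ℕ.m≤n+m n (suc d))) <p (proj₁ avoided) (proj₂ avoided)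
            (FZ-next {d ℕ.+ n} (chain n d 2≤n ¬fx (ℕ.<-trans (ℕ.n<1+n _) <p)
              (λ i n≤i i≤ → free i n≤i (ℕ.m≤n⇒m≤1+n i≤))))
          where
          avoided = free (suc d ℕ.+ n) (ℕ.m≤n+m n (suc d)) ℕ.≤-refl

        -- The last leaf of the run sits at index `t` - 1, and its label is a₁ + e t. Index `t`
        -- itself lies outside the run and may be `j` or `l`.
        chain-to : ∀ n t → 2 ℕ.≤ n → n ℕ.< t → t ℕ.≤ p → ¬ FX n →
                   (∀ i → n ℕ.≤ i → i ℕ.< t → i ≢ j × i ≢ l) →
                   ∃ λ i → label (eZ i) ≡ a₁ ⊕ e t
        chain-to n (suc t) 2≤n n<t t≤p ¬fx free = FZ-label {t}
          (subst FZ (ℕ.m∸n+n≡m n≤t) (chain n (t ℕ.∸ n) 2≤n ¬fx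
            (subst (ℕ._< p) (sym (ℕ.m∸n+n≡m n≤t)) t≤p)
            λ i n≤i i≤ → free i n≤i (s≤s (subst (i ℕ.≤_) (ℕ.m∸n+n≡m n≤t) i≤))))
          where
          n≤t = ℕ.s≤s⁻¹ n<t

        y₀-not-FX : ¬ FX l
        y₀-not-FX fx = FX-y₀ {l} fx (sym y₀≡)

        -- From 2 ≤ n < j < p, the congruence n + 2 j ≡ 3 leaves p + 3 and 2 p + 3 as values of n +
        -- 2 j. In the first case j ≤ l, so leaves of s₃ run from n to j - 1 and the last one
        -- repeats the label of s₁s₂. In the second n = 2 l + 1 > l, so the leaf of s₂ would be a
        -- leaf of s₁.
        stop-at-m : ∀ n → 2 ℕ.≤ n → n ℕ.≤ p → a₁ ⊕ e n ≡ m → (∀ i → 2 ℕ.≤ i → i ℕ.< n → FX i) → ⊥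
        stop-at-m n 2≤n n≤p em below = compare
          where
          N = n ℕ.+ (j ℕ.+ j)
          j≮n : ¬ j ℕ.< n
          j≮n j<n = FX-spine {j} _ (below j 2≤j j<n) (sym a₂≡)
          n≢j : n ≢ j
          n≢j refl = label≢m e₁₂ (≡.trans (cong (a₁ ⊕_) a₂≡) em)
          n<j : n ℕ.< j
          n<j = ℕ.≤∧≢⇒< (ℕ.≮⇒≥ j≮n) n≢j
          N≈3 : + N ≈ + 3
          N≈3 = m-index n em
          6≤N : 6 ℕ.≤ N
          6≤N = ℕ.+-mono-≤ 2≤n (ℕ.+-mono-≤ 2≤j 2≤j)
          3≤N : 3 ℕ.≤ N
          3≤N = ℕ.≤-trans (s≤s (s≤s (s≤s z≤n))) 6≤N
          ≈+p : ∀ a → + a ≈ + (a ℕ.+ p)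
          ≈+p a = ≈-trans (≡⇒≈ (sym (ℤ.+-identityʳ (+ a)))) (+-cong (≈-refl {+ a}) (≈-sym p≈0))
          a<a+p : ∀ a → a ℕ.< a ℕ.+ p
          a<a+p a = ℕ.m<m+n a (s≤s z≤n)
          N<3p : N ℕ.< 3 ℕ.+ p ℕ.+ p ℕ.+ p
          N<3p = ℕ.<-≤-trans
            (ℕ.+-mono-≤-< n≤p (ℕ.+-mono-< j<p j<p))
            (ℕ.≤-trans (ℕ.m≤n+m (p ℕ.+ (p ℕ.+ p)) 3) (ℕ.≤-reflexive (ar p)))
            where
            ar : ∀ p → 3 ℕ.+ (p ℕ.+ (p ℕ.+ p)) ≡ 3 ℕ.+ p ℕ.+ p ℕ.+ p
            ar = ℕSolver.solve-∀
          first : N ≡ 3 ℕ.+ p → ⊥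
          first eq = done (chain-to n j 2≤n n<j (ℕ.<⇒≤ j<p) (λ fx → FX≢m {n} fx em)
              (λ i _ i<j → ℕ.<⇒≢ i<j , ℕ.<⇒≢ (ℕ.<-≤-trans i<j j≤l)))
            where
            ar₁ : ∀ n j → n ℕ.+ (j ℕ.+ j) ≡ n ℕ.+ j ℕ.+ j
            ar₁ = ℕSolver.solve-∀
            ar₂ : ∀ l j → 2 ℕ.+ (l ℕ.+ j) ≡ l ℕ.+ 2 ℕ.+ j
            ar₂ = ℕSolver.solve-∀
            nj : n ℕ.+ j ≡ l ℕ.+ 2
            nj = ℕ.+-cancelʳ-≡ j _ _ (≡.trans (sym (ar₁ n j)) (≡.trans eq
              (≡.trans (cong (2 ℕ.+_) (sym l+j)) (ar₂ l j))))
            j≤l : j ℕ.≤ l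
            j≤l = ℕ.+-cancelˡ-≤ 2 j l (ℕ.≤-trans (ℕ.+-monoˡ-≤ j 2≤n)
              (ℕ.≤-reflexive (≡.trans nj (ℕ.+-comm l 2))))
            done : (∃ λ i → label (eZ i) ≡ a₁ ⊕ e j) → ⊥
            done (i , h) = distinct (eZ i) e₁₂ h (cong (a₁ ⊕_) a₂≡) (λ ()) refl
          second : N ≡ 3 ℕ.+ p ℕ.+ p → ⊥
          second eq = y₀-not-FX (below l 2≤l l<n)
            where
            ar₁ : ∀ p → 3 ℕ.+ p ℕ.+ p ≡ suc (suc p ℕ.+ suc p)
            ar₁ = ℕSolver.solve-∀
            ar₂ : ∀ l j → suc (l ℕ.+ j ℕ.+ (l ℕ.+ j)) ≡ suc (l ℕ.+ l) ℕ.+ (j ℕ.+ j)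
            ar₂ = ℕSolver.solve-∀
            n≡ : n ≡ suc (l ℕ.+ l)
            n≡ = ℕ.+-cancelʳ-≡ (j ℕ.+ j) _ _ (≡.trans eq (≡.trans (ar₁ p)
              (≡.trans (cong (λ t → suc (t ℕ.+ t)) (sym l+j)) (ar₂ l j))))
            l<n : l ℕ.< n
            l<n = subst (l ℕ.<_) (sym n≡) (s≤s (ℕ.m≤m+n l l))
          compare : ⊥
          compare with N ℕ.<? 3 ℕ.+ p
          ... | yes N<₁ = ℕ.<⇒≢ (ℕ.≤-trans (s≤s (s≤s (s≤s (s≤s z≤n)))) 6≤N)
                            (sym (window {3} 3≤N N<₁ ℕ.≤-refl (a<a+p 3) N≈3))
          ... | no N≮₁ with N ℕ.<? 3 ℕ.+ p ℕ.+ p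
          ...   | yes N<₂ = first (window {3 ℕ.+ p} (ℕ.≮⇒≥ N≮₁) N<₂ ℕ.≤-refl (a<a+p (3 ℕ.+ p))
                              (≈-trans N≈3 (≈+p 3)))
          ...   | no N≮₂ = second (window {3 ℕ.+ p ℕ.+ p} (ℕ.≮⇒≥ N≮₂) N<3p ℕ.≤-refl
                              (a<a+p (3 ℕ.+ p ℕ.+ p))
                              (≈-trans N≈3 (≈-trans (≈+p 3) (≈+p (3 ℕ.+ p)))))

        -- The missing label belongs to the index n = p + 3 - 2 j, and j + 1 < n ≤ l. A leaf of s₁
        -- at `e (suc j)` would repeat the label of s₂s₃, so leaves of s₃ run from j + 1 to n - 1,
        -- and the label of the last one is `m`.
        stop-at-a₂ : (∀ i → 2 ℕ.≤ i → i ℕ.< j → FX i) → ⊥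
        stop-at-a₂ below = done (chain-to (suc j) n (ℕ.≤-trans 2≤j (ℕ.n≤1+n j))
            (ℕ.≤∧≢⇒< j<n (λ eq → label≢m e₂₃ (≡.trans (sym succ) (≡.trans (cong (λ t → a₁ ⊕ e t) eq) em))))
            (ℕ.≤-trans n≤l (ℕ.<⇒≤ l<p))
            not-X
            (λ i j<i i<n → (λ eq → ℕ.<⇒≢ j<i (sym eq)) , ℕ.<⇒≢ (ℕ.<-≤-trans i<n n≤l)))
          where
          j≤l : j ℕ.≤ l
          j≤l = ℕ.≮⇒≥ λ l<j → y₀-not-FX (below l 2≤l l<j)
          2≤p+3 : j ℕ.+ j ℕ.≤ 3 ℕ.+ p
          2≤p+3 = ℕ.≤-trans (ℕ.+-monoˡ-≤ j j≤l)
            (ℕ.≤-trans (ℕ.≤-reflexive l+j) (ℕ.m≤n+m (suc p) 2))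
          n = 3 ℕ.+ p ℕ.∸ (j ℕ.+ j)
          n+2j : n ℕ.+ (j ℕ.+ j) ≡ 3 ℕ.+ p
          n+2j = ℕ.m∸n+n≡m 2≤p+3
          em : a₁ ⊕ e n ≡ m
          em = m-at n (≈-trans (≡⇒≈ (cong +_ n+2j))
            (≈-trans (+-cong (≈-refl { + 3}) p≈0) (≡⇒≈ refl)))
          ar₁ : ∀ n j → n ℕ.+ (j ℕ.+ j) ≡ n ℕ.+ j ℕ.+ j
          ar₁ = ℕSolver.solve-∀
          ar₂ : ∀ l j → 2 ℕ.+ (l ℕ.+ j) ≡ l ℕ.+ 2 ℕ.+ j
          ar₂ = ℕSolver.solve-∀
          nj : n ℕ.+ j ≡ l ℕ.+ 2
          nj = ℕ.+-cancelʳ-≡ j _ _ (≡.trans (sym (ar₁ n j)) (≡.trans n+2j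
              (≡.trans (cong (2 ℕ.+_) (sym l+j)) (ar₂ l j))))
          n≤l : n ℕ.≤ l
          n≤l = ℕ.+-cancelʳ-≤ 2 n l (ℕ.≤-trans (ℕ.+-monoʳ-≤ n 2≤j) (ℕ.≤-reflexive nj))
          2≤n : 2 ℕ.≤ n
          2≤n = ℕ.+-cancelʳ-≤ j 2 n (ℕ.≤-trans (ℕ.+-monoʳ-≤ 2 j≤l)
            (ℕ.≤-reflexive (≡.trans (ℕ.+-comm 2 l) (sym nj))))
          n≢j : n ≢ j
          n≢j eq = label≢m e₁₂ (≡.trans (cong (a₁ ⊕_) a₂≡) (≡.trans (cong (λ t → a₁ ⊕ e t) (sym eq)) em))
          j<n : j ℕ.< n
          j<n = ℕ.≤∧≢⇒< (ℕ.≮⇒≥ λ n<j → FX≢m {n} (below n 2≤n n<j) em) (≢-sym n≢j)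
          succ : a₁ ⊕ e (suc j) ≡ a₂ ⊕ a₃
          succ = ≡.trans (e-step j) (≡.trans (cong (a₃ ⊕_) (sym a₂≡)) (⊕-comm a₃ a₂))
          not-X : ¬ FX (suc j)
          not-X fx with FX-label {suc j} fx
          ... | i , h = distinct (eX i) e₂₃ h (sym succ) (λ ()) refl
          done : (∃ λ i → label (eZ i) ≡ a₁ ⊕ e n) → ⊥
          done (i , h) = label≢m (eZ i) (≡.trans h em)

      indexed : ∀ j → j ℕ.≤ p → a₂ ≡ e j →
                2 ℕ.≤ j × j ℕ.< p × (suc p ℕ.∸ j) ℕ.+ j ≡ suc p
      indexed zero          _   eq = ⊥-elim (a₁≢a₂ (≡.trans (sym e0) (sym eq)))
      indexed (suc zero)    _   eq = ⊥-elim (a₂≢a₃ (≡.trans eq e1))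
      indexed (suc (suc j)) j≤p eq = s≤s (s≤s z≤n)
        , ℕ.≤∧≢⇒< j≤p (λ h → a₁≢a₂ (≡.trans (sym ep) (≡.trans (cong e (sym h)) (sym eq))))
        , ℕ.m∸n+n≡m (ℕ.m≤n⇒m≤1+n j≤p)

      -- If the walk stops at m then a₂ is on the line as well: 2 a₂ is determined by m, and 2 is
      -- invertible.
      a₂-index : ∀ n → a₁ ⊕ e n ≡ m → ∃ λ j → j ℕ.< p × a₂ ≡ e j
      a₂-index n em = toℕ r , Fin.toℕ<n r , coord-injective λ i →
          ≈-trans (at i) (≈-sym (≈-trans (coord-e (toℕ r) i)
            (+-cong (≈-refl {coord a₁ i}) (*-cong r≈ (≈-refl {δ i})))))
        where
        h : ℤ
        h = proj₁ (inverse +2≉0)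
        r : Fin p
        r = residue (h * (+ 3 - + n))
        r≈ : + toℕ r ≈ h * (+ 3 - + n)
        r≈ = ≈-trans (≡⇒≈ (sym (val-toℕ r))) (val-residue (h * (+ 3 - + n)))
        id₁ : ∀ a b c m n h → + 2 * b - + 2 * (a + h * (+ 3 - n) * (c - a)) ≡
          (a + (a + n * (c - a)) + (- 1ℤ * a + + 2 * b + - + 3 * c + m) + 1ℤ * (+ 3 - n) * (c - a)) -
          (m + 0ℤ + h * + 2 * (+ 3 - n) * (c - a))
        id₁ = solve-∀
        m≈ : ∀ i → coord a₁ i + (coord a₁ i + + n * δ i) ≈ coord m i
        m≈ i = ≈-trans (≈-sym (≈-trans (coord-⊕ a₁ (e n) i)
          (+-cong (≈-refl {coord a₁ i}) (coord-e n i)))) (coords em i)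
        half : ∀ i → 1ℤ * (+ 3 - + n) * δ i ≈ h * + 2 * (+ 3 - + n) * δ i
        half i = *-cong (*-cong (≈-sym (proj₂ (inverse +2≉0))) (≈-refl {+ 3 - + n})) (≈-refl {δ i})
        at : ∀ i → coord a₂ i ≈ coord a₁ i + h * (+ 3 - + n) * δ i
        at i = *-cancelˡ +2≉0 (shift (+-cong (+-cong (m≈ i) (relation ex ey ez i)) (half i))
          (id₁ (coord a₁ i) (coord a₂ i) (coord a₃ i) (coord m i) (+ n) h))

      impossible : ⊥
      impossible = go first-stop
        where
        at-m : ∀ n j → 2 ℕ.≤ n → n ℕ.≤ p → a₁ ⊕ e n ≡ m → (∀ i → 2 ℕ.≤ i → i ℕ.< n → FX i) →
               a₂ ≡ e j → 2 ℕ.≤ j × j ℕ.< p × (suc p ℕ.∸ j) ℕ.+ j ≡ suc p → ⊥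
        at-m n j 2≤n n≤p em below eq (2≤j , j<p , l+j) =
          Indexed.stop-at-m j _ 2≤j j<p l+j eq n 2≤n n≤p em below
        at-a₂ : ∀ n → e n ≡ a₂ → (∀ i → 2 ℕ.≤ i → i ℕ.< n → FX i) →
                2 ℕ.≤ n × n ℕ.< p × (suc p ℕ.∸ n) ℕ.+ n ≡ suc p → ⊥
        at-a₂ n eq below (2≤j , j<p , l+j) =
          Indexed.stop-at-a₂ n _ 2≤j j<p l+j (sym eq) below
        go : FirstStop → ⊥
        go (n , 2≤n , n≤p , inj₁ em , below) =
          at-m n j 2≤n n≤p em below (proj₂ (proj₂ (a₂-index n em)))
            (indexed j (ℕ.<⇒≤ (proj₁ (proj₂ (a₂-index n em)))) (proj₂ (proj₂ (a₂-index n em))))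
          where j = proj₁ (a₂-index n em)
        go (n , 2≤n , n≤p , inj₂ eq , below) = at-a₂ n eq below (indexed n n≤p (sym eq))

  -- An edge is recorded by its end away from s₂, or its leaf, coloured by the other end; S₁ and
  -- S₃ mark s₁ and s₃, which behave like leaves of s₂.
  data Color : Set where
    X Y Z S₁ S₃ : Color

  code : Color → ℕ
  code X  = 0
  code Y  = 1
  code Z  = 2
  code S₁ = 3
  code S₃ = 4

  same : Color → Color → Bool
  same κ κ′ = code κ ≡ᵇ code κ′

  same⇒≡ : ∀ κ κ′ → same κ κ′ ≡ true → κ ≡ κ′
  same⇒≡ X X _ = refl
  same⇒≡ Y Y _ = refl
  same⇒≡ Z Z _ = refl
  same⇒≡ S₁ S₁ _ = refl
  same⇒≡ S₃ S₃ _ = refl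

  byColor : ∀ {B : Set} → B → B → B → Color → B
  byColor b₁ b₂ b₃ X  = b₁
  byColor b₁ b₂ b₃ Y  = b₂
  byColor b₁ b₂ b₃ Z  = b₃
  byColor b₁ b₂ b₃ S₁ = b₂
  byColor b₁ b₂ b₃ S₃ = b₂

  bump : Bool → ℕ → ℕ
  bump true  n = suc n
  bump false n = n

  module _ {B : Set} where

    count : Color → List (Color × B) → ℕ
    count κ []              = 0
    count κ ((κ′ , _) ∷ xs) = bump (same κ κ′) (count κ xs)

    count-++ : ∀ κ xs ys → count κ (xs ++ ys) ≡ count κ xs ℕ.+ count κ ys
    count-++ κ []              ys = refl
    count-++ κ ((κ′ , _) ∷ xs) ys with same κ κ′
    ... | true  = cong suc (count-++ κ xs ys)
    ... | false = count-++ κ xs ys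

    pick : ∀ κ xs → Fin (count κ xs) → Fin (length xs)
    pick κ ((κ′ , _) ∷ xs) i with same κ κ′
    pick κ ((κ′ , _) ∷ xs) Fin.zero    | true  = Fin.zero
    pick κ ((κ′ , _) ∷ xs) (Fin.suc i) | true  = Fin.suc (pick κ xs i)
    pick κ ((κ′ , _) ∷ xs) i           | false = Fin.suc (pick κ xs i)

    pick-color : ∀ κ xs i → proj₁ (List.lookup xs (pick κ xs i)) ≡ κ
    pick-color κ ((κ′ , _) ∷ xs) i with same κ κ′ in eq
    pick-color κ ((κ′ , _) ∷ xs) Fin.zero    | true  = sym (same⇒≡ κ κ′ eq)
    pick-color κ ((κ′ , _) ∷ xs) (Fin.suc i) | true  = pick-color κ xs i
    pick-color κ ((κ′ , _) ∷ xs) i           | false = pick-color κ xs i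

    pick-injective : ∀ κ xs {i j} → pick κ xs i ≡ pick κ xs j → i ≡ j
    pick-injective κ ((κ′ , _) ∷ xs) {i} {j} e with same κ κ′
    pick-injective κ ((κ′ , _) ∷ xs) {Fin.zero}  {Fin.zero}  e | true = refl
    pick-injective κ ((κ′ , _) ∷ xs) {Fin.suc i} {Fin.suc j} e | true =
      cong Fin.suc (pick-injective κ xs (Fin.suc-injective e))
    ... | false = pick-injective κ xs (Fin.suc-injective e)

  count-map : ∀ {B C : Set} (g : B → C) κ xs →
              count κ (map (λ it → proj₁ it , g (proj₂ it)) xs) ≡ count κ xs
  count-map g κ []              = refl
  count-map g κ ((κ′ , _) ∷ xs) = cong (bump (same κ κ′)) (count-map g κ xs)

  allPairs-lookup : ∀ {B : Set} {R : B → B → Set} → (∀ {a b} → R a b → R b a) →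
    ∀ {xs} → AllPairs R xs → ∀ i j → i ≢ j → R (List.lookup xs i) (List.lookup xs j)
  allPairs-lookup sy (r ∷ rs) Fin.zero    Fin.zero    i≢j = ⊥-elim (i≢j refl)
  allPairs-lookup sy (r ∷ rs) Fin.zero    (Fin.suc j) i≢j = All.lookup r (∈-lookup j)
  allPairs-lookup sy (r ∷ rs) (Fin.suc i) Fin.zero    i≢j = sy (All.lookup r (∈-lookup i))
  allPairs-lookup sy (r ∷ rs) (Fin.suc i) (Fin.suc j) i≢j =
    allPairs-lookup sy rs i j (i≢j ∘ cong Fin.suc)

  -- From coloured arrangements to labelings.

  module Layouts (p-1 k : ℕ) where
    open Residues p-1
    open Vectors p-1

    Compatible : (a : Color → Zpk p k) → Color × Zpk p k → Color × Zpk p k → Set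
    Compatible a (κ , v) (κ′ , w) = v ≢ w × a κ ⊕ v ≢ a κ′ ⊕ w

    -- Only injectivity is demanded: once the number of vertices is that of the group, surjectivity
    -- follows by counting.
    record Layout : Set where
      field
        a₁ a₂ a₃ : Zpk p k
        items : List (Color × Zpk p k)
      centre : Color → Zpk p k
      centre = byColor a₁ a₂ a₃
      field
        compatible : AllPairs (Compatible centre) items
        avoids-a₂ : All (λ it → proj₂ it ≢ a₂) items
        S₁-at-a₁ : All (λ it → proj₁ it ≡ S₁ → proj₂ it ≡ a₁) items
        S₃-at-a₃ : All (λ it → proj₁ it ≡ S₃ → proj₂ it ≡ a₃) items
        count-S₁ : count S₁ items ≡ 1
        count-S₃ : count S₃ items ≡ 1

    module FromLayout (L : Layout) where
      open Layout L

      private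
        x = count X items
        y = count Y items
        z = count Z items
        V = Vertex x y z
        E = Edge x y z

        slot : E → Σ Color λ κ → Fin (count κ items)
        slot (inj₁ Fin.zero)           = S₁ , subst Fin (sym count-S₁) Fin.zero
        slot (inj₁ (Fin.suc Fin.zero)) = S₃ , subst Fin (sym count-S₃) Fin.zero
        slot (inj₂ (inj₁ i))           = X , i
        slot (inj₂ (inj₂ (inj₁ i)))    = Y , i
        slot (inj₂ (inj₂ (inj₂ i)))    = Z , i

        unslot : (Σ Color λ κ → Fin (count κ items)) → E
        unslot (X  , i) = inj₂ (inj₁ i)
        unslot (Y  , i) = inj₂ (inj₂ (inj₁ i))
        unslot (Z  , i) = inj₂ (inj₂ (inj₂ i))
        unslot (S₁ , _) = inj₁ Fin.zero
        unslot (S₃ , _) = inj₁ (Fin.suc Fin.zero)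

        unslot-slot : ∀ e → unslot (slot e) ≡ e
        unslot-slot (inj₁ Fin.zero)           = refl
        unslot-slot (inj₁ (Fin.suc Fin.zero)) = refl
        unslot-slot (inj₂ (inj₁ i))           = refl
        unslot-slot (inj₂ (inj₂ (inj₁ i)))    = refl
        unslot-slot (inj₂ (inj₂ (inj₂ i)))    = refl

        index : E → Fin (length items)
        index e = pick (proj₁ (slot e)) items (proj₂ (slot e))

        pick-slot : ∀ {κ κ′ i j} → pick κ items i ≡ pick κ′ items j →
                    _≡_ {A = Σ Color λ κ → Fin (count κ items)} (κ , i) (κ′ , j)
        pick-slot {κ} {κ′} {i} {j} eq
          with ≡.trans (sym (pick-color κ items i))
                 (≡.trans (cong (λ n → proj₁ (List.lookup items n)) eq) (pick-color κ′ items j))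
        ... | refl = cong (κ ,_) (pick-injective κ items eq)

        index-injective : ∀ d e → index d ≡ index e → d ≡ e
        index-injective d e eq =
          ≡.trans (sym (unslot-slot d)) (≡.trans (cong unslot (pick-slot eq)) (unslot-slot e))

        colorOf : E → Color
        colorOf e = proj₁ (slot e)

        value : E → Zpk p k
        value e = proj₂ (List.lookup items (index e))

        color-lookup : ∀ e → proj₁ (List.lookup items (index e)) ≡ colorOf e
        color-lookup e = pick-color (colorOf e) items (proj₂ (slot e))

        value-S₁ : value (inj₁ Fin.zero) ≡ a₁
        value-S₁ = All.lookup S₁-at-a₁ (∈-lookup (index (inj₁ Fin.zero)))
          (color-lookup (inj₁ Fin.zero))

        value-S₃ : value (inj₁ (Fin.suc Fin.zero)) ≡ a₃
        value-S₃ = All.lookup S₃-at-a₃ (∈-lookup (index (inj₁ (Fin.suc Fin.zero))))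
          (color-lookup (inj₁ (Fin.suc Fin.zero)))

        -- Each vertex other than s₂ is the outer end of exactly one edge. Injectivity on vertices
        -- thus reduces to injectivity on items, with `nothing` standing for s₂.
        far-end : V → Maybe E
        far-end (inj₁ Fin.zero)                     = just (inj₁ Fin.zero)
        far-end (inj₁ (Fin.suc Fin.zero))           = nothing
        far-end (inj₁ (Fin.suc (Fin.suc Fin.zero))) = just (inj₁ (Fin.suc Fin.zero))
        far-end (inj₂ l)                            = just (inj₂ l)

        far-end-injective : ∀ v w → far-end v ≡ far-end w → v ≡ w
        far-end-injective (inj₁ Fin.zero) (inj₁ Fin.zero) _ = refl
        far-end-injective (inj₁ (Fin.suc Fin.zero)) (inj₁ (Fin.suc Fin.zero)) _ = refl
        far-end-injective (inj₁ (Fin.suc (Fin.suc Fin.zero))) (inj₁ (Fin.suc (Fin.suc Fin.zero))) _ = refl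
        far-end-injective (inj₂ l) (inj₂ .l) refl = refl
        far-end-injective (inj₁ Fin.zero) (inj₁ (Fin.suc Fin.zero)) ()
        far-end-injective (inj₁ Fin.zero) (inj₁ (Fin.suc (Fin.suc Fin.zero))) ()
        far-end-injective (inj₁ Fin.zero) (inj₂ _) ()
        far-end-injective (inj₁ (Fin.suc Fin.zero)) (inj₁ Fin.zero) ()
        far-end-injective (inj₁ (Fin.suc Fin.zero)) (inj₁ (Fin.suc (Fin.suc Fin.zero))) ()
        far-end-injective (inj₁ (Fin.suc Fin.zero)) (inj₂ _) ()
        far-end-injective (inj₁ (Fin.suc (Fin.suc Fin.zero))) (inj₁ Fin.zero) ()
        far-end-injective (inj₁ (Fin.suc (Fin.suc Fin.zero))) (inj₁ (Fin.suc Fin.zero)) ()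
        far-end-injective (inj₁ (Fin.suc (Fin.suc Fin.zero))) (inj₂ _) ()
        far-end-injective (inj₂ _) (inj₁ Fin.zero) ()
        far-end-injective (inj₂ _) (inj₁ (Fin.suc Fin.zero)) ()
        far-end-injective (inj₂ _) (inj₁ (Fin.suc (Fin.suc Fin.zero))) ()

        at : Maybe E → Zpk p k
        at nothing  = a₂
        at (just e) = value e

        labeling : V → Zpk p k
        labeling v = at (far-end v)

        compatible-at : ∀ d e → index d ≢ index e →
          Compatible centre (List.lookup items (index d)) (List.lookup items (index e))
        compatible-at d e = allPairs-lookup (λ { (v , w) → ≢-sym v , ≢-sym w }) compatible (index d) (index e)

        value-injective : ∀ d e → value d ≡ value e → d ≡ e
        value-injective d e eq with index d Fin.≟ index e
        ... | yes same-index = index-injective d e same-index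
        ... | no  different  = ⊥-elim (proj₁ (compatible-at d e different) eq)

        at-injective : ∀ s t → at s ≡ at t → s ≡ t
        at-injective nothing  nothing  eq = refl
        at-injective nothing  (just e) eq = ⊥-elim (All.lookup avoids-a₂ (∈-lookup (index e)) (sym eq))
        at-injective (just d) nothing  eq = ⊥-elim (All.lookup avoids-a₂ (∈-lookup (index d)) eq)
        at-injective (just d) (just e) eq = cong just (value-injective d e eq)

        labeling-injective : ∀ {v w} → labeling v ≡ labeling w → v ≡ w
        labeling-injective {v} {w} eq = far-end-injective v w (at-injective _ _ eq)

        label≡ : ∀ e → edgeLabel {p} {k} {x} {y} {z} labeling e ≡ centre (colorOf e) ⊕ value e
        label≡ (inj₁ Fin.zero)           = ⊕-comm (value (inj₁ Fin.zero)) a₂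
        label≡ (inj₁ (Fin.suc Fin.zero)) = refl
        label≡ (inj₂ (inj₁ i))           = cong (_⊕ value (inj₂ (inj₁ i))) value-S₁
        label≡ (inj₂ (inj₂ (inj₁ i)))    = refl
        label≡ (inj₂ (inj₂ (inj₂ i)))    = cong (_⊕ value (inj₂ (inj₂ (inj₂ i)))) value-S₃

        label-injective : ∀ {d e} → edgeLabel {p} {k} {x} {y} {z} labeling d ≡
                                    edgeLabel {p} {k} {x} {y} {z} labeling e → d ≡ e
        label-injective {d} {e} eq with index d Fin.≟ index e
        ... | yes same-index = index-injective d e same-index
        ... | no  different  = ⊥-elim (proj₂ (compatible-at d e different)
                (≡.trans (cong (λ κ → centre κ ⊕ value d) (color-lookup d))
                (≡.trans (sym (label≡ d)) (≡.trans eq (≡.trans (label≡ e)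
                (cong (λ κ → centre κ ⊕ value e) (sym (color-lookup e))))))))

      layout⇒rainbow : x ℕ.+ y ℕ.+ z ℕ.+ 3 ≡ p ℕ.^ k → Rainbow p k x y z
      layout⇒rainbow size = labeling , ((λ {v} {w} → labeling-injective {v} {w}) , surjective) ,
        (λ {d} {e} → label-injective {d} {e})
        where
        arrange : ∀ x y z → 3 ℕ.+ (x ℕ.+ (y ℕ.+ z)) ≡ x ℕ.+ y ℕ.+ z ℕ.+ 3
        arrange = ℕSolver.solve-∀
        lengths : length (map labeling (leafList 3 x y z)) ≡ length (vectors k)
        lengths = ≡.trans (List.length-map labeling (leafList 3 x y z))
          (≡.trans (length-leafList 3 x y z) (≡.trans (arrange x y z)
            (≡.trans size (sym (length-vectors k)))))
        hit : ∀ u → u ∈ map labeling (leafList 3 x y z)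
        hit u = Perm.∈-resp-↭ (unique-full
          (Unique.map⁺ {f = labeling} (λ {v} {w} → labeling-injective {v} {w}) (leafList-unique 3 x y z)) ∈-vectors lengths)
          (∈-vectors u)
        preimage : ∀ {u} vs → u ∈ map labeling vs → ∃ λ v → ∀ {w} → w ≡ v → labeling w ≡ u
        preimage vs u∈ with ∈-map⁻ labeling u∈
        ... | v , _ , eq = v , λ { refl → sym eq }
        surjective : ∀ u → ∃ λ v → ∀ {w} → w ≡ v → labeling w ≡ u
        surjective u = preimage (leafList 3 x y z) (hit u)

  count-none : ∀ {B : Set} κ (xs : List (Color × B)) → count κ xs ≡ 0 → All (λ it → proj₁ it ≢ κ) xs
  count-none κ []              _ = []
  count-none κ ((κ′ , _) ∷ xs) e with same κ κ′ in s
  ... | false = (λ { refl → case ≡.trans (sym s) (same-refl κ) of λ () }) ∷ count-none κ xs e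
    where
    same-refl : ∀ κ → same κ κ ≡ true
    same-refl X  = refl
    same-refl Y  = refl
    same-refl Z  = refl
    same-refl S₁ = refl
    same-refl S₃ = refl

  -- Arrangements on a single coset of the line.

  module Blocks (p-1 : ℕ) where
    open Residues p-1

    Separated : (c : Color → ℤ) → Color × ℤ → Color × ℤ → Set
    Separated c (κ , v) (κ′ , w) = v ≉ w × c κ + v ≉ c κ′ + w

    -- Coordinates along one coset. With the spine on the line, adding a spine label preserves the
    -- coset, so a block does not depend on which coset it will occupy.
    record Block (c : Color → ℤ) (N : Color → ℕ) : Set where
      field
        items     : List (Color × ℤ)
        separated : AllPairs (Separated c) items
        counts    : ∀ κ → count κ items ≡ N κ

    recount : ∀ {c M N} → (∀ κ → M κ ≡ N κ) → Block c M → Block c N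
    recount e b = record { Block b ; counts = λ κ → ≡.trans (Block.counts b κ) (e κ) }

    record Lines (c : Color → ℤ) (n : ℕ) (N : Color → ℕ) : Set where
      field
        blocks    : List (List (Color × ℤ))
        number    : length blocks ≡ n
        separated : All (AllPairs (Separated c)) blocks
        counts    : ∀ κ → count κ (concat blocks) ≡ N κ

    line : ∀ {c N} → Block c N → Lines c 1 N
    line b = record
      { blocks    = items ∷ []
      ; number    = refl
      ; separated = separated ∷ []
      ; counts    = λ κ → ≡.trans (cong (count κ) (List.++-identityʳ items)) (counts κ)
      }
      where open Block b

    no-lines : ∀ {c} → Lines c 0 (λ _ → 0)
    no-lines = record { blocks = [] ; number = refl ; separated = [] ; counts = λ _ → refl }

    infixr 5 _⊹_
    _⊹_ : ∀ {c m n M N} → Lines c m M → Lines c n N → Lines c (m ℕ.+ n) (λ κ → M κ ℕ.+ N κ)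
    L ⊹ L′ = record
      { blocks    = L.blocks ++ L′.blocks
      ; number    = ≡.trans (List.length-++ L.blocks) (cong₂ ℕ._+_ L.number L′.number)
      ; separated = All.++⁺ L.separated L′.separated
      ; counts    = λ κ → ≡.trans (cong (count κ) (sym (List.concat-++ L.blocks L′.blocks)))
                      (≡.trans (count-++ κ (concat L.blocks) (concat L′.blocks))
                        (cong₂ ℕ._+_ (L.counts κ) (L′.counts κ)))
      }
      where
      module L = Lines L
      module L′ = Lines L′

    copies : ∀ {c N} q → Block c N → Lines c q (λ κ → q ℕ.* N κ)
    copies zero    b = no-lines
    copies (suc q) b = line b ⊹ copies q b

    -- A chunk has its items at positions u ≤ n < u′ with labels congruent to l ≤ t < l′; an item
    -- is stored as colour, position and label.
    Item : Set
    Item = Color × ℕ × ℕ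

    record Chunk (c : Color → ℤ) (P : Color → ℕ → Set) (u u′ l l′ : ℕ) (N : Color → ℕ) : Set where
      field
        items    : List Item
        u≤u′     : u ℕ.≤ u′
        l≤l′     : l ℕ.≤ l′
        located  : All (λ { (κ , n , t) → (u ℕ.≤ n × n ℕ.< u′) × (l ℕ.≤ t × t ℕ.< l′) ×
                                          c κ + + n ≈ + t × P κ n }) items
        distinct : AllPairs (λ { (κ , n , t) (κ′ , n′ , t′) → n ≢ n′ × t ≢ t′ }) items
        counts   : ∀ κ → count κ items ≡ N κ

    only : Color → ℕ → Color → ℕ
    only κ n κ′ = if same κ′ κ then n else 0

    run : ∀ {c P} κ u l n → c κ + + u ≈ + l → (∀ i → u ℕ.≤ i → i ℕ.< u ℕ.+ n → P κ i) →
          Chunk c P u (u ℕ.+ n) l (l ℕ.+ n) (only κ n)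
    run {c} {P} κ u l n h free = record
      { items    = go u l n
      ; u≤u′     = ℕ.m≤m+n u n
      ; l≤l′     = ℕ.m≤m+n l n
      ; located  = located u l n h free
      ; distinct = distinct u l n
      ; counts   = λ κ′ → counts κ′ u l n
      }
      where
      go : ℕ → ℕ → ℕ → List Item
      go u l zero    = []
      go u l (suc n) = (κ , u , l) ∷ go (suc u) (suc l) n
      Located : ℕ → ℕ → ℕ → Item → Set
      Located u l n (κ , i , t) = (u ℕ.≤ i × i ℕ.< u ℕ.+ n) × (l ℕ.≤ t × t ℕ.< l ℕ.+ n) ×
                                  c κ + + i ≈ + t × P κ i
      widen : ∀ {u l n} it → Located (suc u) (suc l) n it → Located u l (suc n) it
      widen {u} {l} {n} (κ , i , t) ((a , b) , (a′ , b′) , r) =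
        (ℕ.<⇒≤ a , subst (i ℕ.<_) (sym (ℕ.+-suc u n)) b) ,
        (ℕ.<⇒≤ a′ , subst (t ℕ.<_) (sym (ℕ.+-suc l n)) b′) , r
      id₁ : ∀ a u l → a + (1ℤ + u) - (1ℤ + l) ≡ a + u - l
      id₁ = solve-∀
      located : ∀ u l n → c κ + + u ≈ + l → (∀ i → u ℕ.≤ i → i ℕ.< u ℕ.+ n → P κ i) →
                All (Located u l n) (go u l n)
      located u l zero    h free = []
      located u l (suc n) h free =
        ((ℕ.≤-refl , ℕ.m<m+n u (s≤s z≤n)) , (ℕ.≤-refl , ℕ.m<m+n l (s≤s z≤n)) , h ,
          free u ℕ.≤-refl (ℕ.m<m+n u (s≤s z≤n)))
        ∷ All.map (λ {it} → widen {u} {l} {n} it) (located (suc u) (suc l) n (shift h (id₁ (c κ) (+ u) (+ l)))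
            (λ i u<i i< → free i (ℕ.<⇒≤ u<i) (subst (i ℕ.<_) (sym (ℕ.+-suc u n)) i<)))
      later : ∀ u l n → All (λ { (κ , i , t) → u ℕ.≤ i × l ℕ.≤ t }) (go u l n)
      later u l zero    = []
      later u l (suc n) = (ℕ.≤-refl , ℕ.≤-refl)
        ∷ All.map (λ { (a , b) → ℕ.<⇒≤ a , ℕ.<⇒≤ b }) (later (suc u) (suc l) n)
      distinct : ∀ u l n → AllPairs (λ { (κ , n , t) (κ′ , n′ , t′) → n ≢ n′ × t ≢ t′ }) (go u l n)
      distinct u l zero    = []
      distinct u l (suc n) = All.map (λ { (a , b) → ℕ.<⇒≢ a , ℕ.<⇒≢ b }) (later (suc u) (suc l) n)
        ∷ distinct (suc u) (suc l) n
      counts : ∀ κ′ u l n → count κ′ (go u l n) ≡ only κ n κ′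
      counts κ′ u l zero with same κ′ κ
      ... | true  = refl
      ... | false = refl
      counts κ′ u l (suc n) with same κ′ κ | counts κ′ (suc u) (suc l) n
      ... | true  | e = cong suc e
      ... | false | e = e

    private
      join : ∀ {c P u u′ v v′ l l′ k k′ M N} →
        (A : Chunk c P u u′ l l′ M) (B : Chunk c P v v′ k k′ N) → u′ ℕ.≤ v →
        (∀ {t t′} → l ℕ.≤ t → t ℕ.< l′ → k ℕ.≤ t′ → t′ ℕ.< k′ → t ≢ t′) →
        ∀ {h h′} → h ℕ.≤ h′ → h ℕ.≤ l → h ℕ.≤ k → l′ ℕ.≤ h′ → k′ ℕ.≤ h′ →
        Chunk c P u v′ h h′ (λ κ → M κ ℕ.+ N κ)
      join A B u′≤v apart h≤h′ h≤l h≤k l′≤h′ k′≤h′ = record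
        { items    = A.items ++ B.items
        ; u≤u′     = ℕ.≤-trans A.u≤u′ (ℕ.≤-trans u′≤v B.u≤u′)
        ; l≤l′     = h≤h′
        ; located  = All.++⁺
            (All.map (λ { ((a , b) , (a′ , b′) , r) →
              (a , ℕ.<-≤-trans b (ℕ.≤-trans u′≤v B.u≤u′)) ,
              (ℕ.≤-trans h≤l a′ , ℕ.<-≤-trans b′ l′≤h′) , r }) A.located)
            (All.map (λ { ((a , b) , (a′ , b′) , r) →
              (ℕ.≤-trans (ℕ.≤-trans A.u≤u′ u′≤v) a , b) ,
              (ℕ.≤-trans h≤k a′ , ℕ.<-≤-trans b′ k′≤h′) , r }) B.located)
        ; distinct = AllPairs.++⁺ A.distinct B.distinct
            (All.map (λ { ((a , b) , (a′ , b′) , r) →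
              All.map (λ { ((d , e) , (d′ , e′) , r′) →
                ℕ.<⇒≢ (ℕ.<-≤-trans b (ℕ.≤-trans u′≤v d)) , apart a′ b′ d′ e′ }) B.located })
              A.located)
        ; counts   = λ κ → ≡.trans (count-++ κ A.items B.items) (cong₂ ℕ._+_ (A.counts κ) (B.counts κ))
        }
        where
        module A = Chunk A
        module B = Chunk B

    -- Both juxtapose two parts in position order; the name locates the labels of the second part
    -- relative to those of the first.
    above : ∀ {c P u u′ v v′ l l′ k k′ M N} →
      Chunk c P u u′ l l′ M → Chunk c P v v′ k k′ N → u′ ℕ.≤ v → l′ ℕ.≤ k →
      Chunk c P u v′ l k′ (λ κ → M κ ℕ.+ N κ)
    above A B u′≤v l′≤k = join A B u′≤v
      (λ _ t<l′ k≤t′ _ → ℕ.<⇒≢ (ℕ.<-≤-trans t<l′ (ℕ.≤-trans l′≤k k≤t′)))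
      (ℕ.≤-trans A.l≤l′ (ℕ.≤-trans l′≤k B.l≤l′)) ℕ.≤-refl (ℕ.≤-trans A.l≤l′ l′≤k)
      (ℕ.≤-trans l′≤k B.l≤l′) ℕ.≤-refl
      where
      module A = Chunk A
      module B = Chunk B

    below : ∀ {c P u u′ v v′ l l′ k k′ M N} →
      Chunk c P u u′ l l′ M → Chunk c P v v′ k k′ N → u′ ℕ.≤ v → k′ ℕ.≤ l →
      Chunk c P u v′ k l′ (λ κ → M κ ℕ.+ N κ)
    below A B u′≤v k′≤l = join A B u′≤v
      (λ l≤t _ _ t′<k′ eq → ℕ.<⇒≢ (ℕ.<-≤-trans t′<k′ (ℕ.≤-trans k′≤l l≤t)) (sym eq))
      (ℕ.≤-trans B.l≤l′ (ℕ.≤-trans k′≤l A.l≤l′)) (ℕ.≤-trans B.l≤l′ k′≤l) ℕ.≤-refl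
      ℕ.≤-refl (ℕ.≤-trans k′≤l A.l≤l′)
      where
      module A = Chunk A
      module B = Chunk B

    module _ {c P u u′ l l′ N} (C : Chunk c P u u′ l l′ N) (u′≤ : u′ ℕ.≤ u ℕ.+ p) (l′≤ : l′ ℕ.≤ l ℕ.+ p) where
      private module C = Chunk C

      -- Positions and labels each lie in an interval of length at most `p`, so those that differ as
      -- natural numbers are incongruent.
      toBlock : Block c N
      toBlock = record
        { items     = map (λ it → proj₁ it , + proj₁ (proj₂ it)) C.items
        ; separated = AllPairs.map⁺ (go C.items C.located C.distinct)
        ; counts    = λ κ → ≡.trans (count-map (λ it → + proj₁ it) κ C.items) (C.counts κ)
        }
        where
        Loc : Item → Set
        Loc (κ , n , t) = (u ℕ.≤ n × n ℕ.< u′) × (l ℕ.≤ t × t ℕ.< l′) × c κ + + n ≈ + t × P κ n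
        go : ∀ xs → All Loc xs → AllPairs (λ { (κ , n , t) (κ′ , n′ , t′) → n ≢ n′ × t ≢ t′ }) xs →
             AllPairs (λ a b → Separated c (proj₁ a , + proj₁ (proj₂ a)) (proj₁ b , + proj₁ (proj₂ b))) xs
        pair : ∀ a → Loc a → ∀ b → Loc b → proj₁ (proj₂ a) ≢ proj₁ (proj₂ b) × proj₂ (proj₂ a) ≢ proj₂ (proj₂ b) →
               Separated c (proj₁ a , + proj₁ (proj₂ a)) (proj₁ b , + proj₁ (proj₂ b))
        pair (κ , n , t) ((a , b) , (a′ , b′) , h , _) (κ₁ , n₁ , t₁) ((d , e) , (d′ , e′) , h₁ , _) (n≢ , t≢) =
          (λ eq → n≢ (window {u} a (ℕ.<-≤-trans b u′≤) d (ℕ.<-≤-trans e u′≤) eq)) ,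
          (λ eq → t≢ (window {l} a′ (ℕ.<-≤-trans b′ l′≤) d′ (ℕ.<-≤-trans e′ l′≤)
                        (≈-trans (≈-sym h) (≈-trans eq h₁))))
        pairs : ∀ a → Loc a → ∀ ys → All Loc ys →
                All (λ b → proj₁ (proj₂ a) ≢ proj₁ (proj₂ b) × proj₂ (proj₂ a) ≢ proj₂ (proj₂ b)) ys →
                All (λ b → Separated c (proj₁ a , + proj₁ (proj₂ a)) (proj₁ b , + proj₁ (proj₂ b))) ys
        pairs a la []       []         []       = []
        pairs a la (b ∷ ys) (lb ∷ lys) (r ∷ rs) = pair a la b lb r ∷ pairs a la ys lys rs
        go []       []         []       = []
        go (a ∷ xs) (la ∷ lxs) (r ∷ rs) = pairs a la xs lxs r ∷ go xs lxs rs

      toBlock-located : All (λ it → ∃ λ n → proj₂ it ≡ + n × (u ℕ.≤ n × n ℕ.< u′) × P (proj₁ it) n)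
                            (Block.items toBlock)
      toBlock-located = All.map⁺ (All.map (λ { {κ , n , t} (r , _ , _ , q) → n , refl , r , q }) C.located)

    module AffineInvariance (pr : Prime p) where
      open PrimeModulus pr

      -- Multiplying the positions by `s` multiplies the labels by `s`, up to a translation by `τ`
      -- common to all colours; neither operation creates a coincidence.
      transform : ∀ {c c′ N} s τ → s ≉ 0ℤ → (∀ κ → c κ ≈ s * c′ κ + τ) → Block c′ N → Block c N
      transform {c} {c′} s τ s≉0 h b = record
        { items     = map (λ it → proj₁ it , s * proj₂ it) items
        ; separated = AllPairs.map⁺ (AllPairs.map (λ {a} {b} → scaled a b) separated)
        ; counts    = λ κ → ≡.trans (count-map (s *_) κ items) (counts κ)
        }
        where
        open Block b
        id₁ : ∀ s a v τ b w → s * (a + v) - s * (b + w) ≡ s * a + τ + s * v - (s * b + τ + s * w)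
        id₁ = solve-∀
        scaled : ∀ a b → Separated c′ a b → Separated c (proj₁ a , s * proj₂ a) (proj₁ b , s * proj₂ b)
        scaled (κ , v) (κ′ , w) (v≉w , l≉l′) =
          (λ e → v≉w (*-cancelˡ s≉0 e)) ,
          (λ e → l≉l′ (*-cancelˡ s≉0 (shift
            (≈-trans (+-cong (≈-sym (h κ)) (≈-refl {s * v})) (≈-trans e (+-cong (h κ′) (≈-refl {s * w}))))
            (id₁ s (c′ κ) v τ (c′ κ′) w))))

  -- Combining arrangements of cosets into a layout.

  module Assembly (p-1 k : ℕ) where
    open Residues p-1
    open Vectors p-1
    open Blocks p-1
    open Layouts p-1 (suc k)

    G : Set
    G = Zpk p (suc k)

    Row : Set
    Row = Zpk p k × List (Color × ℤ)

    place : Zpk p k → Color × ℤ → Color × G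
    place g (κ , v) = κ , residue v ∷ g

    flatten : List Row → List (Color × G)
    flatten []              = []
    flatten ((g , b) ∷ rows) = map (place g) b ++ flatten rows

    count-place : ∀ κ g b → count κ (map (place g) b) ≡ count κ b
    count-place κ g b = count-map (λ v → residue v ∷ g) κ b

    count-flatten : ∀ κ gs bs → length gs ≡ length bs →
                    count κ (flatten (List.zip gs bs)) ≡ count κ (concat bs)
    count-flatten κ []       []       _ = refl
    count-flatten κ (g ∷ gs) (b ∷ bs) e = ≡.trans (count-++ κ (map (place g) b) _)
      (≡.trans (cong₂ ℕ._+_ (count-place κ g b) (count-flatten κ gs bs (ℕ.suc-injective e)))
        (sym (count-++ κ b (concat bs))))

    module _ (a : Color → G) (c : Color → ℤ) where

      InLine : Color → Set
      InLine κ = a κ ≡ residue (c κ) ∷ zeros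

      RowOK : Row → Set
      RowOK (g , b) = AllPairs (Separated c) b × All (InLine ∘ proj₁) b

      tail-label : ∀ {κ v} → InLine κ → Vec.tail (a κ ⊕ v) ≡ Vec.tail v
      tail-label {κ} {v} e = ≡.trans (cong (λ t → Vec.tail (t ⊕ v)) e) (go v)
        where
        go : ∀ (v : G) → Vec.tail ((residue (c κ) ∷ zeros) ⊕ v) ≡ Vec.tail v
        go (i ∷ v) = zeros⊕ v

      OnLine : (Zpk p k → Set) → Color × G → Set
      OnLine Q it = InLine (proj₁ it) × Q (Vec.tail (proj₂ it))

      flatten-onLine : ∀ {Q} rows → All RowOK rows → All (Q ∘ proj₁) rows → All (OnLine Q) (flatten rows)
      flatten-onLine []       []                 []       = []
      flatten-onLine ((g , b) ∷ rows) ((_ , il) ∷ oks) (q ∷ qs) =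
        All.++⁺ (All.map⁺ (All.map (λ e → e , q) il)) (flatten-onLine rows oks qs)

      place-compatible : ∀ g b → RowOK (g , b) → AllPairs (Compatible a) (map (place g) b)
      place-compatible g []             _               = []
      place-compatible g ((κ , v) ∷ b) (r ∷ rs , e ∷ es) = row b r es ∷ place-compatible g b (rs , es)
        where
        label : ∀ {κ} v → InLine κ → a κ ⊕ (residue v ∷ g) ≡ residue (c κ + v) ∷ g
        label {κ} v e = ≡.trans (cong (_⊕ (residue v ∷ g)) e) (cong₂ _∷_ (addMod-residue (c κ) v) (zeros⊕ g))
        row : ∀ b → All (Separated c (κ , v)) b → All (InLine ∘ proj₁) b →
              All (Compatible a (place g (κ , v))) (map (place g) b)
        row []             []               []        = []
        row ((κ′ , w) ∷ b) ((v≉w , l≉) ∷ r) (e′ ∷ es) =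
          ((λ eq → v≉w (residue-injective (cong Vec.head eq))) ,
           (λ eq → l≉ (residue-injective (cong Vec.head
             (≡.trans (sym (label v e)) (≡.trans eq (label w e′)))))))
          ∷ row b r es

      -- As the centres in use lie on the line, items of different cosets have labels in different
      -- cosets; only collisions within one row remain, and `Separated` excludes them.
      flatten-compatible : ∀ rows → AllPairs (λ r s → proj₁ r ≢ proj₁ s) rows → All RowOK rows →
                           AllPairs (Compatible a) (flatten rows)
      flatten-compatible []               []       []         = []
      flatten-compatible ((g , b) ∷ rows) (r ∷ rs) (ok ∷ oks) =
        AllPairs.++⁺ (place-compatible g b ok) (flatten-compatible rows rs oks)
          (All.map⁺ (All.map (λ {it} e → All.map (λ {it′} → across it e it′) (flatten-onLine rows oks r))
            (proj₂ ok)))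
        where
        across : ∀ it → InLine (proj₁ it) → ∀ it′ → OnLine (g ≢_) it′ → Compatible a (place g it) it′
        across (κ , v) e (κ′ , w) (e′ , g≢) =
          (λ eq → g≢ (cong Vec.tail eq)) ,
          (λ eq → g≢ (≡.trans (sym (tail-label e)) (≡.trans (cong Vec.tail eq) (tail-label e′))))

    zip-distinct : ∀ {gs : List (Zpk p k)} (bs : List (List (Color × ℤ))) → Unique gs →
                   AllPairs (λ r s → proj₁ r ≢ proj₁ s) (List.zip gs bs)
    zip-all : ∀ {B C : Set} {P : B → Set} {xs} (ys : List C) → All P xs → All (P ∘ proj₁) (List.zip xs ys)
    zip-all ys       []       = []
    zip-all []       (q ∷ qs) = []
    zip-all (y ∷ ys) (q ∷ qs) = q ∷ zip-all ys qs
    zip-distinct bs       []       = []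
    zip-distinct []       (r ∷ rs) = []
    zip-distinct (b ∷ bs) (r ∷ rs) = zip-all {P = _ ≢_} bs r ∷ zip-distinct bs rs

    zip-all₂ : ∀ {B C : Set} {P : C → Set} (xs : List B) {ys} → All P ys → All (P ∘ proj₂) (List.zip xs ys)
    zip-all₂ []       _        = []
    zip-all₂ (x ∷ xs) []       = []
    zip-all₂ (x ∷ xs) (q ∷ qs) = q ∷ zip-all₂ xs qs

    recount-rainbow : ∀ {x y z x′ y′ z′} → x ≡ x′ → y ≡ y′ → z ≡ z′ →
      (x ℕ.+ y ℕ.+ z ℕ.+ 3 ≡ p ℕ.^ suc k → Rainbow p (suc k) x y z) →
      x′ ℕ.+ y′ ℕ.+ z′ ℕ.+ 3 ≡ p ℕ.^ suc k → Rainbow p (suc k) x′ y′ z′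
    recount-rainbow refl refl refl h = h

    module _ {c₁ c₂ c₃ : ℤ} {n : ℕ} {M N : Color → ℕ}
      (b : Block (byColor c₁ c₂ c₃) M) (L : Lines (byColor c₁ c₂ c₃) n N)
      (off : All (λ it → proj₂ it ≉ c₂) (Block.items b))
      (at₁ : All (λ it → proj₁ it ≡ S₁ → proj₂ it ≈ c₁) (Block.items b))
      (at₃ : All (λ it → proj₁ it ≡ S₃ → proj₂ it ≈ c₃) (Block.items b))
      (M₁ : M S₁ ≡ 1) (M₃ : M S₃ ≡ 1) (N₁ : N S₁ ≡ 0) (N₃ : N S₃ ≡ 0)
      (full : suc n ≡ p ℕ.^ k) where

      private
        c : Color → ℤ
        c = byColor c₁ c₂ c₃

        module b = Block b
        module L = Lines L

        gs : List (Zpk p k)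
        gs = proj₁ (vectors-head k)

        gs-unique : Unique (zeros ∷ gs)
        gs-unique = subst Unique (proj₂ (vectors-head k)) (vectors-unique k)

        gs-length : length gs ≡ length L.blocks
        gs-length = ℕ.suc-injective (≡.trans (sym (cong length (proj₂ (vectors-head k))))
          (≡.trans (length-vectors k) (≡.trans (sym full) (cong suc (sym L.number)))))

        rest : List Row
        rest = List.zip gs L.blocks

        rows : List Row
        rows = (zeros , b.items) ∷ rest

        emb : ℤ → G
        emb x = residue x ∷ zeros

        a : Color → G
        a = byColor (emb c₁) (emb c₂) (emb c₃)

        in-line : ∀ κ → InLine a c κ
        in-line X  = refl
        in-line Y  = refl
        in-line Z  = refl
        in-line S₁ = refl
        in-line S₃ = refl

        all-in-line : ∀ (b : List (Color × ℤ)) → All (InLine a c ∘ proj₁) b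
        all-in-line b = All.universal (λ it → in-line (proj₁ it)) b

        rest-ok : All (RowOK a c) rest
        rest-ok = zip-all₂ gs (All.map (λ {b} s → s , all-in-line b) L.separated)

        nonzero : All (zeros ≢_) gs
        nonzero = AllPairs.head gs-unique

        rest-on-line : All (OnLine a c (zeros ≢_)) (flatten rest)
        rest-on-line = flatten-onLine a c {zeros ≢_} rest rest-ok (zip-all {P = zeros ≢_} L.blocks nonzero)

        count-rest : ∀ κ → count κ (flatten rest) ≡ N κ
        count-rest κ = ≡.trans (count-flatten κ gs L.blocks gs-length) (L.counts κ)

        count-items : ∀ κ → count κ (flatten rows) ≡ M κ ℕ.+ N κ
        count-items κ = ≡.trans (count-++ κ (map (place zeros) b.items) (flatten rest))
          (cong₂ ℕ._+_ (≡.trans (count-place κ zeros b.items) (b.counts κ)) (count-rest κ))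

        at : ∀ κ x → All (λ it → proj₁ it ≡ κ → proj₂ it ≈ x) b.items → N κ ≡ 0 →
             All (λ it → proj₁ it ≡ κ → proj₂ it ≡ emb x) (flatten rows)
        at κ x h N0 = All.++⁺
          (All.map⁺ (All.map (λ f e → cong (_∷ zeros) (residue-cong (f e))) h))
          (All.map (λ ne e → ⊥-elim (ne e))
            (count-none κ (flatten rest) (≡.trans (count-rest κ) N0)))

        layout : Layout
        layout = record
          { a₁ = emb c₁ ; a₂ = emb c₂ ; a₃ = emb c₃
          ; items      = flatten rows
          ; compatible = flatten-compatible a c rows (zip-distinct (b.items ∷ L.blocks) gs-unique)
              ((b.separated , all-in-line b.items) ∷ rest-ok)
          ; avoids-a₂  = All.++⁺
              (All.map⁺ (All.map (λ v≉ e → v≉ (residue-injective (cong Vec.head e))) off))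
              (All.map (λ { (_ , ne) e → ne (sym (cong Vec.tail e)) }) rest-on-line)
          ; S₁-at-a₁   = at S₁ c₁ at₁ N₁
          ; S₃-at-a₃   = at S₃ c₃ at₃ N₃
          ; count-S₁   = ≡.trans (count-items S₁) (cong₂ ℕ._+_ M₁ N₁)
          ; count-S₃   = ≡.trans (count-items S₃) (cong₂ ℕ._+_ M₃ N₃)
          }

      -- The spine block occupies the coset of zero, which contains the spine, and the other blocks
      -- occupy the remaining `p ^ k` - 1 cosets.
      assemble : ∀ {x y z} → M X ℕ.+ N X ≡ x → M Y ℕ.+ N Y ≡ y → M Z ℕ.+ N Z ≡ z →
                 x ℕ.+ y ℕ.+ z ℕ.+ 3 ≡ p ℕ.^ suc k → Rainbow p (suc k) x y z
      assemble ex ey ez size = recount-rainbow (≡.trans (count-items X) ex) (≡.trans (count-items Y) ey)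
          (≡.trans (count-items Z) ez) (FromLayout.layout⇒rainbow layout) size

  -- Cosets without spine, and cores to be completed by cosets of one kind.

  tally : ℕ → ℕ → ℕ → Color → ℕ
  tally A B C X  = A
  tally A B C Y  = B
  tally A B C Z  = C
  tally A B C S₁ = 0
  tally A B C S₃ = 0

  module LineBlocks (p-1 : ℕ) (pr : Prime (suc p-1)) where
    open Residues p-1
    open PrimeModulus pr
    open Blocks p-1
    open AffineInvariance pr

    -- Translating c κ to 0 turns every label into its position.
    monochrome : ∀ {c} κ → Block c (only κ p)
    monochrome {c} κ = transform 1ℤ (c κ) (small≉0 (s≤s z≤n) (ℕ.nonTrivial⇒n>1 p {{prime⇒nonTrivial pr}}))
      (λ κ′ → ≡⇒≈ (id₁ (c κ′) (c κ)))
      (toBlock {c = λ κ′ → c κ′ - c κ} {P = λ _ _ → ⊤}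
        (run κ 0 0 p (≡⇒≈ (id₂ (c κ))) (λ _ _ _ → tt)) ℕ.≤-refl ℕ.≤-refl)
      where
      id₁ : ∀ a b → a ≡ 1ℤ * (a - b) + b
      id₁ = solve-∀
      id₂ : ∀ b → b - b + 0ℤ ≡ 0ℤ
      id₂ = solve-∀

    -- The case of three values of Hall's theorem on differences in abelian groups: exchange a
    -- block of A with a block of C positions, and rescale.
    exchange : ∀ {c₁ c₂ c₃} A B C → c₁ ≉ c₂ → A ℕ.+ B ℕ.+ C ≡ p →
      + A * c₁ + + B * c₂ + + C * c₃ ≈ 0ℤ → Block (byColor c₁ c₂ c₃) (tally A B C)
    exchange {c₁} {c₂} {c₃} A B C c₁≉c₂ size rel = go A B C size rel
      where
      id₁ : ∀ a b c₁ c₂ c₃ → a * (c₁ - c₂) - 0ℤ ≡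
            a * c₁ + b * c₂ + 0ℤ * c₃ + 0ℤ * c₂ - (0ℤ + (a + b) * c₂)
      id₁ = solve-∀
      u≉0 : c₁ - c₂ ≉ 0ℤ
      u≉0 h = c₁≉c₂ (shift h (id₃ c₁ c₂))
        where
        id₃ : ∀ a b → a - b ≡ a - b - 0ℤ
        id₃ = solve-∀
      go : ∀ A B C → A ℕ.+ B ℕ.+ C ≡ p → + A * c₁ + + B * c₂ + + C * c₃ ≈ 0ℤ →
           Block (byColor c₁ c₂ c₃) (tally A B C)
      go zero    B zero    size rel = recount e (monochrome Y)
        where
        e : ∀ κ → only Y p κ ≡ tally 0 B 0 κ
        e X  = refl
        e Y  = ≡.trans (sym size) (ℕ.+-identityʳ B)
        e Z  = refl
        e S₁ = refl
        e S₃ = refl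
      -- Without leaves of s₃ the relation reads A (c₁ - c₂) = 0, so `suc A` is `p` and the line is
      -- of one kind.
      go (suc A) B zero    size rel with integral (+ suc A) (c₁ - c₂) (shift (+-cong rel (*-cong 0≈ (≈-refl {c₂})))
                                           (id₁ (+ suc A) (+ B) c₁ c₂ c₃))
        where
        0≈ : 0ℤ ≈ + (suc A ℕ.+ B)
        0≈ = ≈-trans (≈-sym p≈0) (≡⇒≈ (cong +_ (≡.trans (sym size) (ℕ.+-identityʳ (suc A ℕ.+ B)))))
      ... | inj₂ u≈0 = ⊥-elim (u≉0 u≈0)
      ... | inj₁ A≈0 = recount e (monochrome X)
        where
        A≡p : suc A ≡ p
        A≡p = window {1} (s≤s z≤n) (s≤s (subst (suc A ℕ.≤_) size
          (ℕ.≤-trans (ℕ.m≤m+n (suc A) B) (ℕ.m≤m+n _ 0)))) (s≤s z≤n) ℕ.≤-refl (≈-trans A≈0 (≈-sym p≈0))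
        B≡0 : 0 ≡ B
        B≡0 = sym (ℕ.+-cancelˡ-≡ (suc A) B 0 (≡.trans (sym (ℕ.+-identityʳ _))
          (≡.trans size (≡.trans (sym A≡p) (sym (ℕ.+-identityʳ _))))))
        e : ∀ κ → only X p κ ≡ tally (suc A) B 0 κ
        e X  = sym A≡p
        e Y  = B≡0
        e Z  = refl
        e S₁ = refl
        e S₃ = refl
      go A B (suc C) size rel with ℕ.m≤n⇒m<n∨m≡n (subst (suc C ℕ.≤_) size (ℕ.m≤n+m (suc C) (A ℕ.+ B)))
      ... | inj₂ C≡p = recount e (monochrome Z)
        where
        A+B≡0 : A ℕ.+ B ≡ 0
        A+B≡0 = ℕ.+-cancelʳ-≡ (suc C) _ _ (≡.trans size (sym C≡p))
        e : ∀ κ → only Z p κ ≡ tally A B (suc C) κ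
        e X  = sym (ℕ.m+n≡0⇒m≡0 A A+B≡0)
        e Y  = sym (ℕ.m+n≡0⇒n≡0 A A+B≡0)
        e Z  = sym C≡p
        e S₁ = refl
        e S₃ = refl
      -- An affine change turns c₁, c₂, c₃ into D, 0, - A, where D is the number of leaves of s₃.
      -- Then X moves the first A positions up by D, Z moves the next D positions down by A, and Y
      -- keeps the rest in place.
      ... | inj₁ C<p = transform s c₂ s≉0 affine (recount e (toBlock swapped
              (ℕ.≤-reflexive (≡.trans (ar₁ A B D) size)) (ℕ.≤-reflexive (≡.trans (ar₂ A B D) size))))
        where
        D = suc C
        D≉0 : + D ≉ 0ℤ
        D≉0 = small≉0 (s≤s z≤n) C<p
        t s : ℤ
        t = c₁ - c₂
        s = proj₁ (inverse D≉0) * t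
        sD≈t : s * + D ≈ t
        sD≈t = ≈-trans (≡⇒≈ (id₄ (proj₁ (inverse D≉0)) t (+ D)))
          (≈-trans (*-cong (proj₂ (inverse D≉0)) (≈-refl {t})) (≡⇒≈ (ℤ.*-identityˡ t)))
          where
          id₄ : ∀ y t d → y * t * d ≡ y * d * t
          id₄ = solve-∀
        s≉0 : s ≉ 0ℤ
        s≉0 h = u≉0 (≈-trans (≈-sym sD≈t) (≈-trans (*-cong h (≈-refl {+ D})) (≡⇒≈ (ℤ.*-zeroˡ (+ D)))))
        c′ : Color → ℤ
        c′ = byColor (+ D) 0ℤ (- + A)
        total≈0 : 0ℤ ≈ + (A ℕ.+ B ℕ.+ D)
        total≈0 = ≈-trans (≈-sym p≈0) (≡⇒≈ (cong +_ (sym size)))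
        id₅ : ∀ a b d s c₁ c₂ c₃ → d * c₃ - d * (s * (- a) + c₂) ≡
              a * c₁ + b * c₂ + d * c₃ + s * d * a + 0ℤ * c₂ -
              (0ℤ + (c₁ - c₂) * a + (a + b + d) * c₂)
        id₅ = solve-∀
        id₆ : ∀ a b → a ≡ a - b + b
        id₆ = solve-∀
        id₇ : ∀ s b → b ≡ s * 0ℤ + b
        id₇ = solve-∀
        affine : ∀ κ → byColor c₁ c₂ c₃ κ ≈ s * c′ κ + c₂
        affine X  = ≈-trans (≡⇒≈ (id₆ c₁ c₂)) (+-cong (≈-sym sD≈t) (≈-refl {c₂}))
        affine Y  = ≡⇒≈ (id₇ s c₂)
        -- The relation determines c₃, because D is invertible; A + B + D ≡ 0 eliminates B.
        affine Z  = *-cancelˡ D≉0 (shift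
          (+-cong (+-cong rel (*-cong sD≈t (≈-refl {+ A}))) (*-cong total≈0 (≈-refl {c₂})))
          (id₅ (+ A) (+ B) (+ D) s c₁ c₂ c₃))
        affine S₁ = ≡⇒≈ (id₇ s c₂)
        affine S₃ = ≡⇒≈ (id₇ s c₂)
        id₈ : ∀ a → - a + a ≡ 0ℤ
        id₈ = solve-∀
        N : Color → ℕ
        N κ = only X A κ ℕ.+ only Z D κ ℕ.+ only Y B κ
        swapped : Chunk c′ (λ _ _ → ⊤) 0 (A ℕ.+ D ℕ.+ B) 0 (D ℕ.+ A ℕ.+ B) N
        swapped = above
          (below (run X 0 D A (≡⇒≈ (cong +_ (ℕ.+-identityʳ D))) (λ _ _ _ → tt))
                 (run Z A 0 D (≡⇒≈ (id₈ (+ A))) (λ _ _ _ → tt)) ℕ.≤-refl ℕ.≤-refl)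
          (run Y (A ℕ.+ D) (D ℕ.+ A) B (≡⇒≈ (cong +_ (ℕ.+-comm A D))) (λ _ _ _ → tt))
          ℕ.≤-refl ℕ.≤-refl
        ar₁ : ∀ a b d → a ℕ.+ d ℕ.+ b ≡ a ℕ.+ b ℕ.+ d
        ar₁ = ℕSolver.solve-∀
        ar₂ : ∀ a b d → d ℕ.+ a ℕ.+ b ≡ a ℕ.+ b ℕ.+ d
        ar₂ = ℕSolver.solve-∀
        e : ∀ κ → N κ ≡ tally A B D κ
        e X  = ≡.trans (ℕ.+-identityʳ _) (ℕ.+-identityʳ A)
        e Y  = refl
        e Z  = ℕ.+-identityʳ D
        e S₁ = refl
        e S₃ = refl

  -- Some lines of the final arrangement: the line of the spine and r further ones, with A, B and C
  -- leaves at s₁, s₂ and s₃.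
  module Cores (p-1 : ℕ) (pr : Prime (suc p-1)) where
    open Residues p-1
    open PrimeModulus pr
    open Blocks p-1
    open LineBlocks p-1 pr

    record Core (r A B C : ℕ) : Set where
      field
        c₁ c₂ c₃ : ℤ
        M N      : Color → ℕ
        spine    : Block (byColor c₁ c₂ c₃) M
        lines    : Lines (byColor c₁ c₂ c₃) r N
        off-c₂   : All (λ it → proj₂ it ≉ c₂) (Block.items spine)
        at-c₁    : All (λ it → proj₁ it ≡ S₁ → proj₂ it ≈ c₁) (Block.items spine)
        at-c₃    : All (λ it → proj₁ it ≡ S₃ → proj₂ it ≈ c₃) (Block.items spine)
        M₁       : M S₁ ≡ 1
        M₃       : M S₃ ≡ 1
        N₁       : N S₁ ≡ 0
        N₃       : N S₃ ≡ 0
        count-A  : M X ℕ.+ N X ≡ A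
        count-B  : M Y ℕ.+ N Y ≡ B
        count-C  : M Z ℕ.+ N Z ≡ C

    -- Whole cosets of one kind absorb multiples of `p`, so a core only has to meet the right
    -- residues without exceeding x, y and z. Dividing the number of vertices by `p` shows that the
    -- cosets are used up exactly.
    core⇒rainbow : ∀ {r A B C k x y z} → Core r A B C → A ℕ.+ B ℕ.+ C ℕ.+ 3 ≡ suc r ℕ.* p →
      ∀ q₁ q₂ q₃ → A ℕ.+ q₁ ℕ.* p ≡ x → B ℕ.+ q₂ ℕ.* p ≡ y → C ℕ.+ q₃ ℕ.* p ≡ z →
      x ℕ.+ y ℕ.+ z ℕ.+ 3 ≡ p ℕ.^ suc k → Rainbow p (suc k) x y z
    core⇒rainbow {r} {A} {B} {C} {k} {x} {y} {z} core total q₁ q₂ q₃ ex ey ez size =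
      Assembly.assemble p-1 k spine (lines ⊹ copies q₁ (monochrome X) ⊹ copies q₂ (monochrome Y) ⊹
          copies q₃ (monochrome Z)) off-c₂ at-c₁ at-c₃ M₁ M₃
        (≡.trans (cong (ℕ._+ _) N₁) (vanish q₁ q₂ q₃)) (≡.trans (cong (ℕ._+ _) N₃) (vanish q₁ q₂ q₃))
        (ℕ.*-cancelˡ-≡ _ _ p (≡.trans (sym scaled) size))
        (≡.trans (countX (M X) (N X) p q₁ q₂ q₃) (≡.trans (cong (ℕ._+ q₁ ℕ.* p) count-A) ex))
        (≡.trans (countY (M Y) (N Y) p q₁ q₂ q₃) (≡.trans (cong (ℕ._+ q₂ ℕ.* p) count-B) ey))
        (≡.trans (countZ (M Z) (N Z) p q₁ q₂ q₃) (≡.trans (cong (ℕ._+ q₃ ℕ.* p) count-C) ez)) size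
      where
      open Core core
      vanish : ∀ a b c → a ℕ.* 0 ℕ.+ (b ℕ.* 0 ℕ.+ c ℕ.* 0) ≡ 0
      vanish = ℕSolver.solve-∀
      countX : ∀ m n p a b c → m ℕ.+ (n ℕ.+ (a ℕ.* p ℕ.+ (b ℕ.* 0 ℕ.+ c ℕ.* 0))) ≡ m ℕ.+ n ℕ.+ a ℕ.* p
      countX = ℕSolver.solve-∀
      countY : ∀ m n p a b c → m ℕ.+ (n ℕ.+ (a ℕ.* 0 ℕ.+ (b ℕ.* p ℕ.+ c ℕ.* 0))) ≡ m ℕ.+ n ℕ.+ b ℕ.* p
      countY = ℕSolver.solve-∀
      countZ : ∀ m n p a b c → m ℕ.+ (n ℕ.+ (a ℕ.* 0 ℕ.+ (b ℕ.* 0 ℕ.+ c ℕ.* p))) ≡ m ℕ.+ n ℕ.+ c ℕ.* p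
      countZ = ℕSolver.solve-∀
      ar₁ : ∀ A B C p a b c → A ℕ.+ a ℕ.* p ℕ.+ (B ℕ.+ b ℕ.* p) ℕ.+ (C ℕ.+ c ℕ.* p) ℕ.+ 3 ≡
            A ℕ.+ B ℕ.+ C ℕ.+ 3 ℕ.+ p ℕ.* (a ℕ.+ (b ℕ.+ c))
      ar₁ = ℕSolver.solve-∀
      ar₂ : ∀ r p q → suc r ℕ.* p ℕ.+ p ℕ.* q ≡ p ℕ.* suc (r ℕ.+ q)
      ar₂ = ℕSolver.solve-∀
      scaled : x ℕ.+ y ℕ.+ z ℕ.+ 3 ≡ p ℕ.* suc (r ℕ.+ (q₁ ℕ.+ (q₂ ℕ.+ q₃)))
      scaled = ≡.trans (cong₂ (λ s t → s ℕ.+ t ℕ.+ 3) (cong₂ ℕ._+_ (sym ex) (sym ey)) (sym ez))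
        (≡.trans (ar₁ A B C p q₁ q₂ q₃) (≡.trans (cong (ℕ._+ p ℕ.* (q₁ ℕ.+ (q₂ ℕ.+ q₃))) total)
          (ar₂ r p (q₁ ℕ.+ (q₂ ℕ.+ q₃)))))

    -- The spine at positions n₁, n₂ and n₃ of its line.
    module Word (n₁ n₂ n₃ : ℕ) (n₁<p : n₁ ℕ.< p) (n₂<p : n₂ ℕ.< p) (n₁≢n₂ : n₁ ≢ n₂) (n₃≢n₂ : n₃ ≢ n₂) where

      c : Color → ℤ
      c = byColor (+ n₁) (+ n₂) (+ n₃)

      Free : Color → ℕ → Set
      Free κ n = n ≢ n₂ × (κ ≡ S₁ → n ≡ n₁) × (κ ≡ S₃ → n ≡ n₃)

      WordChunk : (u u′ l l′ : ℕ) (N : Color → ℕ) → Set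
      WordChunk = Chunk c Free

      exact : ∀ κ {u l} → byColor n₁ n₂ n₃ κ ℕ.+ u ≡ l → c κ + + u ≈ + l
      exact X  refl = ≈-refl
      exact Y  refl = ≈-refl
      exact Z  refl = ≈-refl
      exact S₁ refl = ≈-refl
      exact S₃ refl = ≈-refl

      Leafy : Color → Set
      Leafy X  = ⊤
      Leafy Y  = ⊤
      Leafy Z  = ⊤
      Leafy S₁ = ⊥
      Leafy S₃ = ⊥

      free-leaf : ∀ {κ} → Leafy κ → ∀ {i} → i ≢ n₂ → Free κ i
      free-leaf leafy i≢ = i≢ , (λ { refl → ⊥-elim leafy }) , (λ { refl → ⊥-elim leafy })

      leaves-before : ∀ κ {leafy : Leafy κ} u l n → byColor n₁ n₂ n₃ κ ℕ.+ u ≡ l →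
        u ℕ.+ n ℕ.≤ n₂ → WordChunk u (u ℕ.+ n) l (l ℕ.+ n) (only κ n)
      leaves-before κ {leafy} u l n h le = run κ u l n (exact κ h) λ i _ i< →
        free-leaf leafy (ℕ.<⇒≢ (ℕ.<-≤-trans i< le))

      leaves-after : ∀ κ {leafy : Leafy κ} u l n → byColor n₁ n₂ n₃ κ ℕ.+ u ≡ l →
        n₂ ℕ.< u → WordChunk u (u ℕ.+ n) l (l ℕ.+ n) (only κ n)
      leaves-after κ {leafy} u l n h lt = run κ u l n (exact κ h) λ i u≤i _ →
        free-leaf leafy (≢-sym (ℕ.<⇒≢ (ℕ.<-≤-trans lt u≤i)))

      single : ∀ {u i} → u ℕ.≤ i → i ℕ.< u ℕ.+ 1 → i ≡ u
      single {u} {i} u≤i i< = ℕ.≤-antisym (ℕ.s≤s⁻¹ (subst (i ℕ.<_) (ℕ.+-comm u 1) i<)) u≤i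

      s₁-mark : ∀ l → n₂ ℕ.+ n₁ ≡ l → WordChunk n₁ (n₁ ℕ.+ 1) l (l ℕ.+ 1) (only S₁ 1)
      s₁-mark l h = run S₁ n₁ l 1 (exact S₁ h) λ i u≤i i< →
        (λ e → n₁≢n₂ (≡.trans (sym (single u≤i i<)) e)) , (λ _ → single u≤i i<) , λ ()

      s₃-mark : ∀ l → n₂ ℕ.+ n₃ ≡ l → WordChunk n₃ (n₃ ℕ.+ 1) l (l ℕ.+ 1) (only S₃ 1)
      s₃-mark l h = run S₃ n₃ l 1 (exact S₃ h) λ i u≤i i< →
        (λ e → n₃≢n₂ (≡.trans (sym (single u≤i i<)) e)) , (λ ()) , λ _ → single u≤i i<

      exchange-at : ∀ A B C → A ℕ.+ B ℕ.+ C ≡ p →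
        + A * + n₁ + + B * + n₂ + + C * + n₃ ≈ 0ℤ → Block c (tally A B C)
      exchange-at A B C = exchange A B C (λ h → n₁≢n₂ (below-p n₁<p n₂<p h))

      exchangeℕ : ∀ A B C → A ℕ.+ B ℕ.+ C ≡ p → ∀ q → A ℕ.* n₁ ℕ.+ B ℕ.* n₂ ℕ.+ C ℕ.* n₃ ≡ q ℕ.* p →
                  Block c (tally A B C)
      exchangeℕ A B C size q e = exchange-at A B C size
        (≈-trans (≡⇒≈ (≡.trans
          (cong₂ _+_ (cong₂ _+_ (sym (ℤ.pos-* A n₁)) (sym (ℤ.pos-* B n₂))) (sym (ℤ.pos-* C n₃)))
          (cong +_ e))) (kp≈0 q))

      wordCore : ∀ {u u′ l l′ M r N A B C} → WordChunk u u′ l l′ M → u′ ℕ.≤ p → l′ ℕ.≤ l ℕ.+ p →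
        Lines c r N → M S₁ ≡ 1 → M S₃ ≡ 1 → N S₁ ≡ 0 → N S₃ ≡ 0 →
        M X ℕ.+ N X ≡ A → M Y ℕ.+ N Y ≡ B → M Z ℕ.+ N Z ≡ C → Core r A B C
      wordCore {u} {u′} {M = M} {N = N} chunk u′≤p l′≤ lines M₁ M₃ N₁ N₃ eA eB eC = record
        { c₁ = + n₁ ; c₂ = + n₂ ; c₃ = + n₃ ; M = M ; N = N
        ; spine  = toBlock chunk u′≤ l′≤
        ; lines  = lines
        ; off-c₂ = All.map (λ { (n , refl , (_ , n<u′) , n≢n₂ , _) e →
                     n≢n₂ (below-p (ℕ.<-≤-trans n<u′ u′≤p) n₂<p e) }) located
        ; at-c₁  = All.map (λ { (n , refl , _ , _ , at , _) e → ≡⇒≈ (cong +_ (at e)) }) located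
        ; at-c₃  = All.map (λ { (n , refl , _ , _ , _ , at) e → ≡⇒≈ (cong +_ (at e)) }) located
        ; M₁ = M₁ ; M₃ = M₃ ; N₁ = N₁ ; N₃ = N₃
        ; count-A = eA ; count-B = eB ; count-C = eC
        }
        where
        u′≤ : u′ ℕ.≤ u ℕ.+ p
        u′≤ = ℕ.≤-trans u′≤p (ℕ.m≤n+m p u)
        located = toBlock-located chunk u′≤ l′≤

  ≤-by : ∀ k {a b} → a ℕ.+ k ≡ b → a ℕ.≤ b
  ≤-by k {a} e = subst (a ℕ.≤_) e (ℕ.m≤m+n a k)

  -- Explicit arrangements around the spine.

  module Arrangements (p-1 : ℕ) (pr : Prime (suc p-1)) where
    open Residues p-1
    open PrimeModulus pr
    open Blocks p-1
    open LineBlocks p-1 pr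
    open Cores p-1 pr

    -- s₂ Z … Z s₁ Y … Y s₃ X … X; the labels of Y, Z and X in this order are consecutive.
    module Caterpillar (α β γ : ℕ) (size : α ℕ.+ β ℕ.+ γ ℕ.+ 3 ≡ p) where

      n₁ n₃ : ℕ
      n₁ = suc γ
      n₃ = suc (suc (γ ℕ.+ β))

      private
        ar : ∀ α β γ → suc (suc (suc (γ ℕ.+ β))) ℕ.+ α ≡ α ℕ.+ β ℕ.+ γ ℕ.+ 3
        ar = ℕSolver.solve-∀

        size′ : suc n₃ ℕ.+ α ≡ p
        size′ = ≡.trans (ar α β γ) size

        n₁<p : n₁ ℕ.< p
        n₁<p = ≤-by (β ℕ.+ α ℕ.+ 1) (≡.trans (ar₁ α β γ) size)
          where
          ar₁ : ∀ α β γ → suc (suc γ) ℕ.+ (β ℕ.+ α ℕ.+ 1) ≡ α ℕ.+ β ℕ.+ γ ℕ.+ 3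
          ar₁ = ℕSolver.solve-∀

      open Word n₁ 0 n₃ n₁<p (s≤s z≤n) (λ ()) (λ ()) public

      private
        inner : WordChunk n₁ (n₃ ℕ.+ 1) n₁ (n₃ ℕ.+ 1) _
        inner = above (s₁-mark n₁ refl)
          (above (leaves-after Y (suc n₁) (suc n₁) β refl (s≤s z≤n)) (s₃-mark n₃ refl) ℕ.≤-refl ℕ.≤-refl)
          (ℕ.≤-reflexive (ℕ.+-comm n₁ 1)) (ℕ.≤-reflexive (ℕ.+-comm n₁ 1))

        word : WordChunk 1 (suc n₃ ℕ.+ α) n₁ (n₁ ℕ.+ suc n₃ ℕ.+ α) _
        word = above
          (below (leaves-after Z 1 (suc n₃) γ (ℕ.+-comm n₃ 1) (s≤s z≤n)) inner ℕ.≤-refl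
            (ℕ.≤-reflexive (ℕ.+-comm n₃ 1)))
          (leaves-after X (suc n₃) (n₁ ℕ.+ suc n₃) α refl (s≤s z≤n))
          (ℕ.≤-reflexive (ℕ.+-comm n₃ 1))
          -- The labels of Z end just below `suc n₃ + γ` and those of X start one higher; the label
          -- skipped in between is the missing one.
          (≤-by 1 (≡.trans (ℕ.+-comm _ 1) (cong suc (ℕ.+-comm (suc n₃) γ))))

      core : ∀ {r N A B C} → Lines c r N → N S₁ ≡ 0 → N S₃ ≡ 0 →
             α ℕ.+ N X ≡ A → β ℕ.+ N Y ≡ B → γ ℕ.+ N Z ≡ C → Core r A B C
      core {N = N} L N₁ N₃ eA eB eC = wordCore word (ℕ.≤-reflexive size′)
        (ℕ.≤-reflexive (≡.trans (ℕ.+-assoc n₁ (suc n₃) α) (cong (n₁ ℕ.+_) size′)))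
        L refl refl N₁ N₃ eA (≡.trans (cong (ℕ._+ N Y) (ar₀ β)) eB)
        (≡.trans (cong (ℕ._+ N Z) (ar₀ γ)) eC)
        where
        ar₀ : ∀ b → b ℕ.+ 0 ℕ.+ 0 ≡ b
        ar₀ = ℕSolver.solve-∀

    core₀ : ∀ α β γ → α ℕ.+ β ℕ.+ γ ℕ.+ 3 ≡ p → Core 0 α β γ
    core₀ α β γ size = Caterpillar.core α β γ size no-lines refl refl
      (ℕ.+-identityʳ α) (ℕ.+-identityʳ β) (ℕ.+-identityʳ γ)

    -- The spine 0, 1, -1 and two lines full of transpositions.
    core-full : ∀ h → 1 ℕ.+ 2 ℕ.* h ≡ p → 1 ℕ.≤ h → Core 2 (2 ℕ.* h) (2 ℕ.* h) (2 ℕ.* h)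
    core-full (suc h) size _ = core (line swaps ⊹ line swaps) refl refl (ar₁ h) (ar₂ h) (ar₁ h)
      where
      ar₀ : ∀ h → 0 ℕ.+ 2 ℕ.* h ℕ.+ 0 ℕ.+ 3 ≡ 1 ℕ.+ 2 ℕ.* suc h
      ar₀ = ℕSolver.solve-∀
      ar₁ : ∀ h → suc h ℕ.+ suc h ≡ 2 ℕ.* suc h
      ar₁ = ℕSolver.solve-∀
      ar₂ : ∀ h → 2 ℕ.* h ℕ.+ (1 ℕ.+ 1) ≡ 2 ℕ.* suc h
      ar₂ = ℕSolver.solve-∀
      open Caterpillar 0 (2 ℕ.* h) 0 (≡.trans (ar₀ h) size)
      ar₃ : ∀ h → suc h ℕ.+ 1 ℕ.+ suc h ≡ 1 ℕ.+ 2 ℕ.* suc h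
      ar₃ = ℕSolver.solve-∀
      ar₄ : ∀ h → suc h ℕ.* 1 ℕ.+ 1 ℕ.* 0 ℕ.+ suc h ℕ.* suc (suc (2 ℕ.* h)) ≡ suc h ℕ.* (1 ℕ.+ 2 ℕ.* suc h)
      ar₄ = ℕSolver.solve-∀
      -- Here `n₃` is `p` - 1, that is a₃ = - a₁, so equally many leaves of s₁ and s₃ balance; the
      -- single leaf of s₂ accounts for `p` being odd.
      swaps = exchangeℕ (suc h) 1 (suc h) (≡.trans (ar₃ h) size) (suc h)
        (≡.trans (ar₄ h) (cong (suc h ℕ.*_) size))

    -- s₂ Y … Y s₁ Y s₃ Y … Y with every Y fixed.
    core-balanced : ∀ α γ → suc α ℕ.+ suc γ ℕ.+ 2 ≡ p → Core 1 (suc α) (suc α ℕ.+ suc γ ℕ.+ 1) (suc γ)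
    core-balanced α γ size = wordCore word (ℕ.≤-reflexive size′)
        (ℕ.≤-trans (ℕ.≤-reflexive size′) (ℕ.m≤n+m p 1))
        -- `n₁` is the number `suc γ` of leaves of s₃ and `n₃` is `p` minus the number `suc α` of
        -- leaves of s₁, so their contributions cancel.
        (line (exchangeℕ (suc α) 2 (suc γ) (≡.trans (ar₁ α γ) size) n₁ (≡.trans (ar₂ α γ) (cong (suc γ ℕ.*_) size))))
        refl refl refl refl refl (ar₃ α γ) refl
      where
      n₁ n₃ : ℕ
      n₁ = suc γ
      n₃ = suc (suc (suc γ))
      ar : ∀ α γ → suc (suc (suc (suc γ))) ℕ.+ α ≡ suc α ℕ.+ suc γ ℕ.+ 2
      ar = ℕSolver.solve-∀
      size′ : suc n₃ ℕ.+ α ≡ p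
      size′ = ≡.trans (ar α γ) size
      n₁<p : n₁ ℕ.< p
      n₁<p = ≤-by (2 ℕ.+ α) (≡.trans (ar₀ α γ) size)
        where
        ar₀ : ∀ α γ → suc (suc γ) ℕ.+ (2 ℕ.+ α) ≡ suc α ℕ.+ suc γ ℕ.+ 2
        ar₀ = ℕSolver.solve-∀
      open Word n₁ 0 n₃ n₁<p (s≤s z≤n) (λ ()) (λ ())
      ar₁ : ∀ α γ → suc α ℕ.+ 2 ℕ.+ suc γ ≡ suc α ℕ.+ suc γ ℕ.+ 2
      ar₁ = ℕSolver.solve-∀
      ar₂ : ∀ α γ → suc α ℕ.* suc γ ℕ.+ 2 ℕ.* 0 ℕ.+ suc γ ℕ.* suc (suc (suc γ)) ≡
                    suc γ ℕ.* (suc α ℕ.+ suc γ ℕ.+ 2)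
      ar₂ = ℕSolver.solve-∀
      ar₃ : ∀ α γ → γ ℕ.+ (0 ℕ.+ (1 ℕ.+ (0 ℕ.+ α))) ℕ.+ 2 ≡ suc α ℕ.+ suc γ ℕ.+ 1
      ar₃ = ℕSolver.solve-∀
      fixed : ∀ u n → 0 ℕ.< u → WordChunk u (u ℕ.+ n) u (u ℕ.+ n) (only Y n)
      fixed u n 0<u = leaves-after Y u u n refl 0<u
      word : WordChunk 1 (suc n₃ ℕ.+ α) 1 (suc n₃ ℕ.+ α) _
      word = above (fixed 1 γ (s≤s z≤n)) (above (s₁-mark n₁ refl) (above (fixed (suc n₁) 1 (s≤s z≤n))
        (above (s₃-mark n₃ refl) (fixed (suc n₃) α (s≤s z≤n))
          n₃+1 n₃+1) n₁+2 n₁+2) n₁+1 n₁+1) ℕ.≤-refl ℕ.≤-refl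
        where
        n₃+1 = ℕ.≤-reflexive (ℕ.+-comm n₃ 1)
        n₁+1 = ℕ.≤-reflexive (ℕ.+-comm n₁ 1)
        n₁+2 = ℕ.≤-reflexive (ℕ.+-comm (suc n₁) 1)

    -- With p = 2 h + 1: the spine is a₂ = 0, a₃ = 1, a₁ = h + 1 = 1/2.
    core-half : ∀ h → 1 ℕ.+ 2 ℕ.* suc (suc h) ≡ p →
                Core 2 p (2 ℕ.* suc (suc h)) (2 ℕ.* suc h ℕ.+ 1)
    core-half h′ size = wordCore word (ℕ.≤-reflexive size′) (ℕ.≤-reflexive (≡.trans (ar₁ h′) (cong suc size)))
        -- Both relations come from 2 a₁ = a₃ = 1: on the first line `p` - 2 leaves of s₁ amount to
        -- - 2 a₁ and one of s₃ to 1; on the second a₁ + h a₃ = 2 h + 1 = p.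
        (line (exchangeℕ (2 ℕ.* suc h′ ℕ.+ 1) 1 1 (≡.trans (ar₂ h′) size) h (≡.trans (ar₃ h′) (cong (h ℕ.*_) size)))
         ⊹ line (exchangeℕ 1 h h (≡.trans (ar₄ h′) size) 1 (≡.trans (ar₅ h′) (cong (1 ℕ.*_) size))))
        refl refl refl refl (≡.trans (ar₆ h′) size) (ar₇ h′) (ar₈ h′)
      where
      h = suc (suc h′)
      n₁ = suc h
      size′ : suc n₁ ℕ.+ suc h′ ≡ p
      size′ = ≡.trans (ar h′) size
        where
        ar : ∀ h → suc (suc (suc (suc h))) ℕ.+ suc h ≡ 1 ℕ.+ 2 ℕ.* suc (suc h)
        ar = ℕSolver.solve-∀
      n₁<p : n₁ ℕ.< p
      n₁<p = ≤-by (suc h′) size′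
      open Word n₁ 0 1 n₁<p (s≤s z≤n) (λ ()) (λ ())
      ar₁ : ∀ h → suc (suc (suc h)) ℕ.+ suc (suc h) ℕ.+ 1 ≡ suc (1 ℕ.+ 2 ℕ.* suc (suc h))
      ar₁ = ℕSolver.solve-∀
      ar₂ : ∀ h → 2 ℕ.* suc h ℕ.+ 1 ℕ.+ 1 ℕ.+ 1 ≡ 1 ℕ.+ 2 ℕ.* suc (suc h)
      ar₂ = ℕSolver.solve-∀
      ar₃ : ∀ h → (2 ℕ.* suc h ℕ.+ 1) ℕ.* suc (suc (suc h)) ℕ.+ 1 ℕ.* 0 ℕ.+ 1 ℕ.* 1 ≡
                  suc (suc h) ℕ.* (1 ℕ.+ 2 ℕ.* suc (suc h))
      ar₃ = ℕSolver.solve-∀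
      ar₄ : ∀ h → 1 ℕ.+ suc (suc h) ℕ.+ suc (suc h) ≡ 1 ℕ.+ 2 ℕ.* suc (suc h)
      ar₄ = ℕSolver.solve-∀
      ar₅ : ∀ h → 1 ℕ.* suc (suc (suc h)) ℕ.+ suc (suc h) ℕ.* 0 ℕ.+ suc (suc h) ℕ.* 1 ≡
                  1 ℕ.* (1 ℕ.+ 2 ℕ.* suc (suc h))
      ar₅ = ℕSolver.solve-∀
      ar₆ : ∀ h → 1 ℕ.+ 0 ℕ.+ (2 ℕ.* suc h ℕ.+ 1 ℕ.+ 1) ≡ 1 ℕ.+ 2 ℕ.* suc (suc h)
      ar₆ = ℕSolver.solve-∀
      ar₇ : ∀ h → suc h ℕ.+ (1 ℕ.+ suc (suc h)) ≡ 2 ℕ.* suc (suc h)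
      ar₇ = ℕSolver.solve-∀
      ar₈ : ∀ h → h ℕ.+ 0 ℕ.+ (1 ℕ.+ suc (suc h)) ≡ 2 ℕ.* suc h ℕ.+ 1
      ar₈ = ℕSolver.solve-∀
      upper : WordChunk h (suc n₁ ℕ.+ suc h′) n₁ (n₁ ℕ.+ h ℕ.+ 1) _
      upper = below (leaves-after X h (n₁ ℕ.+ h) 1 refl (s≤s z≤n))
        (above (s₁-mark n₁ refl) (leaves-after Y (suc n₁) (suc n₁) (suc h′) refl (s≤s z≤n)) n₁+1 n₁+1)
        (ℕ.≤-reflexive (ℕ.+-comm h 1)) (≤-by 0 (ar₉ h′))
        where
        n₁+1 = ℕ.≤-reflexive (ℕ.+-comm n₁ 1)
        ar₉ : ∀ h → suc (suc (suc (suc h))) ℕ.+ suc h ℕ.+ 0 ≡ suc (suc (suc h)) ℕ.+ suc (suc h)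
        ar₉ = ℕSolver.solve-∀
      -- The labels are 1, 3, ..., `p`, with 2 missing; `p` itself is taken by the leaf of s₁ at
      -- position `h`.
      word : WordChunk 1 (suc n₁ ℕ.+ suc h′) 1 (n₁ ℕ.+ h ℕ.+ 1) _
      word = above (s₃-mark 1 refl)
        (above (leaves-after Z 2 3 h′ refl (s≤s z≤n)) upper ℕ.≤-refl ℕ.≤-refl)
        ℕ.≤-refl (s≤s (s≤s z≤n))

    -- The spine is a₁ = 0, a₃ = 1, a₂ = 2; all other positions carry leaves of s₂ and s₃.
    module Tight (γ b h : ℕ) (size : 3 ℕ.+ γ ℕ.+ b ≡ p) (odd : 1 ℕ.+ 2 ℕ.* h ≡ p) where

      private
        2<p : 3 ℕ.≤ p
        2<p = ≤-by (γ ℕ.+ b) size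

        n₁<p : 0 ℕ.< p
        n₁<p = s≤s z≤n

      open Word 0 2 1 n₁<p 2<p (λ ()) (λ ())

      private
        ar₁ : ∀ h → h ℕ.+ h ℕ.+ 1 ≡ 1 ℕ.+ 2 ℕ.* h
        ar₁ = ℕSolver.solve-∀
        ar₂ : ∀ h → h ℕ.* 0 ℕ.+ h ℕ.* 2 ℕ.+ 1 ℕ.* 1 ≡ 1 ℕ.* (1 ℕ.+ 2 ℕ.* h)
        ar₂ = ℕSolver.solve-∀
        ar₃ : ∀ γ b → 2 ℕ.+ (3 ℕ.+ γ) ℕ.+ b ≡ 2 ℕ.+ (3 ℕ.+ γ ℕ.+ b)
        ar₃ = ℕSolver.solve-∀
        ar₄ : ∀ h → h ℕ.+ h ≡ 2 ℕ.* h
        ar₄ = ℕSolver.solve-∀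
        other : Block c (tally h h 1)
        other = exchangeℕ h h 1 (≡.trans (ar₁ h) odd) 1 (≡.trans (ar₂ h) (cong (1 ℕ.*_) odd))
        word : WordChunk 0 (3 ℕ.+ γ ℕ.+ b) 2 (2 ℕ.+ (3 ℕ.+ γ) ℕ.+ b) _
        word = above (above (s₁-mark 2 refl) (s₃-mark 3 refl) ℕ.≤-refl ℕ.≤-refl)
          (above (leaves-after Z 3 4 γ refl ℕ.≤-refl)
            (leaves-after Y (3 ℕ.+ γ) (2 ℕ.+ (3 ℕ.+ γ)) b refl (s≤s (s≤s (s≤s z≤n))))
            ℕ.≤-refl (ℕ.n≤1+n _)) (s≤s (s≤s z≤n)) ℕ.≤-refl

      -- Since 2 h = p - 1, taking `b` to be 1 or 2 gives s₂ exactly p or p + 1 leaves: the residues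
      -- 0 and 1, realised by at least `p` leaves.
      core : Core 2 (2 ℕ.* h) (b ℕ.+ 2 ℕ.* h) (γ ℕ.+ 2)
      core = wordCore word (ℕ.≤-reflexive size) (ℕ.≤-reflexive (≡.trans (ar₃ γ b) (cong (2 ℕ.+_) size)))
        (line other ⊹ line other) refl refl refl refl (ar₄ h)
        (cong (b ℕ.+_) (ar₄ h)) (cong (ℕ._+ 2) (ℕ.+-identityʳ γ))

    -- The spine is a₁ = 0, a₂ = s, a₃ = -1, so that leaves of s₁ keep their place. One path of leaves
    -- runs down from s - 1 to 0; another goes down q steps and then up by jumps of s until it
    -- reaches -1.
    module Paths (ε r q f g : ℕ)
      (size : suc (q ℕ.+ r) ℕ.* (2 ℕ.+ ε ℕ.+ r ℕ.+ f ℕ.* suc (q ℕ.+ r)) ℕ.+ suc ε ≡ p)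
      (gap : suc g ≡ suc (q ℕ.+ r) ℕ.* (ε ℕ.+ r) ℕ.+ ε ℕ.+ f ℕ.* suc (q ℕ.+ r) ℕ.* (q ℕ.+ r)) where

      -- On the second line `b` leaves of s₂ are balanced by `s * b` leaves of s₃, because a₂ = s
      -- and a₃ = -1. The second path turns from steps down to jumps at `u₀`, and `gap` makes `n₃`
      -- equal to `p` - 1.
      s b n₃ u₀ : ℕ
      s = suc (q ℕ.+ r)
      b = ε ℕ.+ r ℕ.+ f ℕ.* (q ℕ.+ r)
      u₀ = suc s ℕ.+ g
      n₃ = s ℕ.+ u₀ ℕ.+ f ℕ.* s

      private
        size′ : suc n₃ ≡ p
        size′ = ≡.trans (ar₁ q r f g) (≡.trans (cong (λ t → t ℕ.+ 1 ℕ.+ 2 ℕ.* s ℕ.+ f ℕ.* s) gap)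
          (≡.trans (ar₂ ε q r f) size))
          where
          ar₁ : ∀ q r f g → suc (suc (q ℕ.+ r) ℕ.+ (suc (suc (q ℕ.+ r)) ℕ.+ g) ℕ.+ f ℕ.* suc (q ℕ.+ r)) ≡
                suc g ℕ.+ 1 ℕ.+ 2 ℕ.* suc (q ℕ.+ r) ℕ.+ f ℕ.* suc (q ℕ.+ r)
          ar₁ = ℕSolver.solve-∀
          ar₂ : ∀ ε q r f → suc (q ℕ.+ r) ℕ.* (ε ℕ.+ r) ℕ.+ ε ℕ.+ f ℕ.* suc (q ℕ.+ r) ℕ.* (q ℕ.+ r)
                ℕ.+ 1 ℕ.+ 2 ℕ.* suc (q ℕ.+ r) ℕ.+ f ℕ.* suc (q ℕ.+ r) ≡
                suc (q ℕ.+ r) ℕ.* (2 ℕ.+ ε ℕ.+ r ℕ.+ f ℕ.* suc (q ℕ.+ r)) ℕ.+ suc ε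
          ar₂ = ℕSolver.solve-∀

        s<n₃ : s ℕ.< n₃
        s<n₃ = ℕ.<-≤-trans (ℕ.m<m+n s (s≤s z≤n)) (ℕ.m≤m+n (s ℕ.+ u₀) (f ℕ.* s))

        s<p : s ℕ.< p
        s<p = ℕ.<-trans s<n₃ (ℕ.≤-reflexive size′)

      open Word 0 s n₃ (s≤s z≤n) s<p (λ ()) (≢-sym (ℕ.<⇒≢ s<n₃))

      private
        after : ∀ {u} → u₀ ℕ.≤ u → s ℕ.< u
        after u₀≤u = ℕ.≤-trans (ℕ.m≤m+n (suc s) g) u₀≤u

        end : ℕ → ℕ → ℕ
        end zero    u = u
        end (suc f) u = end f (s ℕ.+ u)

        end≡ : ∀ f u → end f u ≡ u ℕ.+ f ℕ.* s
        end≡ zero    u = sym (ℕ.+-identityʳ u)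
        end≡ (suc f) u = ≡.trans (end≡ f (s ℕ.+ u)) (ar s u (f ℕ.* s))
          where
          ar : ∀ s u t → s ℕ.+ u ℕ.+ t ≡ u ℕ.+ (s ℕ.+ t)
          ar = ℕSolver.solve-∀

        jumps : ℕ → Color → ℕ
        jumps zero    κ = 0
        jumps (suc f) κ = only Y 1 κ ℕ.+ only X (q ℕ.+ r) κ ℕ.+ jumps f κ

        jump : ∀ f u → u₀ ℕ.≤ u → WordChunk u (end f u) (suc u) (suc (end f u)) (jumps f)
        jump zero    u u₀≤u = record
          { items = [] ; u≤u′ = ℕ.≤-refl ; l≤l′ = ℕ.≤-refl ; located = [] ; distinct = []
          ; counts = λ _ → refl }
        jump (suc f) u u₀≤u = above
          (below (leaves-after Y u (s ℕ.+ u) 1 refl (after u₀≤u))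
            (leaves-after X (suc u) (suc u) (q ℕ.+ r) refl (ℕ.m<n⇒m<1+n (after u₀≤u)))
            (ℕ.≤-reflexive (ℕ.+-comm u 1)) (ℕ.≤-reflexive (cong suc (ℕ.+-comm u (q ℕ.+ r)))))
          (jump f (s ℕ.+ u) (ℕ.≤-trans u₀≤u (ℕ.m≤n+m u s)))
          (ℕ.≤-reflexive (cong suc (ℕ.+-comm u (q ℕ.+ r))))
          (ℕ.≤-reflexive (ℕ.+-comm (s ℕ.+ u) 1))

        jumps-X : ∀ f → jumps f X ≡ f ℕ.* (q ℕ.+ r)
        jumps-X zero    = refl
        jumps-X (suc f) = cong (q ℕ.+ r ℕ.+_) (jumps-X f)

        jumps-Y : ∀ f → jumps f Y ≡ f
        jumps-Y zero    = refl
        jumps-Y (suc f) = cong suc (jumps-Y f)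

        jumps-Z : ∀ f → jumps f Z ≡ 0
        jumps-Z zero    = refl
        jumps-Z (suc f) = jumps-Z f

        jumps-S₁ : ∀ f → jumps f S₁ ≡ 0
        jumps-S₁ zero    = refl
        jumps-S₁ (suc f) = jumps-S₁ f

        jumps-S₃ : ∀ f → jumps f S₃ ≡ 0
        jumps-S₃ zero    = refl
        jumps-S₃ (suc f) = jumps-S₃ f

        turn : WordChunk u₀ (suc u₀ ℕ.+ q ℕ.+ r) u₀ (s ℕ.+ u₀ ℕ.+ 1) _
        turn = below (leaves-after Y u₀ (s ℕ.+ u₀) 1 refl (after ℕ.≤-refl))
          (above (run Z (suc u₀) u₀ q down (λ i u≤i _ →
              free-leaf {Z} tt (≢-sym (ℕ.<⇒≢ (after (ℕ.<⇒≤ u≤i))))))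
            (leaves-after X (suc u₀ ℕ.+ q) (suc u₀ ℕ.+ q) r refl (after (≤-by (suc q) (ar₁ u₀ q))))
            -- The label skipped here, u₀ + q, is the missing one.
            ℕ.≤-refl (ℕ.n≤1+n _))
          (ℕ.≤-reflexive (ℕ.+-comm u₀ 1)) (ℕ.≤-reflexive (ar₂ u₀ q r))
          where
          ar₁ : ∀ u q → u ℕ.+ suc q ≡ suc u ℕ.+ q
          ar₁ = ℕSolver.solve-∀
          ar₂ : ∀ u q r → suc u ℕ.+ q ℕ.+ r ≡ suc (q ℕ.+ r) ℕ.+ u
          ar₂ = ℕSolver.solve-∀
          ar₃ : ∀ n u → n ℕ.+ suc u ≡ u ℕ.+ suc n
          ar₃ = ℕSolver.solve-∀
          down : + n₃ + + suc u₀ ≈ + u₀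
          down = ≈-trans (≡⇒≈ (cong +_ (≡.trans (ar₃ n₃ u₀) (cong (u₀ ℕ.+_) size′))))
            (≈-trans (+-cong (≈-refl {+ u₀}) p≈0) (≡⇒≈ (ℤ.+-identityʳ (+ u₀))))

        middle : WordChunk (suc s) (end f (s ℕ.+ u₀)) (suc s) (suc (end f (s ℕ.+ u₀))) _
        middle = above (leaves-after X (suc s) (suc s) g refl ℕ.≤-refl)
          (above turn (jump f (s ℕ.+ u₀) (ℕ.m≤n+m u₀ s))
            (ℕ.≤-reflexive (ar₂ u₀ q r)) (ℕ.≤-reflexive (ℕ.+-comm (s ℕ.+ u₀) 1)))
          ℕ.≤-refl ℕ.≤-refl
          where
          ar₂ : ∀ u q r → suc u ℕ.+ q ℕ.+ r ≡ suc (q ℕ.+ r) ℕ.+ u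
          ar₂ = ℕSolver.solve-∀

        end≡n₃ : end f (s ℕ.+ u₀) ≡ n₃
        end≡n₃ = end≡ f (s ℕ.+ u₀)

        -- Read as a map from positions to labels, the line is a single path from the missing label
        -- u₀ + q through u₀, -1, s - 1 and 0 to s, the place of s₂; leaves of s₁ fix everything
        -- else. The labels 0 to s - 1 are written as `p` onwards to fit the window starting at `s`.
        word : WordChunk 0 (n₃ ℕ.+ 1) s (s ℕ.+ n₃ ℕ.+ 1) _
        word = above (s₁-mark s (ℕ.+-identityʳ s))
          (above
            (below (leaves-before Z 1 p (q ℕ.+ r) (≡.trans (ℕ.+-comm n₃ 1) size′) ℕ.≤-refl) middle
              (ℕ.n≤1+n s) (ℕ.≤-reflexive (≡.trans (cong suc end≡n₃) size′)))
            (s₃-mark (s ℕ.+ n₃) refl)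
            (ℕ.≤-reflexive end≡n₃)
            (ℕ.≤-reflexive (≡.trans (cong (ℕ._+ (q ℕ.+ r)) (sym size′)) (cong suc (ℕ.+-comm n₃ (q ℕ.+ r))))))
          ℕ.≤-refl (ℕ.≤-reflexive (ℕ.+-comm s 1))

      core : ∀ {A B C} →
        g ℕ.+ r ℕ.+ f ℕ.* (q ℕ.+ r) ℕ.+ (3 ℕ.+ 2 ℕ.* q ℕ.+ r ℕ.+ f) ≡ A →
        1 ℕ.+ f ℕ.+ b ≡ B → q ℕ.+ r ℕ.+ q ℕ.+ s ℕ.* b ≡ C → Core 1 A B C
      core eA eB eC = wordCore word
        (ℕ.≤-reflexive (≡.trans (ℕ.+-comm n₃ 1) size′))
        (ℕ.≤-reflexive (≡.trans (ℕ.+-assoc s n₃ 1) (cong (s ℕ.+_) (≡.trans (ℕ.+-comm n₃ 1) size′))))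
        (line (exchangeℕ (3 ℕ.+ 2 ℕ.* q ℕ.+ r ℕ.+ f) b (s ℕ.* b) (≡.trans (ar₁ ε q r f) size) (s ℕ.* b)
          (≡.trans (ar₂ (3 ℕ.+ 2 ℕ.* q ℕ.+ r ℕ.+ f) b s n₃) (cong (s ℕ.* b ℕ.*_) size′))))
        (cong (λ t → suc (t ℕ.+ 0)) (jumps-S₁ f)) (cong (ℕ._+ 1) (jumps-S₃ f)) refl refl
        (≡.trans (cong (λ t → g ℕ.+ (r ℕ.+ t) ℕ.+ 0 ℕ.+ (3 ℕ.+ 2 ℕ.* q ℕ.+ r ℕ.+ f)) (jumps-X f))
          (≡.trans (ar₃ g r (f ℕ.* (q ℕ.+ r)) (3 ℕ.+ 2 ℕ.* q ℕ.+ r ℕ.+ f)) eA))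
        (≡.trans (cong (λ t → 1 ℕ.+ t ℕ.+ 0 ℕ.+ b) (jumps-Y f)) (≡.trans (ar₄ f b) eB))
        (≡.trans (cong (λ t → q ℕ.+ r ℕ.+ (q ℕ.+ 0 ℕ.+ t) ℕ.+ 0 ℕ.+ s ℕ.* b) (jumps-Z f))
          (≡.trans (ar₅ (q ℕ.+ r) q (s ℕ.* b)) eC))
        where
        ar₁ : ∀ ε q r f → 3 ℕ.+ 2 ℕ.* q ℕ.+ r ℕ.+ f ℕ.+ (ε ℕ.+ r ℕ.+ f ℕ.* (q ℕ.+ r)) ℕ.+
              suc (q ℕ.+ r) ℕ.* (ε ℕ.+ r ℕ.+ f ℕ.* (q ℕ.+ r)) ≡
              suc (q ℕ.+ r) ℕ.* (2 ℕ.+ ε ℕ.+ r ℕ.+ f ℕ.* suc (q ℕ.+ r)) ℕ.+ suc ε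
        ar₁ = ℕSolver.solve-∀
        ar₂ : ∀ a b s n → a ℕ.* 0 ℕ.+ b ℕ.* s ℕ.+ s ℕ.* b ℕ.* n ≡ s ℕ.* b ℕ.* suc n
        ar₂ = ℕSolver.solve-∀
        ar₃ : ∀ g r t a → g ℕ.+ (r ℕ.+ t) ℕ.+ 0 ℕ.+ a ≡ g ℕ.+ r ℕ.+ t ℕ.+ a
        ar₃ = ℕSolver.solve-∀
        ar₄ : ∀ f b → 1 ℕ.+ f ℕ.+ 0 ℕ.+ b ≡ 1 ℕ.+ f ℕ.+ b
        ar₄ = ℕSolver.solve-∀
        ar₅ : ∀ t q c → t ℕ.+ (q ℕ.+ 0 ℕ.+ 0) ℕ.+ 0 ℕ.+ c ≡ t ℕ.+ q ℕ.+ c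
        ar₅ = ℕSolver.solve-∀

  -- If s₁ is a leaf then a₁ may be chosen off the line through a₂ = 0 and a₃ = 1.
  module DoubleStar (p-2 : ℕ) (pr : Prime (suc (suc p-2))) (k : ℕ)
    (q₂ q₃ : ℕ) (full : suc (suc (q₂ ℕ.+ q₃)) ≡ suc (suc p-2) ℕ.^ k) where

    private
      p-1 : ℕ
      p-1 = suc p-2

    open Residues p-1
    open Vectors p-1
    open Blocks p-1
    open LineBlocks p-1 pr
    open Layouts p-1 (suc k)
    open Assembly p-1 k

    private
      c : Color → ℤ
      c = byColor 0ℤ 0ℤ 1ℤ

      Mark₃ Mark₁ : Color → ℕ → Set
      Mark₃ κ n = κ ≡ S₃ → n ≡ 1
      Mark₁ κ n = κ ≡ S₁ → n ≡ 0

      line₀ : Chunk c Mark₃ 1 (2 ℕ.+ p-2) 1 (3 ℕ.+ p-2) _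
      line₀ = above
        (run S₃ 1 1 1 ≈-refl (λ { i 1≤i i<2 _ → ℕ.≤-antisym (ℕ.s≤s⁻¹ i<2) 1≤i }))
        (run Z 2 3 p-2 ≈-refl (λ _ _ _ ())) ℕ.≤-refl (ℕ.n≤1+n 2)

      line₁ : Chunk c Mark₁ 0 p 0 p _
      line₁ = above (run S₁ 0 0 1 ≈-refl (λ { i _ i<1 _ → ℕ.n≤0⇒n≡0 (ℕ.s≤s⁻¹ i<1) }))
        (run Y 1 1 p-1 ≈-refl (λ _ _ _ ())) ℕ.≤-refl ℕ.≤-refl

      block₀ = toBlock line₀ (ℕ.n≤1+n p) ℕ.≤-refl
      block₁ = toBlock line₁ ℕ.≤-refl ℕ.≤-refl
      located₀ = toBlock-located line₀ (ℕ.n≤1+n p) ℕ.≤-refl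
      located₁ = toBlock-located line₁ ℕ.≤-refl ℕ.≤-refl

      L = copies q₂ (monochrome {c} Y) ⊹ copies q₃ (monochrome {c} Z)

      module B₀ = Block block₀
      module B₁ = Block block₁
      module L = Lines L

      two-vectors : ∀ vs → vectors k ≡ zeros ∷ vs → ∃ λ e → ∃ λ gs → vs ≡ e ∷ gs × length gs ≡ q₂ ℕ.+ q₃
      two-vectors vs eq = go vs (≡.trans (sym (cong length eq)) (≡.trans (length-vectors k) (sym full)))
        where
        go : ∀ vs → suc (length vs) ≡ suc (suc (q₂ ℕ.+ q₃)) →
             ∃ λ e → ∃ λ gs → vs ≡ e ∷ gs × length gs ≡ q₂ ℕ.+ q₃
        go (e ∷ gs) h = e , gs , refl , ℕ.suc-injective (ℕ.suc-injective h)

      second = two-vectors _ (proj₂ (vectors-head k))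

      e : Zpk p k
      e = proj₁ second

      gs : List (Zpk p k)
      gs = proj₁ (proj₂ second)

      gs-length : length gs ≡ length L.blocks
      gs-length = ≡.trans (proj₂ (proj₂ (proj₂ second))) (sym L.number)

      unique : Unique (zeros ∷ e ∷ gs)
      unique = subst Unique (≡.trans (proj₂ (vectors-head k)) (cong (zeros ∷_) (proj₁ (proj₂ (proj₂ second)))))
        (vectors-unique k)

      a₁ a₂ a₃ : G
      a₁ = residue 0ℤ ∷ e
      a₂ = residue 0ℤ ∷ zeros
      a₃ = residue 1ℤ ∷ zeros

      a : Color → G
      a = byColor a₁ a₂ a₃

      in-line : ∀ κ → κ ≢ X → InLine a c κ
      in-line X  ≢X = ⊥-elim (≢X refl)
      in-line Y  _  = refl
      in-line Z  _  = refl
      in-line S₁ _  = refl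
      in-line S₃ _  = refl

      all-in-line : ∀ {b : List (Color × ℤ)} → All (λ it → proj₁ it ≢ X) b → All (InLine a c ∘ proj₁) b
      all-in-line = All.map (λ {it} → in-line (proj₁ it))

      rest rows : List Row
      rest = List.zip gs L.blocks
      rows = (zeros , B₀.items) ∷ (e , B₁.items) ∷ rest

      zero-count : ∀ a b → a ℕ.* 0 ℕ.+ b ℕ.* 0 ≡ 0
      zero-count = ℕSolver.solve-∀

      no-X : All (All (λ it → proj₁ it ≢ X)) L.blocks
      no-X = All.concat⁻ (count-none X (concat L.blocks) (≡.trans (L.counts X) (zero-count q₂ q₃)))

      rest-ok : All (RowOK a c) rest
      rest-ok = zip-all₂ gs (All.zipWith (λ { (s , n) → s , all-in-line n }) (L.separated , no-X))

      later-ok : All (RowOK a c) ((e , B₁.items) ∷ rest)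
      later-ok = (B₁.separated , all-in-line (count-none X B₁.items (B₁.counts X))) ∷ rest-ok

      count-rest : ∀ κ → count κ (flatten rest) ≡ q₂ ℕ.* only Y p κ ℕ.+ q₃ ℕ.* only Z p κ
      count-rest κ = ≡.trans (count-flatten κ gs L.blocks gs-length) (L.counts κ)

      nonzero : All (zeros ≢_) (e ∷ gs)
      nonzero = AllPairs.head unique

      later-on-line : All (OnLine a c (zeros ≢_)) (flatten ((e , B₁.items) ∷ rest))
      later-on-line = flatten-onLine a c {zeros ≢_} ((e , B₁.items) ∷ rest) later-ok
        (zip-all {P = zeros ≢_} (B₁.items ∷ L.blocks) nonzero)

      count-items : ∀ κ → count κ (flatten rows) ≡
        count κ B₀.items ℕ.+ (count κ B₁.items ℕ.+ (q₂ ℕ.* only Y p κ ℕ.+ q₃ ℕ.* only Z p κ))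
      count-items κ = ≡.trans (count-++ κ (map (place zeros) B₀.items) _)
        (cong₂ ℕ._+_ (count-place κ zeros B₀.items)
          (≡.trans (count-++ κ (map (place e) B₁.items) _)
            (cong₂ ℕ._+_ (count-place κ e B₁.items) (count-rest κ))))

      absent : ∀ {v : G} κ (xs : List (Color × G)) → count κ xs ≡ 0 →
               All (λ it → proj₁ it ≡ κ → proj₂ it ≡ v) xs
      absent κ xs h = All.map (λ ne e → ⊥-elim (ne e)) (count-none κ xs h)

      layout : Layout
      layout = record
        { a₁ = a₁ ; a₂ = a₂ ; a₃ = a₃
        ; items      = flatten rows
        ; compatible = flatten-compatible a c rows (zip-distinct (B₀.items ∷ B₁.items ∷ L.blocks) unique)
            ((B₀.separated , all-in-line (count-none X B₀.items (B₀.counts X))) ∷ later-ok)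
        ; avoids-a₂  = All.++⁺
            (All.map⁺ (All.map (λ { (n , refl , (1≤n , n<p) , _) eq → ℕ.<⇒≢ 1≤n
               (sym (below-p n<p (s≤s z≤n) (residue-injective (cong Vec.head eq)))) }) located₀))
            (All.map (λ { (_ , ne) eq → ne (sym (cong Vec.tail eq)) }) later-on-line)
        ; S₁-at-a₁   = All.++⁺
            (absent S₁ (map (place zeros) B₀.items) (≡.trans (count-place S₁ zeros B₀.items) (B₀.counts S₁)))
            (All.++⁺ (All.map⁺ (All.map
               (λ { (n , refl , _ , at) eq → cong (λ t → residue (+ t) ∷ e) (at eq) }) located₁))
              (absent S₁ (flatten rest) (≡.trans (count-rest S₁) (zero-count q₂ q₃))))
        ; S₃-at-a₃   = All.++⁺
            (All.map⁺ (All.map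
               (λ { (n , refl , _ , at) eq → cong (λ t → residue (+ t) ∷ zeros) (at eq) }) located₀))
            (All.++⁺ (absent S₃ (map (place e) B₁.items)
                (≡.trans (count-place S₃ e B₁.items) (B₁.counts S₃)))
              (absent S₃ (flatten rest) (≡.trans (count-rest S₃) (zero-count q₂ q₃))))
        ; count-S₁   = ≡.trans (count-items S₁) (cong₂ ℕ._+_ (B₀.counts S₁)
            (cong₂ ℕ._+_ (B₁.counts S₁) (zero-count q₂ q₃)))
        ; count-S₃   = ≡.trans (count-items S₃) (cong₂ ℕ._+_ (B₀.counts S₃)
            (cong₂ ℕ._+_ (B₁.counts S₃) (zero-count q₂ q₃)))
        }

    rainbow : p ℕ.^ suc k ≡ p-1 ℕ.+ q₂ ℕ.* p ℕ.+ (p-2 ℕ.+ q₃ ℕ.* p) ℕ.+ 3 →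
              Rainbow p (suc k) 0 (p-1 ℕ.+ q₂ ℕ.* p) (p-2 ℕ.+ q₃ ℕ.* p)
    rainbow size = recount-rainbow
        (≡.trans (count-items X) (cong₂ ℕ._+_ (B₀.counts X) (cong₂ ℕ._+_ (B₁.counts X) (zero-count q₂ q₃))))
        (≡.trans (count-items Y) (≡.trans (cong₂ ℕ._+_ (B₀.counts Y) (cong (ℕ._+ (q₂ ℕ.* p ℕ.+ q₃ ℕ.* 0)) (B₁.counts Y)))
          (ar₁ p-1 q₂ p q₃)))
        (≡.trans (count-items Z) (≡.trans (cong₂ ℕ._+_ (B₀.counts Z) (cong (ℕ._+ (q₂ ℕ.* 0 ℕ.+ q₃ ℕ.* p)) (B₁.counts Z)))
          (ar₂ p-2 q₂ p q₃)))
        (FromLayout.layout⇒rainbow layout) (sym size)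
      where
      ar₁ : ∀ n b p c → n ℕ.+ (b ℕ.* p ℕ.+ c ℕ.* 0) ≡ n ℕ.+ b ℕ.* p
      ar₁ = ℕSolver.solve-∀
      ar₂ : ∀ n b p c → n ℕ.+ (b ℕ.* 0 ℕ.+ c ℕ.* p) ≡ n ℕ.+ c ℕ.* p
      ar₂ = ℕSolver.solve-∀

  -- Multiples of three residues that wrap around together.

  module Balancing (p-1 : ℕ) where
    open Residues p-1

    reduced : ℕ → ℕ → ℕ
    reduced D a with D ℕ.+ a ℕ.<? p
    ... | yes _ = D ℕ.+ a
    ... | no  _ = D ℕ.+ a ℕ.∸ p

    -- The residue of n D, built by repeated addition so that each step shows whether it wraps
    -- around.
    mult : ℕ → ℕ → ℕ
    mult zero    D = 0
    mult (suc n) D = reduced D (mult n D)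

    reduced-spec : ∀ {D a} → D ℕ.< p → a ℕ.< p →
      reduced D a ℕ.< p × ∃ λ w → w ℕ.≤ 1 × reduced D a ℕ.+ w ℕ.* p ≡ D ℕ.+ a
    reduced-spec {D} {a} D<p a<p with D ℕ.+ a ℕ.<? p
    ... | yes small = small , 0 , z≤n , ℕ.+-identityʳ _
    ... | no  large = ℕ.m<n+o⇒m∸n<o (D ℕ.+ a) p (ℕ.+-mono-< D<p a<p) , 1 , ℕ.≤-refl ,
          ≡.trans (cong (D ℕ.+ a ℕ.∸ p ℕ.+_) (ℕ.*-identityˡ p)) (ℕ.m∸n+n≡m (ℕ.≮⇒≥ large))

    mult<p : ∀ {D} → D ℕ.< p → ∀ n → mult n D ℕ.< p
    mult<p D<p zero    = s≤s z≤n
    mult<p D<p (suc n) = proj₁ (reduced-spec D<p (mult<p D<p n))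

    mult-≈ : ∀ {D} → D ℕ.< p → ∀ n → + mult n D ≈ + n * + D
    mult-≈ {D} D<p zero    = ≡⇒≈ (sym (ℤ.*-zeroˡ (+ D)))
    mult-≈ {D} D<p (suc n) with reduced-spec D<p (mult<p D<p n)
    ... | _ , w , _ , e = shift (+-cong (≈-trans (≡⇒≈ (cong +_ e)) (+-cong (≈-refl {+ D}) (mult-≈ D<p n)))
            (≈-sym (kp≈0 w)))
          (id₁ (+ reduced D (mult n D)) (+ (w ℕ.* p)) (+ D) (+ n))
      where
      id₁ : ∀ r w d n → r - (1ℤ + n) * d ≡ r + w + 0ℤ - (d + n * d + w)
      id₁ = solve-∀

    mult-p : ∀ {D} → D ℕ.< p → mult p D ≡ 0
    mult-p {D} D<p = below-p (mult<p D<p p) (s≤s z≤n)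
      (≈-trans (mult-≈ D<p p) (≈-trans (*-cong p≈0 (≈-refl {+ D})) (≡⇒≈ (ℤ.*-zeroˡ (+ D)))))

    -- The sum of the residues of n A, n B, n C is 2p for n = 1 and 0 for n = p, and below 3p
    -- throughout, so at some step it drops from 2p to p, that is, all three residues wrap around.
    module _ {A B C : ℕ} (A<p : A ℕ.< p) (B<p : B ℕ.< p) (C<p : C ℕ.< p)
      (total : A ℕ.+ B ℕ.+ C ≡ 2 ℕ.* p) where

      private
        S : ℕ → ℕ
        S n = mult n A ℕ.+ mult n B ℕ.+ mult n C

      Wraps : ℕ → ℕ → Set
      Wraps n D = mult (suc n) D ℕ.+ p ≡ D ℕ.+ mult n D

      Jump : Set
      Jump = ∃ λ n → Wraps n A × Wraps n B × Wraps n C ×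
                     mult n A ℕ.+ mult n B ℕ.+ mult n C ≡ 2 ℕ.* p

      private
        step : ∀ n → S n ≡ 2 ℕ.* p →
          (Wraps n A × Wraps n B × Wraps n C) ⊎ ∃ λ w → w ℕ.≤ 2 × S (suc n) ℕ.+ w ℕ.* p ≡ 4 ℕ.* p
        step n Sn with reduced-spec A<p (mult<p A<p n) | reduced-spec B<p (mult<p B<p n)
                     | reduced-spec C<p (mult<p C<p n)
        ... | _ , wA , wA≤1 , eA | _ , wB , wB≤1 , eB | _ , wC , wC≤1 , eC = go wA wB wC wA≤1 wB≤1 wC≤1 eA eB eC
          where
          a′ = mult (suc n) A
          b′ = mult (suc n) B
          c′ = mult (suc n) C
          ar₁ : ∀ a b c x y z p → a ℕ.+ b ℕ.+ c ℕ.+ (x ℕ.+ y ℕ.+ z) ℕ.* p ≡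
                a ℕ.+ x ℕ.* p ℕ.+ (b ℕ.+ y ℕ.* p) ℕ.+ (c ℕ.+ z ℕ.* p)
          ar₁ = ℕSolver.solve-∀
          ar₂ : ∀ a b c x y z → a ℕ.+ x ℕ.+ (b ℕ.+ y) ℕ.+ (c ℕ.+ z) ≡ a ℕ.+ b ℕ.+ c ℕ.+ (x ℕ.+ y ℕ.+ z)
          ar₂ = ℕSolver.solve-∀
          ar₃ : ∀ p → 2 ℕ.* p ℕ.+ 2 ℕ.* p ≡ 4 ℕ.* p
          ar₃ = ℕSolver.solve-∀
          sum : ∀ wA wB wC → a′ ℕ.+ wA ℕ.* p ≡ A ℕ.+ mult n A → b′ ℕ.+ wB ℕ.* p ≡ B ℕ.+ mult n B →
                c′ ℕ.+ wC ℕ.* p ≡ C ℕ.+ mult n C → S (suc n) ℕ.+ (wA ℕ.+ wB ℕ.+ wC) ℕ.* p ≡ 4 ℕ.* p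
          sum wA wB wC eA eB eC = ≡.trans (ar₁ a′ b′ c′ wA wB wC p)
            (≡.trans (cong₂ ℕ._+_ (cong₂ ℕ._+_ eA eB) eC)
              (≡.trans (ar₂ A B C (mult n A) (mult n B) (mult n C))
                (≡.trans (cong₂ ℕ._+_ total Sn) (ar₃ p))))
          one : ∀ {r D m} → r ℕ.+ 1 ℕ.* p ≡ D ℕ.+ m → r ℕ.+ p ≡ D ℕ.+ m
          one {r} e = ≡.trans (cong (r ℕ.+_) (sym (ℕ.*-identityˡ p))) e
          go : ∀ wA wB wC → wA ℕ.≤ 1 → wB ℕ.≤ 1 → wC ℕ.≤ 1 →
            a′ ℕ.+ wA ℕ.* p ≡ A ℕ.+ mult n A → b′ ℕ.+ wB ℕ.* p ≡ B ℕ.+ mult n B →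
            c′ ℕ.+ wC ℕ.* p ≡ C ℕ.+ mult n C →
            (Wraps n A × Wraps n B × Wraps n C) ⊎ ∃ λ w → w ℕ.≤ 2 × S (suc n) ℕ.+ w ℕ.* p ≡ 4 ℕ.* p
          go 0 wB wC lA lB lC eA eB eC = inj₂ (_ , ℕ.+-mono-≤ lB lC , sum 0 wB wC eA eB eC)
          go 1 0 wC lA lB lC eA eB eC = inj₂ (_ , ℕ.+-mono-≤ (ℕ.≤-refl {1}) lC , sum 1 0 wC eA eB eC)
          go 1 1 0 lA lB lC eA eB eC = inj₂ (_ , ℕ.≤-refl , sum 1 1 0 eA eB eC)
          go 1 1 1 lA lB lC eA eB eC = inj₁ (one {D = A} {mult n A} eA , one {D = B} {mult n B} eB , one {D = C} {mult n C} eC)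
          go 1 1 (suc (suc _)) lA lB (s≤s ())
          go 1 (suc (suc _)) _ lA (s≤s ())
          go (suc (suc _)) _ _ (s≤s ())

        S<3p : ∀ n → S n ℕ.< 3 ℕ.* p
        S<3p n = ℕ.<-≤-trans (ℕ.+-mono-< (ℕ.+-mono-< (mult<p A<p n) (mult<p B<p n)) (mult<p C<p n))
          (ℕ.≤-reflexive (ar p))
          where
          ar : ∀ p → p ℕ.+ p ℕ.+ p ≡ 3 ℕ.* p
          ar = ℕSolver.solve-∀

        search : ∀ d n → d ℕ.+ n ≡ p → S n ≡ 2 ℕ.* p → Jump
        search zero    n n≡p Sn = ⊥-elim (impossible (≡.trans (sym Sn) (≡.trans (cong S n≡p)
          (cong₂ ℕ._+_ (cong₂ ℕ._+_ (mult-p A<p) (mult-p B<p)) (mult-p C<p)))))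
          where
          impossible : 2 ℕ.* p ≡ 0 → ⊥
          impossible ()
        search (suc d) n dn≡p Sn with step n Sn
        ... | inj₁ (wA , wB , wC) = n , wA , wB , wC , Sn
        ... | inj₂ (w , w≤2 , e) = search d (suc n) (≡.trans (ℕ.+-suc d n) dn≡p) (exact w w≤2 e)
          where
          -- With at most one wrap the new sum would be at least 3 p; so two wraps, and again the
          -- sum 2 p, are all that remains.
          over : ∀ {w} → w ℕ.≤ 1 → S (suc n) ℕ.+ w ℕ.* p ≡ 4 ℕ.* p → ⊥
          over {w} w≤1 e = ℕ.<⇒≢ (ℕ.<-≤-trans (ℕ.+-mono-<-≤ (S<3p (suc n)) (ℕ.*-monoˡ-≤ p w≤1))
            (ℕ.≤-reflexive (ar p))) e
            where
            ar : ∀ p → 3 ℕ.* p ℕ.+ 1 ℕ.* p ≡ 4 ℕ.* p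
            ar = ℕSolver.solve-∀
          exact : ∀ w → w ℕ.≤ 2 → S (suc n) ℕ.+ w ℕ.* p ≡ 4 ℕ.* p → S (suc n) ≡ 2 ℕ.* p
          exact 0 _ e = ⊥-elim (over z≤n e)
          exact 1 _ e = ⊥-elim (over ℕ.≤-refl e)
          exact 2 _ e = ℕ.+-cancelʳ-≡ (2 ℕ.* p) _ _ (≡.trans e (ar p))
            where
            ar : ∀ p → 4 ℕ.* p ≡ 2 ℕ.* p ℕ.+ 2 ℕ.* p
            ar = ℕSolver.solve-∀
          exact (suc (suc (suc _))) (s≤s (s≤s ())) e

      jump : Jump
      jump = search p-1 1 (ℕ.+-comm p-1 1)
        (≡.trans (cong₂ ℕ._+_ (cong₂ ℕ._+_ (first A<p) (first B<p)) (first C<p)) total)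
        where
        first : ∀ {D} → D ℕ.< p → mult 1 D ≡ D
        first {D} D<p = below-p (mult<p D<p 1) D<p (≈-trans (mult-≈ D<p 1) (≡⇒≈ (ℤ.*-identityˡ (+ D))))

  module Mixed (p-1 : ℕ) (pr : Prime (suc p-1)) where
    open Residues p-1
    open Blocks p-1
    open LineBlocks p-1 pr
    open Cores p-1 pr
    open Arrangements p-1 pr
    open Balancing p-1

    -- Write α', β', γ' for the successors. The caterpillar gets p - 1 - a leaves at s₁, where a is
    -- the residue of n α', and likewise for the others; this puts a₁ at - n γ' and a₃ at n α'. As
    -- all three residues wrap around, the leaves left over are the residues of (n + 1) α', (n + 1)
    -- β', (n + 1) γ', and with a₂ = 0 the relation of the further line becomes the identity - (n +
    -- 1) α' n γ' + (n + 1) γ' n α' = 0.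
    core-mixed : ∀ α β γ → suc α ℕ.< p → suc β ℕ.< p → suc γ ℕ.< p →
      suc α ℕ.+ suc β ℕ.+ suc γ ≡ 2 ℕ.* p → Core 1 α β γ
    core-mixed α β γ α<p β<p γ<p total with jump α<p β<p γ<p total
    ... | n , wA , wB , wC , Sn =
      core (line (exchange-at a′ b′ c′ sum′ relation)) refl refl
        (split α wA (left a<p)) (split β wB (left b<p)) (split γ wC (left c<p))
      where
      a = mult n (suc α)
      b = mult n (suc β)
      c = mult n (suc γ)
      a′ = mult (suc n) (suc α)
      b′ = mult (suc n) (suc β)
      c′ = mult (suc n) (suc γ)
      a<p = mult<p α<p n
      b<p = mult<p β<p n
      c<p = mult<p γ<p n
      rest : ℕ → ℕ
      rest d = p ℕ.∸ suc d
      left : ∀ {d} → d ℕ.< p → rest d ℕ.+ suc d ≡ p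
      left d<p = ℕ.m∸n+n≡m d<p
      split : ∀ δ {d d′ r} → d′ ℕ.+ p ≡ suc δ ℕ.+ d → r ℕ.+ suc d ≡ p → r ℕ.+ d′ ≡ δ
      split δ {d} {d′} {r} w e = ℕ.suc-injective (ℕ.+-cancelʳ-≡ d _ _
        (≡.trans (ar d′ r d) (≡.trans (cong (d′ ℕ.+_) e) w)))
        where
        ar : ∀ d′ r d → suc (r ℕ.+ d′) ℕ.+ d ≡ d′ ℕ.+ (r ℕ.+ suc d)
        ar = ℕSolver.solve-∀
      special : rest a ℕ.+ rest b ℕ.+ rest c ℕ.+ 3 ≡ p
      special = ℕ.+-cancelʳ-≡ (2 ℕ.* p) _ _ (≡.trans (cong (rest a ℕ.+ rest b ℕ.+ rest c ℕ.+ 3 ℕ.+_) (sym Sn))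
        (≡.trans (ar₁ (rest a) (rest b) (rest c) a b c)
          (≡.trans (cong₂ ℕ._+_ (cong₂ ℕ._+_ (left a<p) (left b<p)) (left c<p)) (ar₂ p))))
        where
        ar₁ : ∀ x y z a b c → x ℕ.+ y ℕ.+ z ℕ.+ 3 ℕ.+ (a ℕ.+ b ℕ.+ c) ≡ x ℕ.+ suc a ℕ.+ (y ℕ.+ suc b) ℕ.+ (z ℕ.+ suc c)
        ar₁ = ℕSolver.solve-∀
        ar₂ : ∀ p → p ℕ.+ p ℕ.+ p ≡ p ℕ.+ 2 ℕ.* p
        ar₂ = ℕSolver.solve-∀
      open Caterpillar (rest a) (rest b) (rest c) special hiding (c)
      sum′ : a′ ℕ.+ b′ ℕ.+ c′ ≡ p
      sum′ = ℕ.+-cancelʳ-≡ (p ℕ.+ p ℕ.+ p) _ _ (≡.trans (ar₁ a′ b′ c′ p)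
        (≡.trans (cong₂ ℕ._+_ (cong₂ ℕ._+_ wA wB) wC) (≡.trans (ar₂ (suc α) (suc β) (suc γ) a b c)
          (≡.trans (cong₂ ℕ._+_ total Sn) (ar₃ p)))))
        where
        ar₁ : ∀ a b c p → a ℕ.+ b ℕ.+ c ℕ.+ (p ℕ.+ p ℕ.+ p) ≡ a ℕ.+ p ℕ.+ (b ℕ.+ p) ℕ.+ (c ℕ.+ p)
        ar₁ = ℕSolver.solve-∀
        ar₂ : ∀ a b c x y z → a ℕ.+ x ℕ.+ (b ℕ.+ y) ℕ.+ (c ℕ.+ z) ≡ a ℕ.+ b ℕ.+ c ℕ.+ (x ℕ.+ y ℕ.+ z)
        ar₂ = ℕSolver.solve-∀
        ar₃ : ∀ p → 2 ℕ.* p ℕ.+ 2 ℕ.* p ≡ p ℕ.+ (p ℕ.+ p ℕ.+ p)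
        ar₃ = ℕSolver.solve-∀
      n₁≈ : + n₁ ≈ - (+ n * + suc γ)
      n₁≈ = shift (+-cong (≈-trans (≡⇒≈ (cong +_ (≡.trans (sym (ℕ.+-suc (rest c) c)) (left c<p)))) p≈0)
          (≈-sym (mult-≈ γ<p n)))
        (id₁ (+ n₁) (+ c) (+ n * + suc γ))
        where
        id₁ : ∀ n c m → n - - m ≡ n + c + m - (0ℤ + c)
        id₁ = solve-∀
      n₃≡ : n₃ ≡ a
      n₃≡ = ℕ.+-cancelʳ-≡ (rest a ℕ.+ 1) _ _ (≡.trans (ar₁ (rest a) (rest b) (rest c))
        (≡.trans special (≡.trans (sym (left a<p)) (ar₂ (rest a) a))))
        where
        ar₁ : ∀ x y z → suc (suc (z ℕ.+ y)) ℕ.+ (x ℕ.+ 1) ≡ x ℕ.+ y ℕ.+ z ℕ.+ 3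
        ar₁ = ℕSolver.solve-∀
        ar₂ : ∀ x a → x ℕ.+ suc a ≡ a ℕ.+ (x ℕ.+ 1)
        ar₂ = ℕSolver.solve-∀
      relation : + a′ * + n₁ + + b′ * 0ℤ + + c′ * + n₃ ≈ 0ℤ
      relation = ≈-trans
        (+-cong (+-cong (*-cong (mult-≈ α<p (suc n)) n₁≈) (≈-refl {+ b′ * 0ℤ}))
          (*-cong (mult-≈ γ<p (suc n)) (≈-trans (≡⇒≈ (cong +_ n₃≡)) (mult-≈ α<p n))))
        (≡⇒≈ (id₁ (+ n) (+ suc α) (+ suc γ) (+ b′)))
        where
        id₁ : ∀ n a c b → (1ℤ + n) * a * - (n * c) + b * 0ℤ + (1ℤ + n) * c * (n * a) ≡ 0ℤ
        id₁ = solve-∀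

  -- Reversal, and sufficiency by cases on the residues.

  reverse : ∀ p-1 {k x y z} → Rainbow (suc p-1) k x y z → Rainbow (suc p-1) k z y x
  reverse p-1 {k} {x} {y} {z} (f , (f-injective , f-surjective) , label-injective) =
      f ∘ σ , ((λ {v} {w} e → σ-injective v w (f-injective e)) , surjective) ,
      (λ {d} {e} eq → τ-injective d e
        (label-injective (≡.trans (sym (labels d)) (≡.trans eq (labels e)))))
    where
    open Residues p-1
    σ : ∀ {x y z} → Vertex z y x → Vertex x y z
    σ (inj₁ Fin.zero)                     = s₃
    σ (inj₁ (Fin.suc Fin.zero))           = s₂
    σ (inj₁ (Fin.suc (Fin.suc Fin.zero))) = s₁
    σ (inj₂ (inj₁ i))                     = inj₂ (inj₂ (inj₂ i))
    σ (inj₂ (inj₂ (inj₁ i)))              = inj₂ (inj₂ (inj₁ i))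
    σ (inj₂ (inj₂ (inj₂ i)))              = inj₂ (inj₁ i)
    σ-involutive : ∀ {x y z} (v : Vertex x y z) → σ (σ v) ≡ v
    σ-involutive (inj₁ Fin.zero)                     = refl
    σ-involutive (inj₁ (Fin.suc Fin.zero))           = refl
    σ-involutive (inj₁ (Fin.suc (Fin.suc Fin.zero))) = refl
    σ-involutive (inj₂ (inj₁ i))                     = refl
    σ-involutive (inj₂ (inj₂ (inj₁ i)))              = refl
    σ-involutive (inj₂ (inj₂ (inj₂ i)))              = refl
    σ-injective : ∀ v w → σ v ≡ σ w → v ≡ w
    σ-injective v w e = ≡.trans (sym (σ-involutive v)) (≡.trans (cong σ e) (σ-involutive w))
    τ : ∀ {x y z} → Edge z y x → Edge x y z
    τ (inj₁ Fin.zero)           = inj₁ (Fin.suc Fin.zero)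
    τ (inj₁ (Fin.suc Fin.zero)) = inj₁ Fin.zero
    τ (inj₂ (inj₁ i))           = inj₂ (inj₂ (inj₂ i))
    τ (inj₂ (inj₂ (inj₁ i)))    = inj₂ (inj₂ (inj₁ i))
    τ (inj₂ (inj₂ (inj₂ i)))    = inj₂ (inj₁ i)
    τ-involutive : ∀ {x y z} (e : Edge x y z) → τ (τ e) ≡ e
    τ-involutive (inj₁ Fin.zero)           = refl
    τ-involutive (inj₁ (Fin.suc Fin.zero)) = refl
    τ-involutive (inj₂ (inj₁ i))           = refl
    τ-involutive (inj₂ (inj₂ (inj₁ i)))    = refl
    τ-involutive (inj₂ (inj₂ (inj₂ i)))    = refl
    τ-injective : ∀ d e → τ d ≡ τ e → d ≡ e
    τ-injective d e eq = ≡.trans (sym (τ-involutive d)) (≡.trans (cong τ eq) (τ-involutive e))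
    labels : ∀ e → edgeLabel {p} {k} {z} {y} {x} (f ∘ σ) e ≡ edgeLabel {p} {k} {x} {y} {z} f (τ e)
    labels (inj₁ Fin.zero)           = ⊕-comm (f s₃) (f s₂)
    labels (inj₁ (Fin.suc Fin.zero)) = ⊕-comm (f s₂) (f s₁)
    labels (inj₂ (inj₁ i))           = refl
    labels (inj₂ (inj₂ (inj₁ i)))    = refl
    labels (inj₂ (inj₂ (inj₂ i)))    = refl
    surjective : ∀ u → ∃ λ v → ∀ {w} → w ≡ v → f (σ w) ≡ u
    surjective u = σ (proj₁ (f-surjective u)) ,
      λ { refl → proj₂ (f-surjective u) (σ-involutive (proj₁ (f-surjective u))) }

  module Construction (p-2 : ℕ) (pr : Prime (suc (suc p-2))) (5≤p : 5 ℕ.≤ suc (suc p-2)) (k : ℕ) where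

    private
      p-1 : ℕ
      p-1 = suc p-2

    open Residues p-1
    open Blocks p-1
    open Cores p-1 pr
    open Arrangements p-1 pr
    open Mixed p-1 pr

    proper-divisor : ∀ d → 1 ℕ.< d → d ℕ.< p → ¬ d Div.∣ p
    proper-divisor d 1<d d<p d∣p with prime⇒irreducible pr d∣p
    ... | inj₁ d≡1 = ℕ.<⇒≢ 1<d (sym d≡1)
    ... | inj₂ d≡p = ℕ.<⇒≢ d<p d≡p

    half : ∃ λ h → 1 ℕ.+ 2 ℕ.* suc (suc h) ≡ p
    half = go (p ℕ./ 2) (p ℕ.% 2) (ℕ.m%n<n p 2) (ℕ.m≡m%n+[m/n]*n p 2)
      where
      go : ∀ q r → r ℕ.< 2 → p ≡ r ℕ.+ q ℕ.* 2 → ∃ λ h → 1 ℕ.+ 2 ℕ.* suc (suc h) ≡ p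
      go q zero _ e = ⊥-elim (proper-divisor 2 ℕ.≤-refl (ℕ.≤-trans (s≤s (s≤s (s≤s z≤n))) 5≤p) (Div.divides q e))
      go 0 1 _ e = ⊥-elim (ℕ.<⇒≱ (ℕ.≤-reflexive (cong suc e)) (ℕ.≤-trans (s≤s (s≤s z≤n)) 5≤p))
      go 1 1 _ e = ⊥-elim (ℕ.<⇒≱ (ℕ.≤-reflexive (cong suc e)) (ℕ.≤-trans (s≤s (s≤s (s≤s (s≤s z≤n)))) 5≤p))
      go (suc (suc h)) 1 _ e = h , ≡.trans (cong suc (ℕ.*-comm 2 (suc (suc h)))) (sym e)
      go q (suc (suc _)) (s≤s (s≤s ())) e

    h′ h : ℕ
    h′ = proj₁ half
    h = suc (suc h′)

    odd : 1 ℕ.+ 2 ℕ.* h ≡ p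
    odd = proj₂ half

    module _ {x y z : ℕ} (size : x ℕ.+ y ℕ.+ z ℕ.+ 3 ≡ p ℕ.^ suc k) where

      -- The residue 0 of x hides two situations: no leaf of s₁ at all, which needs `DoubleStar`, or
      -- at least `p` of them, which `core-half` spreads over its three lines.
      star : ∀ β γ q₁ q₂ q₃ → suc β ≡ p → suc (suc γ) ≡ p →
        q₁ ℕ.* p ≡ x → β ℕ.+ q₂ ℕ.* p ≡ y → γ ℕ.+ q₃ ℕ.* p ≡ z → Rainbow p (suc k) x y z
      star β γ zero q₂ q₃ refl refl refl refl refl = DoubleStar.rainbow p-2 pr k q₂ q₃
          (ℕ.*-cancelˡ-≡ _ _ p (≡.trans (ar p-2 q₂ q₃) size)) (sym size)
        where
        ar : ∀ t q₂ q₃ → (2 ℕ.+ t) ℕ.* (2 ℕ.+ (q₂ ℕ.+ q₃)) ≡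
             1 ℕ.+ t ℕ.+ q₂ ℕ.* (2 ℕ.+ t) ℕ.+ (t ℕ.+ q₃ ℕ.* (2 ℕ.+ t)) ℕ.+ 3
        ar = ℕSolver.solve-∀
      star β γ (suc q₁) q₂ q₃ eβ eγ ex ey ez = core⇒rainbow (core-half h′ odd) total q₁ q₂ q₃ ex
          (≡.trans (cong (ℕ._+ q₂ ℕ.* p) β≡) ey) (≡.trans (cong (ℕ._+ q₃ ℕ.* p) γ≡) ez) size
        where
        β≡ : 2 ℕ.* h ≡ β
        β≡ = ℕ.suc-injective (≡.trans odd (sym eβ))
        ar₁ : ∀ h → suc (suc (2 ℕ.* suc h ℕ.+ 1)) ≡ 1 ℕ.+ 2 ℕ.* suc (suc h)
        ar₁ = ℕSolver.solve-∀
        γ≡ : 2 ℕ.* suc h′ ℕ.+ 1 ≡ γ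
        γ≡ = ℕ.suc-injective (ℕ.suc-injective (≡.trans (ar₁ h′) (≡.trans odd (sym eγ))))
        ar₂ : ∀ h → 1 ℕ.+ 2 ℕ.* suc (suc h) ℕ.+ 2 ℕ.* suc (suc h) ℕ.+ (2 ℕ.* suc h ℕ.+ 1) ℕ.+ 3 ≡
              3 ℕ.* (1 ℕ.+ 2 ℕ.* suc (suc h))
        ar₂ = ℕSolver.solve-∀
        total : p ℕ.+ 2 ℕ.* h ℕ.+ (2 ℕ.* suc h′ ℕ.+ 1) ℕ.+ 3 ≡ 3 ℕ.* p
        total = subst (λ t → t ℕ.+ 2 ℕ.* h ℕ.+ (2 ℕ.* suc h′ ℕ.+ 1) ℕ.+ 3 ≡ 3 ℕ.* t) odd (ar₂ h′)

      -- For β at most 1 `Paths` does not apply; there the hypotheses supply at least `p` leaves of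
      -- s₂ for `Tight`. From β = 2 on, `Paths` manages with one further line.
      side : ∀ α β γ q₁ q₂ q₃ → suc α ≡ p → suc β ℕ.+ suc γ ≡ p → γ ≢ 0 →
        (β ≡ 0 → q₂ ≢ 0) → (β ≡ 1 → q₂ ≢ 0) →
        α ℕ.+ q₁ ℕ.* p ≡ x → β ℕ.+ q₂ ℕ.* p ≡ y → γ ℕ.+ q₃ ℕ.* p ≡ z → Rainbow p (suc k) x y z
      side α zero γ q₁ zero q₃ eα eβγ γ≢0 β0 β1 ex ey ez = ⊥-elim (β0 refl refl)
      side α (suc zero) γ q₁ zero q₃ eα eβγ γ≢0 β0 β1 ex ey ez = ⊥-elim (β1 refl refl)
      side α zero zero q₁ (suc q₂) q₃ eα eβγ γ≢0 β0 β1 ex ey ez = ⊥-elim (γ≢0 refl)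
      side α zero (suc zero) q₁ (suc q₂) q₃ eα eβγ γ≢0 β0 β1 ex ey ez =
        ⊥-elim (ℕ.<⇒≱ (ℕ.≤-reflexive (cong suc (sym eβγ))) (ℕ.≤-trans (s≤s (s≤s (s≤s (s≤s z≤n)))) 5≤p))
      side α zero (suc (suc γ)) q₁ (suc q₂) q₃ eα eβγ γ≢0 β0 β1 ex ey ez =
        core⇒rainbow (Tight.core γ 1 h size₁ odd) total q₁ q₂ q₃
          (≡.trans (cong (ℕ._+ q₁ ℕ.* p) α≡) ex) (≡.trans (cong (ℕ._+ q₂ ℕ.* p) odd) ey)
          (≡.trans (cong (ℕ._+ q₃ ℕ.* p) (ℕ.+-comm γ 2)) ez) size
        where
        ar₁ : ∀ γ → 3 ℕ.+ γ ℕ.+ 1 ≡ 1 ℕ.+ suc (suc (suc γ))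
        ar₁ = ℕSolver.solve-∀
        size₁ : 3 ℕ.+ γ ℕ.+ 1 ≡ p
        size₁ = ≡.trans (ar₁ γ) eβγ
        α≡ : 2 ℕ.* h ≡ α
        α≡ = ℕ.suc-injective (≡.trans odd (sym eα))
        ar₂ : ∀ h γ → 2 ℕ.* h ℕ.+ (1 ℕ.+ 2 ℕ.* h) ℕ.+ (γ ℕ.+ 2) ℕ.+ 3 ≡
              1 ℕ.+ 2 ℕ.* h ℕ.+ (1 ℕ.+ 2 ℕ.* h) ℕ.+ (3 ℕ.+ γ ℕ.+ 1)
        ar₂ = ℕSolver.solve-∀
        ar₃ : ∀ p → p ℕ.+ p ℕ.+ p ≡ 3 ℕ.* p
        ar₃ = ℕSolver.solve-∀
        total : 2 ℕ.* h ℕ.+ (1 ℕ.+ 2 ℕ.* h) ℕ.+ (γ ℕ.+ 2) ℕ.+ 3 ≡ 3 ℕ.* p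
        total = ≡.trans (ar₂ h γ) (≡.trans (cong₂ ℕ._+_ (cong₂ ℕ._+_ odd odd) size₁) (ar₃ p))
      side α (suc zero) zero q₁ (suc q₂) q₃ eα eβγ γ≢0 β0 β1 ex ey ez = ⊥-elim (γ≢0 refl)
      side α (suc zero) (suc zero) q₁ (suc q₂) q₃ eα eβγ γ≢0 β0 β1 ex ey ez =
        ⊥-elim (ℕ.<⇒≱ (ℕ.≤-reflexive (cong suc (sym eβγ))) 5≤p)
      side α (suc zero) (suc (suc γ)) q₁ (suc q₂) q₃ eα eβγ γ≢0 β0 β1 ex ey ez =
        core⇒rainbow (Tight.core γ 2 h size₁ odd) total q₁ q₂ q₃
          (≡.trans (cong (ℕ._+ q₁ ℕ.* p) α≡) ex)
          (≡.trans (cong (λ t → suc (t ℕ.+ q₂ ℕ.* p)) odd) ey)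
          (≡.trans (cong (ℕ._+ q₃ ℕ.* p) (ℕ.+-comm γ 2)) ez) size
        where
        ar₁ : ∀ γ → 3 ℕ.+ γ ℕ.+ 2 ≡ 2 ℕ.+ suc (suc (suc γ))
        ar₁ = ℕSolver.solve-∀
        size₁ : 3 ℕ.+ γ ℕ.+ 2 ≡ p
        size₁ = ≡.trans (ar₁ γ) eβγ
        α≡ : 2 ℕ.* h ≡ α
        α≡ = ℕ.suc-injective (≡.trans odd (sym eα))
        ar₂ : ∀ h γ → 2 ℕ.* h ℕ.+ (2 ℕ.+ 2 ℕ.* h) ℕ.+ (γ ℕ.+ 2) ℕ.+ 3 ≡
              1 ℕ.+ 2 ℕ.* h ℕ.+ (1 ℕ.+ 2 ℕ.* h) ℕ.+ (3 ℕ.+ γ ℕ.+ 2)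
        ar₂ = ℕSolver.solve-∀
        ar₃ : ∀ p → p ℕ.+ p ℕ.+ p ≡ 3 ℕ.* p
        ar₃ = ℕSolver.solve-∀
        total : 2 ℕ.* h ℕ.+ (2 ℕ.+ 2 ℕ.* h) ℕ.+ (γ ℕ.+ 2) ℕ.+ 3 ≡ 3 ℕ.* p
        total = ≡.trans (ar₂ h γ) (≡.trans (cong₂ ℕ._+_ (cong₂ ℕ._+_ odd odd) size₁) (ar₃ p))
      side α (suc (suc β)) zero q₁ q₂ q₃ eα eβγ γ≢0 β0 β1 ex ey ez = ⊥-elim (γ≢0 refl)
      side α β@(suc (suc β′)) γ@(suc γ′) q₁ q₂ q₃ eα eβγ γ≢0 β0 β1 ex ey ez =
        go (p ℕ./ B) (p ℕ.% B) (ℕ.m%n<n p B) (ℕ.m≡m%n+[m/n]*n p B)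
        where
        B = suc β
        B<p : B ℕ.< p
        B<p = subst (B ℕ.<_) eβγ (ℕ.m<m+n B (s≤s z≤n))
        finish : Core 1 α β γ → Rainbow p (suc k) x y z
        finish K = core⇒rainbow K total q₁ q₂ q₃ ex ey ez size
          where
          ar : ∀ a b c → a ℕ.+ b ℕ.+ c ℕ.+ 3 ≡ suc a ℕ.+ (suc b ℕ.+ suc c)
          ar = ℕSolver.solve-∀
          ar₂ : ∀ p → p ℕ.+ p ≡ 2 ℕ.* p
          ar₂ = ℕSolver.solve-∀
          total : α ℕ.+ β ℕ.+ γ ℕ.+ 3 ≡ 2 ℕ.* p
          total = ≡.trans (ar α β γ) (≡.trans (cong₂ ℕ._+_ eα eβγ) (ar₂ p))
        build : ∀ ε r q f → B ≡ 2 ℕ.+ ε ℕ.+ r ℕ.+ f ℕ.* suc (q ℕ.+ r) →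
          p ≡ suc ε ℕ.+ suc (q ℕ.+ r) ℕ.* B → Rainbow p (suc k) x y z
        build ε r q f eB ep = room _ refl
          where
          s = suc (q ℕ.+ r)
          size₁ : s ℕ.* (2 ℕ.+ ε ℕ.+ r ℕ.+ f ℕ.* s) ℕ.+ suc ε ≡ p
          size₁ = ≡.trans (ℕ.+-comm _ (suc ε)) (sym (≡.trans ep (cong (λ t → suc ε ℕ.+ s ℕ.* t) eB)))
          room : ∀ e → s ℕ.* (ε ℕ.+ r) ℕ.+ ε ℕ.+ f ℕ.* s ℕ.* (q ℕ.+ r) ≡ e → Rainbow p (suc k) x y z
          -- `Paths` needs the gap to be positive. It could vanish only for β + 1 = 2, or for s = 1
          -- and p = β + 2, which means γ = 0.
          room zero e0 = ⊥-elim (degenerate ε≡0 r≡0 f q fs≡0 eB ep)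
            where
            ε≡0 : ε ≡ 0
            ε≡0 = ℕ.m+n≡0⇒n≡0 (s ℕ.* (ε ℕ.+ r)) (ℕ.m+n≡0⇒m≡0 _ e0)
            r≡0 : r ≡ 0
            r≡0 = ℕ.m+n≡0⇒n≡0 ε (ℕ.m+n≡0⇒m≡0 (ε ℕ.+ r) (ℕ.m+n≡0⇒m≡0 (s ℕ.* (ε ℕ.+ r)) (ℕ.m+n≡0⇒m≡0 _ e0)))
            fs≡0 : f ℕ.* s ℕ.* (q ℕ.+ r) ≡ 0
            fs≡0 = ℕ.m+n≡0⇒n≡0 (s ℕ.* (ε ℕ.+ r) ℕ.+ ε) e0
            degenerate : ∀ {ε r} → ε ≡ 0 → r ≡ 0 → ∀ f q → f ℕ.* suc (q ℕ.+ r) ℕ.* (q ℕ.+ r) ≡ 0 →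
              B ≡ 2 ℕ.+ ε ℕ.+ r ℕ.+ f ℕ.* suc (q ℕ.+ r) → p ≡ suc ε ℕ.+ suc (q ℕ.+ r) ℕ.* B → ⊥
            degenerate refl refl zero    q       _ eB ep = case eB of λ ()
            degenerate refl refl (suc f) zero    _ eB ep = case ≡.trans γ≡0 refl of λ ()
              where
              γ≡0 : suc γ′ ≡ 0
              γ≡0 = ℕ.+-cancelˡ-≡ (suc B) _ _ (≡.trans (sym (ℕ.+-suc B γ)) (≡.trans eβγ
                (≡.trans ep (≡.trans (cong suc (ℕ.+-identityʳ B)) (sym (ℕ.+-identityʳ (suc B)))))))
            degenerate refl refl (suc f) (suc q) () eB ep
          room (suc g) gap = finish (Paths.core ε r q f g size₁ (sym gap) eA eB′ eC)
            where
            b = ε ℕ.+ r ℕ.+ f ℕ.* (q ℕ.+ r)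
            ar₁ : ∀ g ε q r f → suc (g ℕ.+ r ℕ.+ f ℕ.* (q ℕ.+ r) ℕ.+ (3 ℕ.+ 2 ℕ.* q ℕ.+ r ℕ.+ f)) ≡
                  suc g ℕ.+ (r ℕ.+ f ℕ.* (q ℕ.+ r) ℕ.+ (3 ℕ.+ 2 ℕ.* q ℕ.+ r ℕ.+ f))
            ar₁ = ℕSolver.solve-∀
            ar₂ : ∀ ε q r f → suc (q ℕ.+ r) ℕ.* (ε ℕ.+ r) ℕ.+ ε ℕ.+ f ℕ.* suc (q ℕ.+ r) ℕ.* (q ℕ.+ r) ℕ.+
                  (r ℕ.+ f ℕ.* (q ℕ.+ r) ℕ.+ (3 ℕ.+ 2 ℕ.* q ℕ.+ r ℕ.+ f)) ≡
                  suc (q ℕ.+ r) ℕ.* (2 ℕ.+ ε ℕ.+ r ℕ.+ f ℕ.* suc (q ℕ.+ r)) ℕ.+ suc ε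
            ar₂ = ℕSolver.solve-∀
            eA : g ℕ.+ r ℕ.+ f ℕ.* (q ℕ.+ r) ℕ.+ (3 ℕ.+ 2 ℕ.* q ℕ.+ r ℕ.+ f) ≡ α
            eA = ℕ.suc-injective (≡.trans (ar₁ g ε q r f) (≡.trans
              (cong (ℕ._+ (r ℕ.+ f ℕ.* (q ℕ.+ r) ℕ.+ (3 ℕ.+ 2 ℕ.* q ℕ.+ r ℕ.+ f))) (sym gap))
              (≡.trans (ar₂ ε q r f) (≡.trans size₁ (sym eα)))))
            ar₃ : ∀ ε q r f → suc (1 ℕ.+ f ℕ.+ (ε ℕ.+ r ℕ.+ f ℕ.* (q ℕ.+ r))) ≡
                  2 ℕ.+ ε ℕ.+ r ℕ.+ f ℕ.* suc (q ℕ.+ r)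
            ar₃ = ℕSolver.solve-∀
            eB′ : 1 ℕ.+ f ℕ.+ b ≡ β
            eB′ = ℕ.suc-injective (≡.trans (ar₃ ε q r f) (sym eB))
            ar₄ : ∀ ε q r f → 2 ℕ.+ ε ℕ.+ r ℕ.+ f ℕ.* suc (q ℕ.+ r) ℕ.+
                  suc (q ℕ.+ r ℕ.+ q ℕ.+ suc (q ℕ.+ r) ℕ.* (ε ℕ.+ r ℕ.+ f ℕ.* (q ℕ.+ r))) ≡
                  suc (q ℕ.+ r) ℕ.* (2 ℕ.+ ε ℕ.+ r ℕ.+ f ℕ.* suc (q ℕ.+ r)) ℕ.+ suc ε
            ar₄ = ℕSolver.solve-∀
            eC : q ℕ.+ r ℕ.+ q ℕ.+ s ℕ.* b ≡ γ
            eC = ℕ.suc-injective (ℕ.+-cancelˡ-≡ B _ _ (≡.trans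
              (cong (ℕ._+ suc (q ℕ.+ r ℕ.+ q ℕ.+ s ℕ.* b)) eB)
              (≡.trans (ar₄ ε q r f) (≡.trans size₁ (sym eβγ)))))
        go : ∀ s ε → ε ℕ.< B → p ≡ ε ℕ.+ s ℕ.* B → Rainbow p (suc k) x y z
        go s zero _ ep = ⊥-elim (proper-divisor B (s≤s (s≤s z≤n)) B<p (Div.divides s ep))
        go zero (suc ε) ε<B ep =
          ⊥-elim (ℕ.<⇒≱ (ℕ.<-trans ε<B B<p) (ℕ.≤-reflexive (≡.trans ep (ℕ.+-identityʳ (suc ε)))))
        -- Two divisions yield the parameters. The quotient of `p` by β + 1 is the jump length, and
        -- its remainder `suc ε` is positive because `p` is prime. Dividing what β exceeds this
        -- remainder by the jump length then gives `f` and `r`.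
        go (suc s) (suc ε) ε<B ep = build ε r q f eB
            (≡.trans ep (cong (λ t → suc ε ℕ.+ t ℕ.* B) (cong suc (sym q+r))))
          where
          Δ = β ℕ.∸ suc ε
          f = Δ ℕ./ suc s
          r = Δ ℕ.% suc s
          q = s ℕ.∸ r
          q+r : q ℕ.+ r ≡ s
          q+r = ℕ.m∸n+n≡m (ℕ.s≤s⁻¹ (ℕ.m%n<n Δ (suc s)))
          ar : ∀ ε r t → suc (r ℕ.+ t ℕ.+ suc ε) ≡ 2 ℕ.+ ε ℕ.+ r ℕ.+ t
          ar = ℕSolver.solve-∀
          eB : B ≡ 2 ℕ.+ ε ℕ.+ r ℕ.+ f ℕ.* suc (q ℕ.+ r)
          eB = ≡.trans (cong suc (≡.trans (sym (ℕ.m∸n+n≡m (ℕ.s≤s⁻¹ ε<B)))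
              (cong (ℕ._+ suc ε) (ℕ.m≡m%n+[m/n]*n Δ (suc s)))))
            (≡.trans (ar ε r (f ℕ.* suc s)) (cong (λ t → 2 ℕ.+ ε ℕ.+ r ℕ.+ f ℕ.* suc t) (sym q+r)))

      middle : ∀ α β γ q₁ q₂ q₃ → suc β ≡ p → suc (suc α) ℕ.+ suc (suc γ) ≡ p →
        suc α ℕ.+ q₁ ℕ.* p ≡ x → β ℕ.+ q₂ ℕ.* p ≡ y → suc γ ℕ.+ q₃ ℕ.* p ≡ z → Rainbow p (suc k) x y z
      middle α β γ q₁ q₂ q₃ eβ eαγ ex ey ez = core⇒rainbow (core-balanced α γ size₁) total q₁ q₂ q₃ ex
          (≡.trans (cong (ℕ._+ q₂ ℕ.* p) β≡) ey) ez size
        where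
        ar₁ : ∀ α γ → suc α ℕ.+ suc γ ℕ.+ 2 ≡ suc (suc α) ℕ.+ suc (suc γ)
        ar₁ = ℕSolver.solve-∀
        size₁ : suc α ℕ.+ suc γ ℕ.+ 2 ≡ p
        size₁ = ≡.trans (ar₁ α γ) eαγ
        ar₂ : ∀ α γ → suc (suc α ℕ.+ suc γ ℕ.+ 1) ≡ suc (suc α) ℕ.+ suc (suc γ)
        ar₂ = ℕSolver.solve-∀
        β≡ : suc α ℕ.+ suc γ ℕ.+ 1 ≡ β
        β≡ = ℕ.suc-injective (≡.trans (ar₂ α γ) (≡.trans eαγ (sym eβ)))
        ar₃ : ∀ α γ → suc α ℕ.+ (suc α ℕ.+ suc γ ℕ.+ 1) ℕ.+ suc γ ℕ.+ 3 ≡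
              2 ℕ.* (suc (suc α) ℕ.+ suc (suc γ))
        ar₃ = ℕSolver.solve-∀
        total : suc α ℕ.+ (suc α ℕ.+ suc γ ℕ.+ 1) ℕ.+ suc γ ℕ.+ 3 ≡ 2 ℕ.* p
        total = ≡.trans (ar₃ α γ) (cong (2 ℕ.*_) eαγ)

    Exceptional : ℕ → ℕ → ℕ → ℕ → Set
    Exceptional y α β γ =
        (β ≡ p ℕ.∸ 2 × ((α ≡ 0 × γ ≡ p ℕ.∸ 1) ⊎ (α ≡ p ℕ.∸ 1 × γ ≡ 0)))
      ⊎ (y ≡ 0 × ((α ≡ p ℕ.∸ 1 × γ ≡ p ℕ.∸ 2) ⊎ (α ≡ p ℕ.∸ 2 × γ ≡ p ℕ.∸ 1)))
      ⊎ (y ≡ 1 × ((α ≡ p ℕ.∸ 1 × γ ≡ p ℕ.∸ 3) ⊎ (α ≡ p ℕ.∸ 3 × γ ≡ p ℕ.∸ 1)))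

    -- Counting vertices modulo `p` shows that `p` divides (α + 1) + (β + 1) + (γ + 1), a sum of
    -- three numbers from 1 to `p`. So it is p, 2 p or 3 p, and in the last case all residues are p
    -- - 1.
    construct : ∀ {x y z} → x ℕ.+ y ℕ.+ z ℕ.+ 3 ≡ p ℕ.^ suc k → ∀ α β γ q₁ q₂ q₃ →
      α ℕ.< p → β ℕ.< p → γ ℕ.< p →
      α ℕ.+ q₁ ℕ.* p ≡ x → β ℕ.+ q₂ ℕ.* p ≡ y → γ ℕ.+ q₃ ℕ.* p ≡ z →
      ¬ Exceptional y α β γ → Rainbow p (suc k) x y z
    construct {x} {y} {z} size α β γ q₁ q₂ q₃ α<p β<p γ<p ex ey ez fine = split p∣sum
      where
      rev : ∀ x y z → z ℕ.+ y ℕ.+ x ℕ.+ 3 ≡ x ℕ.+ y ℕ.+ z ℕ.+ 3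
      rev = ℕSolver.solve-∀
      size′ : z ℕ.+ y ℕ.+ x ℕ.+ 3 ≡ p ℕ.^ suc k
      size′ = ≡.trans (rev x y z) size
      T = suc α ℕ.+ suc β ℕ.+ suc γ
      ar₁ : ∀ α β γ a b c p → α ℕ.+ a ℕ.* p ℕ.+ (β ℕ.+ b ℕ.* p) ℕ.+ (γ ℕ.+ c ℕ.* p) ℕ.+ 3 ≡
            (a ℕ.+ b ℕ.+ c) ℕ.* p ℕ.+ (suc α ℕ.+ suc β ℕ.+ suc γ)
      ar₁ = ℕSolver.solve-∀
      p∣sum : p Div.∣ T
      p∣sum = Div.∣m+n∣m⇒∣n (subst (p Div.∣_)
          (≡.trans (sym size) (≡.trans (cong₂ (λ s t → s ℕ.+ t ℕ.+ 3) (cong₂ ℕ._+_ (sym ex) (sym ey)) (sym ez))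
            (ar₁ α β γ q₁ q₂ q₃ p)))
          (Div.m∣m*n (p ℕ.^ k)))
        (Div.divides (q₁ ℕ.+ q₂ ℕ.+ q₃) refl)
      ar₂ : ∀ α β γ → α ℕ.+ β ℕ.+ γ ℕ.+ 3 ≡ suc α ℕ.+ suc β ℕ.+ suc γ
      ar₂ = ℕSolver.solve-∀
      ar₃ : ∀ p → p ℕ.+ p ℕ.+ p ≡ 3 ℕ.* p
      ar₃ = ℕSolver.solve-∀
      T≤3p : T ℕ.≤ 3 ℕ.* p
      T≤3p = ℕ.≤-trans (ℕ.+-mono-≤ (ℕ.+-mono-≤ α<p β<p) γ<p) (ℕ.≤-reflexive (ar₃ p))
      finish : ∀ {r} → Core r α β γ → T ≡ suc r ℕ.* p → Rainbow p (suc k) x y z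
      finish K e = core⇒rainbow K (≡.trans (ar₂ α β γ) e) q₁ q₂ q₃ ex ey ez size
      rest₁ : T ≡ 2 ℕ.* p → suc α ≡ p → suc β ℕ.+ suc γ ≡ p
      rest₁ e eα = ℕ.+-cancelˡ-≡ p _ _ (≡.trans (cong (ℕ._+ (suc β ℕ.+ suc γ)) (sym eα))
        (≡.trans (ar (suc α) (suc β) (suc γ)) (≡.trans e (ar′ p))))
        where
        ar : ∀ a b c → a ℕ.+ (b ℕ.+ c) ≡ a ℕ.+ b ℕ.+ c
        ar = ℕSolver.solve-∀
        ar′ : ∀ p → 2 ℕ.* p ≡ p ℕ.+ p
        ar′ = ℕSolver.solve-∀
      rest₂ : T ≡ 2 ℕ.* p → suc β ≡ p → suc α ℕ.+ suc γ ≡ p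
      rest₂ e eβ = ℕ.+-cancelˡ-≡ p _ _ (≡.trans (cong (ℕ._+ (suc α ℕ.+ suc γ)) (sym eβ))
        (≡.trans (ar (suc α) (suc β) (suc γ)) (≡.trans e (ar′ p))))
        where
        ar : ∀ a b c → b ℕ.+ (a ℕ.+ c) ≡ a ℕ.+ b ℕ.+ c
        ar = ℕSolver.solve-∀
        ar′ : ∀ p → 2 ℕ.* p ≡ p ℕ.+ p
        ar′ = ℕSolver.solve-∀
      rest₃ : T ≡ 2 ℕ.* p → suc γ ≡ p → suc β ℕ.+ suc α ≡ p
      rest₃ e eγ = ℕ.+-cancelˡ-≡ p _ _ (≡.trans (cong (ℕ._+ (suc β ℕ.+ suc α)) (sym eγ))
        (≡.trans (ar (suc α) (suc β) (suc γ)) (≡.trans e (ar′ p))))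
        where
        ar : ∀ a b c → c ℕ.+ (b ℕ.+ a) ≡ a ℕ.+ b ℕ.+ c
        ar = ℕSolver.solve-∀
        ar′ : ∀ p → 2 ℕ.* p ≡ p ℕ.+ p
        ar′ = ℕSolver.solve-∀
      minus₂ : ∀ {b} → suc b ℕ.+ 1 ≡ p → b ≡ p ℕ.∸ 2
      minus₂ {b} e = cong (ℕ._∸ 2) (≡.trans (cong suc (ℕ.+-comm 1 b)) e)
      y≡ : ∀ {b} → β ≡ b → q₂ ≡ 0 → y ≡ b
      y≡ eb eq = ≡.trans (sym ey) (≡.trans (cong₂ (λ s t → s ℕ.+ t ℕ.* p) eb eq) (ℕ.+-identityʳ _))
      case-α : T ≡ 2 ℕ.* p → suc α ≡ p → Rainbow p (suc k) x y z
      -- The three hypotheses of `side` correspond one by one to the exceptional cases, as β + γ = p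
      -- - 2 fixes the other residue.
      case-α e eα = side size α β γ q₁ q₂ q₃ eα r
        (λ γ≡0 → fine (inj₁ (minus₂ (≡.trans (cong (λ t → suc β ℕ.+ suc t) (sym γ≡0)) r) ,
          inj₂ (ℕ.suc-injective eα , γ≡0))))
        (λ β≡0 q≡0 → fine (inj₂ (inj₁ (y≡ β≡0 q≡0 , inj₁ (ℕ.suc-injective eα ,
          cong (ℕ._∸ 2) (≡.trans (cong (λ t → suc t ℕ.+ suc γ) (sym β≡0)) r))))))
        (λ β≡1 q≡0 → fine (inj₂ (inj₂ (y≡ β≡1 q≡0 , inj₁ (ℕ.suc-injective eα ,
          cong (ℕ._∸ 3) (≡.trans (cong (λ t → suc t ℕ.+ suc γ) (sym β≡1)) r))))))
        ex ey ez
        where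
        r = rest₁ e eα
      case-γ : T ≡ 2 ℕ.* p → suc γ ≡ p → Rainbow p (suc k) x y z
      case-γ e eγ = reverse p-1 (side size′ γ β α q₃ q₂ q₁ eγ r
        (λ α≡0 → fine (inj₁ (minus₂ (≡.trans (cong (λ t → suc β ℕ.+ suc t) (sym α≡0)) r) ,
          inj₁ (α≡0 , ℕ.suc-injective eγ))))
        (λ β≡0 q≡0 → fine (inj₂ (inj₁ (y≡ β≡0 q≡0 , inj₂ (
          cong (ℕ._∸ 2) (≡.trans (cong (λ t → suc t ℕ.+ suc α) (sym β≡0)) r) , ℕ.suc-injective eγ)))))
        (λ β≡1 q≡0 → fine (inj₂ (inj₂ (y≡ β≡1 q≡0 , inj₂ (
          cong (ℕ._∸ 3) (≡.trans (cong (λ t → suc t ℕ.+ suc α) (sym β≡1)) r) , ℕ.suc-injective eγ)))))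
        ez ey ex)
        where
        r = rest₃ e eγ
      case-β : ∀ α γ → suc β ≡ p → suc α ℕ.+ suc γ ≡ p → α ℕ.+ q₁ ℕ.* p ≡ x → γ ℕ.+ q₃ ℕ.* p ≡ z →
               Rainbow p (suc k) x y z
      case-β zero    γ       eβ r ex ez = star size β γ q₁ q₂ q₃ eβ r ex ey ez
      case-β (suc α) zero    eβ r ex ez = reverse p-1
        (star size′ β (suc α) q₃ q₂ q₁ eβ (≡.trans (ℕ.+-comm 1 (suc (suc α))) r) ez ey ex)
      case-β (suc α) (suc γ) eβ r ex ez = middle size α β γ q₁ q₂ q₃ eβ r ex ey ez
      two : T ≡ 2 ℕ.* p → Rainbow p (suc k) x y z
      two e with ℕ.m≤n⇒m<n∨m≡n α<p | ℕ.m≤n⇒m<n∨m≡n β<p | ℕ.m≤n⇒m<n∨m≡n γ<p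
      ... | inj₂ eα | _       | _       = case-α e eα
      ... | inj₁ _  | inj₂ eβ | _       = case-β α γ eβ (rest₂ e eβ) ex ez
      ... | inj₁ _  | inj₁ _  | inj₂ eγ = case-γ e eγ
      ... | inj₁ a  | inj₁ b  | inj₁ c  = finish (core-mixed α β γ a b c e) e
      three : T ≡ 3 ℕ.* p → Rainbow p (suc k) x y z
      three e = core⇒rainbow (core-full h odd (s≤s z≤n)) total q₁ q₂ q₃
          (≡.trans (cong (ℕ._+ q₁ ℕ.* p) (top α top-α α<p)) ex)
          (≡.trans (cong (ℕ._+ q₂ ℕ.* p) (top β top-β β<p)) ey)
          (≡.trans (cong (ℕ._+ q₃ ℕ.* p) (top γ top-γ γ<p)) ez) size
        where
        full : p ℕ.+ p ℕ.+ p ℕ.≤ T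
        full = ℕ.≤-reflexive (≡.trans (ar₃ p) (sym e))
        top-γ : p ℕ.≤ suc γ
        top-γ = ℕ.+-cancelˡ-≤ (p ℕ.+ p) _ _ (ℕ.≤-trans full (ℕ.+-monoˡ-≤ (suc γ) (ℕ.+-mono-≤ α<p β<p)))
        αβ : p ℕ.+ p ℕ.≤ suc α ℕ.+ suc β
        αβ = ℕ.+-cancelʳ-≤ p _ _ (ℕ.≤-trans full (ℕ.+-monoʳ-≤ (suc α ℕ.+ suc β) γ<p))
        top-β : p ℕ.≤ suc β
        top-β = ℕ.+-cancelˡ-≤ p _ _ (ℕ.≤-trans αβ (ℕ.+-monoˡ-≤ (suc β) α<p))
        top-α : p ℕ.≤ suc α
        top-α = ℕ.+-cancelʳ-≤ p _ _ (ℕ.≤-trans αβ (ℕ.+-monoʳ-≤ (suc α) β<p))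
        top : ∀ δ → p ℕ.≤ suc δ → δ ℕ.< p → 2 ℕ.* h ≡ δ
        top δ p≤ δ<p = ℕ.suc-injective (≡.trans odd (ℕ.≤-antisym p≤ δ<p))
        ar : ∀ h → 2 ℕ.* h ℕ.+ 2 ℕ.* h ℕ.+ 2 ℕ.* h ℕ.+ 3 ≡ 3 ℕ.* (1 ℕ.+ 2 ℕ.* h)
        ar = ℕSolver.solve-∀
        total : 2 ℕ.* h ℕ.+ 2 ℕ.* h ℕ.+ 2 ℕ.* h ℕ.+ 3 ≡ 3 ℕ.* p
        total = ≡.trans (ar h) (cong (3 ℕ.*_) odd)
      split : p Div.∣ T → Rainbow p (suc k) x y z
      split (Div.divides 0 ())
      split (Div.divides 1 e) = finish (core₀ α β γ (≡.trans (ar₂ α β γ) (≡.trans e (ℕ.*-identityˡ p)))) e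
      split (Div.divides 2 e) = two e
      split (Div.divides 3 e) = three e
      split (Div.divides (suc (suc (suc (suc t)))) e) = ⊥-elim (ℕ.<⇒≱ (s≤s T≤3p)
        (subst (suc (3 ℕ.* p) ℕ.≤_) (sym e) (ℕ.+-mono-≤ {1} {p} (s≤s z≤n)
          (ℕ.*-monoˡ-≤ p {3} {suc (suc (suc t))} (s≤s (s≤s (s≤s z≤n)))))))

  -- Both directions in terms of remainders.

  module Necessity (p-1 : ℕ) (pr : Prime (suc p-1)) (5≤p : 5 ℕ.≤ suc p-1) where
    open Residues p-1

    residue-class : ∀ m {r s} → m ℕ.% p ≡ r → + r ≈ s → + m ≈ s
    residue-class m e h = ≈-trans (≈-sym (%≈ m)) (≈-trans (≡⇒≈ (cong +_ e)) h)

    minus : ∀ i → i ℕ.≤ p → + (p ℕ.∸ i) ≈ - + i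
    minus i i≤p = shift (≈-trans (≡⇒≈ (cong +_ (ℕ.m∸n+n≡m i≤p))) p≈0) (id₁ (+ (p ℕ.∸ i)) (+ i))
      where
      id₁ : ∀ d i → d - - i ≡ d + i - 0ℤ
      id₁ = solve-∀

    zero-class : ∀ m → m ℕ.% p ≡ 0 → + m ≈ 0ℤ
    zero-class m e = residue-class m e ≈-refl

    minus-class : ∀ m i → i ℕ.≤ 5 → m ℕ.% p ≡ p ℕ.∸ i → + m ≈ - + i
    minus-class m i i≤5 e = residue-class m e (minus i (ℕ.≤-trans i≤5 5≤p))

    1≤5 : 1 ℕ.≤ 5
    1≤5 = s≤s z≤n

    2≤5 : 2 ℕ.≤ 5
    2≤5 = s≤s (s≤s z≤n)

    3≤5 : 3 ℕ.≤ 5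
    3≤5 = s≤s (s≤s (s≤s z≤n))

    module _ {k x y z : ℕ} (size : x ℕ.+ y ℕ.+ z ℕ.+ 3 ≡ p ℕ.^ k) (R : Rainbow p k x y z) where
      open Obstruction p-1 pr 5≤p size (proj₁ R) (proj₂ R)

      excluded₁ : y ℕ.% p ≡ p ℕ.∸ 2 → x ℕ.% p ≡ 0 → z ℕ.% p ≡ p ℕ.∸ 1 → ⊥
      excluded₁ ey ex ez = not-case₁ (zero-class x ex) (+-cong (≈-refl {1ℤ}) (minus-class y 2 2≤5 ey))
        (minus-class z 1 1≤5 ez)

      excluded₂ : y ≡ 0 → x ℕ.% p ≡ p ℕ.∸ 1 → z ℕ.% p ≡ p ℕ.∸ 2 → ⊥
      excluded₂ ey ex ez = not-case₂ ey (minus-class x 1 1≤5 ex) (minus-class z 2 2≤5 ez)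

      excluded₃ : y ≡ 1 → x ℕ.% p ≡ p ℕ.∸ 1 → z ℕ.% p ≡ p ℕ.∸ 3 → ⊥
      excluded₃ ey ex ez =
        OneMiddleLeaf.impossible ey (minus-class x 1 1≤5 ex) (minus-class z 3 3≤5 ez)

  module Equivalence (p-2 k x y z : ℕ) (pr : Prime (suc (suc p-2))) (5≤p : 5 ℕ.≤ suc (suc p-2))
    (size : x ℕ.+ y ℕ.+ z ℕ.+ 3 ≡ suc (suc p-2) ℕ.^ suc k) where
    open Residues (suc p-2)
    open Construction p-2 pr 5≤p k
    open Necessity (suc p-2) pr 5≤p

    necessary : Rainbow p (suc k) x y z → ¬ Exceptional y (x ℕ.% p) (y ℕ.% p) (z ℕ.% p)
    necessary R exceptional = go exceptional
      where
      ar : ∀ x y z → z ℕ.+ y ℕ.+ x ℕ.+ 3 ≡ x ℕ.+ y ℕ.+ z ℕ.+ 3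
      ar = ℕSolver.solve-∀
      size′ = ≡.trans (ar x y z) size
      -- The second alternative of each exceptional case is the first one for the reversed
      -- caterpillar.
      R′ = reverse (suc p-2) R
      go : Exceptional y (x ℕ.% p) (y ℕ.% p) (z ℕ.% p) → ⊥
      go (inj₁ (ey , inj₁ (ex , ez)))        = excluded₁ size R ey ex ez
      go (inj₁ (ey , inj₂ (ex , ez)))        = excluded₁ size′ R′ ey ez ex
      go (inj₂ (inj₁ (ey , inj₁ (ex , ez)))) = excluded₂ size R ey ex ez
      go (inj₂ (inj₁ (ey , inj₂ (ex , ez)))) = excluded₂ size′ R′ ey ez ex
      go (inj₂ (inj₂ (ey , inj₁ (ex , ez)))) = excluded₃ size R ey ex ez
      go (inj₂ (inj₂ (ey , inj₂ (ex , ez)))) = excluded₃ size′ R′ ey ez ex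

    sufficient : ¬ Exceptional y (x ℕ.% p) (y ℕ.% p) (z ℕ.% p) → Rainbow p (suc k) x y z
    sufficient = construct size (x ℕ.% p) (y ℕ.% p) (z ℕ.% p) (x ℕ./ p) (y ℕ./ p) (z ℕ./ p)
      (ℕ.m%n<n x p) (ℕ.m%n<n y p) (ℕ.m%n<n z p)
      (sym (ℕ.m≡m%n+[m/n]*n x p)) (sym (ℕ.m≡m%n+[m/n]*n y p)) (sym (ℕ.m≡m%n+[m/n]*n z p))

open import Data.Nat using (ℕ; _+_; _∸_; _^_; _≤_; _<_; zero; suc; s≤s)
open import Data.Nat.Primality using (Prime)
open import Data.Product using (_×_)
open import Data.Sum using (_⊎_)
open import Relation.Nullary using (¬_)
open import Relation.Binary.PropositionalEquality using (_≡_)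
open import Function.Bundles using (_⇔_; mk⇔)

theorem5 : (p k x y z : ℕ) → Prime p → 5 ≤ p → 1 < k →
    x + y + z + 3 ≡ p ^ k →
    Rainbow p k x y z ⇔
    (¬ ( (res p y ≡ p ∸ 2 × ((res p x ≡ 0 × res p z ≡ p ∸ 1) ⊎ (res p x ≡ p ∸ 1 × res p z ≡ 0)))
    ⊎ (y ≡ 0 × ((res p x ≡ p ∸ 1 × res p z ≡ p ∸ 2) ⊎ (res p x ≡ p ∸ 2 × res p z ≡ p ∸ 1)))
    ⊎ (y ≡ 1 × ((res p x ≡ p ∸ 1 × res p z ≡ p ∸ 3) ⊎ (res p x ≡ p ∸ 3 × res p z ≡ p ∸ 1))) ))
theorem5 (suc (suc p-2)) (suc k) x y z pr 5≤p _ size =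
  mk⇔ (necessary p-2 k x y z pr 5≤p size) (sufficient p-2 k x y z pr 5≤p size)
  where open Caterpillars.Equivalence
theorem5 zero          k    x y z pr ()
theorem5 (suc zero)    k    x y z pr (s≤s ())
theorem5 (suc (suc _)) zero x y z pr _ ()
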